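{- Let $q$ be an odd prime power not in the set $\{3, 5, 7, 9, 11, 13, 17, 19, 23, 25, 27, 29, 31, 37, 41, 43, 47, 49, 53, 59, 61, 67, 71, 73, 79, 81, 83, 89, 97, 101, 103, 109, 113, 121, 125, 127, 131, 137, 139, 149, 151, 157, 169, 173, 181, 191, 197, 199, 211, 229, 239, 241, 269, 281, 307, 311, 331, 337, 349, 361, 373, 379, 389, 409, 419, 421, 461, 463, 509, 521, 529, 569, 571, 601, 617, 631, 659, 661, 701, 761, 769, 841, 859, 881, 911, 1009, 1021, 1231, 1289, 1301, 1331, 1429, 1609, 1741, 1849, 1861, 2029, 2281, 2311, 2729, 3541\}$. Then for every $\beta\in\mathbb{F}_q^*$ there exists a $2$-primitive $\xi\in\mathbb{F}_{q^2}$ with $\mathrm{Tr}(\xi)=\beta$.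
   Context: An element of $\mathbb{F}_{q^2}$ is $2$-primitive if its multiplicative order is $(q^2-1)/2$. $\mathrm{Tr}(\xi)=\xi+\xi^q$. -}

module Defs where

open import Level using (Level; _⊔_) renaming (suc to lsuc)
open import Data.Nat using (ℕ; _≤_; _<_)
open import Data.Nat.Primality using (Prime)
open import Data.Fin using (Fin)
open import Data.List using (List; []; _∷_)
open import Data.Product using (∃; ∃₂; _×_)
open import Relation.Nullary using (¬_)
open import Relation.Binary.PropositionalEquality as ≡ using (_≡_)
open import Algebra.Bundles using (CommutativeRing; Semiring)
open import Function.Bundles using (Bijection)
import Data.Nat as ℕ

record FiniteField (n : ℕ) (c ℓ : Level) : Set (lsuc (c ⊔ ℓ)) where
  field
    commRing : CommutativeRing c ℓ
  open CommutativeRing commRing public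
  field
    0≉1     : ¬ (0# ≈ 1#)
    inverse : ∀ x → ¬ (x ≈ 0#) → ∃ λ y → x * y ≈ 1#
    enum    : Bijection (≡.setoid (Fin n)) setoid

IsOddPrimePower : ℕ → Set
IsOddPrimePower q = (q ℕ.% 2 ≡ 1) × ∃₂ λ p k → Prime p × 1 ≤ k × q ≡ p ℕ.^ k

module _ {n : ℕ} {c ℓ : Level} (K : FiniteField n c ℓ) where
  open FiniteField K
  open import Algebra.Definitions.RawSemiring (Semiring.rawSemiring semiring) using (_^_)

  HasMultOrder : Carrier → ℕ → Set ℓ
  HasMultOrder ξ m = (0 < m) × (ξ ^ m ≈ 1#) × (∀ k → 0 < k → k < m → ¬ (ξ ^ k ≈ 1#))

  TwoPrimitive : ℕ → Carrier → Set ℓ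
  TwoPrimitive q ξ = HasMultOrder ξ ((q ℕ.* q ℕ.∸ 1) ℕ./ 2)

  Tr : ℕ → Carrier → Carrier
  Tr q ξ = ξ + ξ ^ q

  -- Membership in F_q ⊆ F_{q^2}: the fixed points of Frobenius x ↦ x^q
  InBaseField : ℕ → Carrier → Set ℓ
  InBaseField q β = β ^ q ≈ β

exceptions : List ℕ
exceptions = 3 ∷ 5 ∷ 7 ∷ 9 ∷ 11 ∷ 13 ∷ 17 ∷ 19 ∷ 23 ∷ 25 ∷ 27 ∷ 29 ∷ 31 ∷ 37 ∷ 41 ∷ 43 ∷ 47 ∷ 49 ∷ 53 ∷ 59 ∷ 61 ∷ 67 ∷ 71 ∷ 73 ∷ 79 ∷ 81 ∷ 83 ∷ 89 ∷ 97 ∷ 101 ∷ 103 ∷ 109 ∷ 113 ∷ 121 ∷ 125 ∷ 127 ∷ 131 ∷ 137 ∷ 139 ∷ 149 ∷ 151 ∷ 157 ∷ 169 ∷ 173 ∷ 181 ∷ 191 ∷ 197 ∷ 199 ∷ 211 ∷ 229 ∷ 239 ∷ 241 ∷ 269 ∷ 281 ∷ 307 ∷ 311 ∷ 331 ∷ 337 ∷ 349 ∷ 361 ∷ 373 ∷ 379 ∷ 389 ∷ 409 ∷ 419 ∷ 421 ∷ 461 ∷ 463 ∷ 509 ∷ 521 ∷ 529 ∷ 569 ∷ 571 ∷ 601 ∷ 617 ∷ 631 ∷ 659 ∷ 661 ∷ 701 ∷ 761 ∷ 769 ∷ 841 ∷ 859 ∷ 881 ∷ 911 ∷ 1009 ∷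 1021 ∷ 1231 ∷ 1289 ∷ 1301 ∷ 1331 ∷ 1429 ∷ 1609 ∷ 1741 ∷ 1849 ∷ 1861 ∷ 2029 ∷ 2281 ∷ 2311 ∷ 2729 ∷ 3541 ∷ []

-- Put n = q² − 1 and let T be the line Tr ξ = β.  For a prime ℓ ∣ n the function
-- θ_ℓ(ξ) = ℓ·[ξ^(n/ℓ) = 1] − 1 is the sum of the characters of order ℓ; θ₂ and θ₄ are the sums of
-- the characters of orders 2 and 4, and θ_d is the product of the θ's belonging to d.  An element is
-- 2-primitive iff it is a square, not a fourth power and not an ℓ-th power for odd ℓ ∣ n, so everything
-- depends on U_d = Σ_{ξ ∈ T} θ_d(ξ).
--
-- Complex characters are avoided: (x, y) ↦ θ_d(x/y) is a positive semidefinite integer kernel, whence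
-- U_d² ≤ φ(d) Σ_{x, y ∈ T} θ_d(x/y) by Cauchy–Schwarz.  A ratio r ∉ F_q occurs exactly once in T and a
-- ratio r ∈ F_q ∖ {1} never, so the last sum is at most φ(d) q, and equals φ(d) if d ∣ q + 1.  Therefore
-- |U_d| ≤ φ(d) √q for d ≠ 1, and |U_d| ≤ φ(d) if moreover d ∣ q + 1.
--
-- Möbius inversion over some odd primes es ∣ n and a sieve over the remaining ones ss then give an explicit
-- sufficient inequality.  It is evaluated for each admitted prime power below 15401; for larger q it follows from
-- comparing the odd prime divisors of n with the sequence of odd primes, taking ss = [] if there
-- are more than 16 of them.
module Submission where

open import Defs
open import Level using (Level)
open import Data.Bool using (Bool; true; false; _∧_; _∨_; not; T; if_then_else_)
open import Data.Bool.Properties using (T-∧; T-∨; T-≡)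
open import Data.Empty using (⊥; ⊥-elim)
open import Data.Fin as Fin using (Fin; zero; suc; toℕ; fromℕ; inject₁; punchIn)
open import Data.Fin.Permutation using (Permutation; permutation)
import Data.Fin.Properties as Fin
open import Data.Integer as ℤ using (ℤ; +_; 0ℤ; 1ℤ)
import Data.Integer.Properties as ℤ
open import Data.Integer.Tactic.RingSolver using (solve-∀)
open import Data.List using (List; []; _∷_; _++_; length; take; filter; upTo)
open import Data.List.Properties using (++-identityʳ)
open import Data.List.Membership.Propositional using (_∈_; _∉_)
open import Data.List.Membership.Propositional.Properties using (∈-++⁻; ∈-upTo⁺; ∈-filter⁺)
open import Data.List.Relation.Unary.All as All using (All; []; _∷_)
import Data.List.Relation.Unary.All.Properties as All
open import Data.List.Relation.Unary.AllPairs as AllPairs using (AllPairs; []; _∷_)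
import Data.List.Relation.Unary.AllPairs.Properties as AllPairs
open import Data.List.Relation.Unary.Any using (here; there)
open import Data.Nat as ℕ using (ℕ; zero; suc; _∸_; _!)
open import Data.Nat.Properties as ℕ using (_!*_!≢0)
open import Data.Nat.Combinatorics using (_C_; nCk≡n!/k![n-k]!; k![n∸k]!∣n!; nCn≡1)
open import Data.Nat.Coprimality as Coprime using (Coprime; coprime-Bézout; coprime-divisor)
open import Data.Nat.Divisibility hiding (quotient)
open import Data.Nat.DivMod using (m/n*n≡m; m≡m%n+[m/n]*n; m%n<n)
open import Data.Nat.GCD using (gcd; gcd[m,n]∣m; gcd[m,n]∣n; gcd-GCD; module Bézout)
open import Data.Nat.ListAction using (product)
open import Data.Nat.Primality
open import Data.Nat.Primality.Factorisation using (factorise)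
open import Data.Nat.Solver using (module +-*-Solver)
open import Data.Product using (∃; _×_; _,_; proj₁; proj₂)
open import Data.Sum using (_⊎_; inj₁; inj₂)
open import Data.Unit using (⊤; tt)
open import Function using (_∘_; id)
open import Function.Bundles using (Bijection; Equivalence)
open import Relation.Binary.PropositionalEquality as ≡ using (_≡_; _≢_; cong; cong₂; subst)
open import Relation.Nullary using (¬_; Dec; yes; no; does; contradiction; ¬?; _×-dec_)
open import Relation.Nullary.Decidable using (map′)
open import Relation.Unary using (Decidable)
import Algebra.Bundles
open Algebra.Bundles using (CommutativeMonoid)
import Algebra.Properties.CommutativeMonoid.Sum as MonoidSum

-- No generator of the multiplicative group is used. Cardinalities come from a squeeze instead: root
-- counting gives upper bounds whose product is exactly the known total, so all of them are
-- attained. This fixes the size of F_q, of every trace fibre and of the group of ℓ-th roots of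
-- unity, and shows that x ↦ x^(n/ℓ) reaches all of the latter.
--
-- Positivity of the kernels comes from Gram vectors: ℓ·θ_ℓ(x/y) is the inner product of ℓ e_u - 1
-- and ℓ e_v - 1, indexed by the ℓ-th roots of unity, where u = x^(n/ℓ) and v = y^(n/ℓ).
--
-- The cutoff 15401 is governed by seven odd primes. There the general sieve estimate asks for q >
-- 123² = 15129, and the product of the first seven odd primes is too small to guarantee this; from
-- eight primes on the product alone suffices. Below the cutoff √q is rounded up to a multiple of
-- 1/32 and the sharper bound for d ∣ q + 1 is exploited; above it √q is rounded up to an integer
-- and that advantage is given away.

-- Sums over the elements of a finite field

module Enumeration {N : ℕ} {c ℓ : Level} (K : FiniteField N c ℓ) where
  open FiniteField K using (Carrier; _≈_; setoid; enum) renaming (sym to ≈-sym; trans to ≈-trans)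

  elt : Fin N → Carrier
  elt = Bijection.to enum

  idx : Carrier → Fin N
  idx x = proj₁ (Bijection.surjective enum x)

  elt-idx : ∀ x → elt (idx x) ≈ x
  elt-idx x = proj₂ (Bijection.surjective enum x) ≡.refl

  idx-cong : ∀ {x y} → x ≈ y → idx x ≡ idx y
  idx-cong x≈y = Bijection.injective enum
    (≈-trans (elt-idx _) (≈-trans x≈y (≈-sym (elt-idx _))))

  idx-injective : ∀ {x y} → idx x ≡ idx y → x ≈ y
  idx-injective {x} {y} e =
    ≈-trans (≈-sym (elt-idx x)) (≈-trans (Bijection.cong enum e) (elt-idx y))

  idx-elt : ∀ i → idx (elt i) ≡ i
  idx-elt i = Bijection.injective enum (elt-idx (elt i))

  infix 4 _≟_
  abstract
    _≟_ : ∀ x y → Dec (x ≈ y)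
    x ≟ y = map′ idx-injective idx-cong (idx x Fin.≟ idx y)

  module Sum {a b} (M : CommutativeMonoid a b) where
    private
      module M = CommutativeMonoid M
      module S = MonoidSum M

    abstract
      ∑ : (Carrier → M.Carrier) → M.Carrier
      ∑ f = S.sum (f ∘ elt)

      ∑≡sum : ∀ f → ∑ f ≡ S.sum (f ∘ elt)
      ∑≡sum f = ≡.refl

      ∑-cong : ∀ {f g} → (∀ x → f x M.≈ g x) → ∑ f M.≈ ∑ g
      ∑-cong e = S.sum-cong-≋ (e ∘ elt)

      ∑-distrib-∙ : ∀ f g → ∑ (λ x → f x M.∙ g x) M.≈ ∑ f M.∙ ∑ g
      ∑-distrib-∙ f g = S.∑-distrib-+ (f ∘ elt) (g ∘ elt)

      ∑-ε : ∑ (λ _ → M.ε) M.≈ M.ε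
      ∑-ε = S.sum-replicate-zero N

      ∑-reindex : (f : Carrier → M.Carrier) → (∀ {x y} → x ≈ y → f x M.≈ f y) →
        (φ ψ : Carrier → Carrier) → (∀ {x y} → x ≈ y → φ x ≈ φ y) → (∀ {x y} → x ≈ y → ψ x ≈ ψ y) →
        (∀ x → φ (ψ x) ≈ x) → (∀ x → ψ (φ x) ≈ x) → ∑ f M.≈ ∑ (f ∘ φ)
      ∑-reindex f f-cong φ ψ φ-cong ψ-cong φψ ψφ = M.trans (S.sum-permute (f ∘ elt) π)
        (S.sum-cong-≋ λ i → f-cong (elt-idx (φ (elt i))))
        where
        inv : ∀ (φ ψ : Carrier → Carrier) → (∀ {x y} → x ≈ y → φ x ≈ φ y) → (∀ x → φ (ψ x) ≈ x) →
              ∀ i → idx (φ (elt (idx (ψ (elt i))))) ≡ i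
        inv φ ψ φ-cong φψ i = ≡.trans (idx-cong (≈-trans (φ-cong (elt-idx _)) (φψ _))) (idx-elt i)
        π : Permutation N N
        π = permutation (λ i → idx (φ (elt i))) (λ i → idx (ψ (elt i)))
              (inv φ ψ φ-cong φψ) (inv ψ φ ψ-cong ψφ)

      ∑-support : (f : Carrier → M.Carrier) → (∀ {x y} → x ≈ y → f x M.≈ f y) →
        ∀ a → (∀ x → ¬ x ≈ a → f x M.≈ M.ε) → ∑ f M.≈ f a
      ∑-support f f-cong a f≈ε = M.trans (lemma (idx a) (f ∘ elt) vanish) (f-cong (elt-idx a))
        where
        vanish : ∀ i → i ≢ idx a → f (elt i) M.≈ M.ε
        vanish i i≢ = f≈ε _ λ e → i≢ (≡.trans (≡.sym (idx-elt i)) (idx-cong e))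
        lemma : ∀ {m} (i : Fin m) (t : Fin m → M.Carrier) → (∀ j → j ≢ i → t j M.≈ M.ε) → S.sum t M.≈ t i
        lemma {suc m} i t z = M.trans (S.sum-remove {i = i} t)
          (M.trans (M.∙-congˡ (M.trans (S.sum-cong-≋ λ j → z (punchIn i j) (Fin.punchInᵢ≢i i j)) (S.sum-replicate-zero m)))
                   (M.identityʳ _))

      ∑-induction : ∀ {p} (P : M.Carrier → Set p) → P M.ε → (∀ {x y} → P x → P y → P (x M.∙ y)) →
        ∀ {f} → (∀ x → P (f x)) → P (∑ f)
      ∑-induction P Pε P∙ {f} Pf = lemma (f ∘ elt) (Pf ∘ elt)
        where
        lemma : ∀ {m} (t : Fin m → M.Carrier) → (∀ i → P (t i)) → P (S.sum t)
        lemma {zero}  t Pt = Pε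
        lemma {suc m} t Pt = P∙ (Pt zero) (lemma (t ∘ suc) (Pt ∘ suc))

-- Binomial coefficients modulo a prime

prime>1 : ∀ {p} → Prime p → 1 ℕ.< p
prime>1 {p} pp = ℕ.nonTrivial⇒n>1 p {{prime⇒nonTrivial pp}}

prime∤! : ∀ {p} → Prime p → ∀ {m} → m ℕ.< p → ¬ p ∣ m !
prime∤! pp {zero} m<p p∣1 = ℕ.<⇒≢ (prime>1 pp) (≡.sym (∣1⇒≡1 p∣1))
prime∤! pp {suc m} m<p p∣ with euclidsLemma (suc m) (m !) pp p∣
... | inj₁ p∣sm = ℕ.<⇒≱ m<p (∣⇒≤ p∣sm)
... | inj₂ p∣m! = prime∤! pp (ℕ.<-trans (ℕ.n<1+n m) m<p) p∣m!

-- In p! = (p C k) · k! · (p - k)! the prime divides the left side but neither factorial on the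
-- right.
prime∣C : ∀ {p} → Prime p → ∀ {k} → 0 ℕ.< k → k ℕ.< p → p ∣ p C k
prime∣C {p} pp {k} 0<k k<p with euclidsLemma (p C k) (k ! ℕ.* (p ∸ k) !) pp p∣
  where
  instance _ = k !* (p ∸ k) !≢0
  p∣p! : p ∣ p !
  p∣p! = go p (prime⇒nonZero pp) where
    go : ∀ m → ℕ.NonZero m → m ∣ m !
    go (suc m) _ = m∣m*n (m !)
  eq : (p C k) ℕ.* (k ! ℕ.* (p ∸ k) !) ≡ p !
  eq = ≡.trans (cong (ℕ._* (k ! ℕ.* (p ∸ k) !)) (nCk≡n!/k![n-k]! (ℕ.<⇒≤ k<p))) (m/n*n≡m (k![n∸k]!∣n! (ℕ.<⇒≤ k<p)))
  p∣ : p ∣ (p C k) ℕ.* (k ! ℕ.* (p ∸ k) !)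
  p∣ = subst (p ∣_) (≡.sym eq) p∣p!
... | inj₁ h = h
... | inj₂ h with euclidsLemma (k !) ((p ∸ k) !) pp h
... | inj₁ h′ = contradiction h′ (prime∤! pp k<p)
... | inj₂ h′ = contradiction h′ (prime∤! pp (ℕ.∸-monoʳ-< 0<k (ℕ.<⇒≤ k<p)))

-- Finite fields: Fermat's theorem, characteristic, Frobenius

module FieldTheory {N : ℕ} {c ℓ : Level} (K : FiniteField N c ℓ) where
  open FiniteField K hiding (zero) public
  open Enumeration K public
  open import Algebra.Properties.CommutativeSemiring.Exp commutativeSemiring public
    using (_^_; ^-distrib-*; ^-homo-*; ^-assocʳ; ^-congˡ; ^-congʳ)
  open import Algebra.Properties.Semiring.Mult semiring using (×1-homo-*; ×-assoc-*; ×-congʳ; ×-congˡ; ×-assocˡ) renaming (_×_ to infixr 8 _·_)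
  open import Algebra.Properties.Ring ring public
    using (-‿distribˡ-*; -‿distribʳ-*; -1*x≈-x; x[y-z]≈xy-xz; [y-z]x≈yx-zx)
  open import Algebra.Properties.Group +-group public using ()
    renaming (∙-cancelˡ to +-cancelˡ; ∙-cancelʳ to +-cancelʳ; ⁻¹-involutive to -‿involutive; inverseʳ-unique to +-inverseʳ-unique; ⁻¹-injective to -‿injective; x∙y⁻¹≈ε⇒x≈y to x-y≈0⇒x≈y)
  open import Algebra.Properties.AbelianGroup +-abelianGroup public using () renaming (⁻¹-∙-comm to -‿+-comm)
  open import Relation.Binary.Reasoning.Setoid setoid

  module ∑+ = Sum +-commutativeMonoid
  module ∏ = Sum *-commutativeMonoid

  _⁻¹[_] : ∀ x → ¬ x ≈ 0# → Carrier
  x ⁻¹[ x≉0 ] = proj₁ (inverse x x≉0)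

  *-inverse : ∀ {x} (x≉0 : ¬ x ≈ 0#) → x * (x ⁻¹[ x≉0 ]) ≈ 1#
  *-inverse x≉0 = proj₂ (inverse _ x≉0)

  cancel-inverse : ∀ {x} (x≉0 : ¬ x ≈ 0#) y → x ⁻¹[ x≉0 ] * (x * y) ≈ y
  cancel-inverse {x} x≉0 y = begin
    x ⁻¹[ x≉0 ] * (x * y)  ≈⟨ *-assoc _ _ _ ⟨
    x ⁻¹[ x≉0 ] * x * y    ≈⟨ *-congʳ (*-comm _ _) ⟩
    x * x ⁻¹[ x≉0 ] * y    ≈⟨ *-congʳ (*-inverse x≉0) ⟩
    1# * y                 ≈⟨ *-identityˡ y ⟩
    y                      ∎

  cancel-inverse′ : ∀ {x} (x≉0 : ¬ x ≈ 0#) y → x * (x ⁻¹[ x≉0 ] * y) ≈ y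
  cancel-inverse′ {x} x≉0 y = begin
    x * (x ⁻¹[ x≉0 ] * y)  ≈⟨ *-assoc _ _ _ ⟨
    x * x ⁻¹[ x≉0 ] * y    ≈⟨ *-congʳ (*-inverse x≉0) ⟩
    1# * y                 ≈⟨ *-identityˡ y ⟩
    y                      ∎

  *-cancelˡ : ∀ {x} → ¬ x ≈ 0# → ∀ {y z} → x * y ≈ x * z → y ≈ z
  *-cancelˡ {x} x≉0 {y} {z} e = begin
    y                      ≈⟨ cancel-inverse x≉0 y ⟨
    x ⁻¹[ x≉0 ] * (x * y)  ≈⟨ *-congˡ e ⟩
    x ⁻¹[ x≉0 ] * (x * z)  ≈⟨ cancel-inverse x≉0 z ⟩
    z                      ∎

  *-cancelʳ : ∀ {x} → ¬ x ≈ 0# → ∀ {y z} → y * x ≈ z * x → y ≈ z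
  *-cancelʳ x≉0 e = *-cancelˡ x≉0 (trans (*-comm _ _) (trans e (*-comm _ _)))

  *-nonzero : ∀ {x y} → ¬ x ≈ 0# → ¬ y ≈ 0# → ¬ x * y ≈ 0#
  *-nonzero x≉0 y≉0 e = y≉0 (*-cancelˡ x≉0 (trans e (sym (zeroʳ _))))

  zero-product : ∀ {x y} → x * y ≈ 0# → x ≈ 0# ⊎ y ≈ 0#
  zero-product {x} {y} e with x ≟ 0#
  ... | yes x≈0 = inj₁ x≈0
  ... | no  x≉0 = inj₂ (*-cancelˡ x≉0 (trans e (sym (zeroʳ _))))

  1≉0 : ¬ 1# ≈ 0#
  1≉0 e = 0≉1 (sym e)

  ^-nonzero : ∀ {x} → ¬ x ≈ 0# → ∀ m → ¬ x ^ m ≈ 0#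
  ^-nonzero x≉0 zero    = 1≉0
  ^-nonzero x≉0 (suc m) = *-nonzero x≉0 (^-nonzero x≉0 m)

  1^n≈1 : ∀ m → 1# ^ m ≈ 1#
  1^n≈1 zero    = refl
  1^n≈1 (suc m) = trans (*-identityˡ _) (1^n≈1 m)

  ^-* : ∀ x m k → x ^ (m ℕ.* k) ≈ (x ^ m) ^ k
  ^-* x m k = sym (^-assocʳ x m k)

  ^-comm : ∀ x m k → (x ^ m) ^ k ≈ (x ^ k) ^ m
  ^-comm x m k = trans (^-assocʳ x m k) (trans (^-congʳ x (ℕ.*-comm m k)) (^-* x k m))

  ∏-const : ∀ a → ∏.∑ (λ _ → a) ≈ a ^ N
  ∏-const a = trans (reflexive (∏.∑≡sum (λ _ → a))) (S.sum-replicate N) where import Algebra.Properties.CommutativeMonoid.Sum *-commutativeMonoid as S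

  ∑-const : ∀ a → ∑+.∑ (λ _ → a) ≈ N · a
  ∑-const a = trans (reflexive (∑+.∑≡sum (λ _ → a))) (S.sum-replicate N) where import Algebra.Properties.CommutativeMonoid.Sum +-commutativeMonoid as S

  -- Translation by 1 permutes the field, so the sum of all elements equals itself plus N · 1.
  N×≈0 : N · 1# ≈ 0#
  N×≈0 = +-cancelʳ S (N · 1#) 0# (begin
    N · 1# + S                          ≈⟨ +-congʳ (∑-const 1#) ⟨
    ∑+.∑ (λ _ → 1#) + ∑+.∑ (λ x → x)     ≈⟨ ∑+.∑-distrib-∙ (λ _ → 1#) (λ x → x) ⟨
    ∑+.∑ (λ x → 1# + x)  ≈⟨ ∑+.∑-reindex (λ x → x) (λ e → e) (λ x → 1# + x) (λ x → - 1# + x) +-congˡ +-congˡ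
                                             (λ x → trans (sym (+-assoc _ _ _)) (trans (+-congʳ (-‿inverseʳ 1#)) (+-identityˡ x)))
                                             (λ x → trans (sym (+-assoc _ _ _)) (trans (+-congʳ (-‿inverseˡ 1#)) (+-identityˡ x))) ⟨
    S                                   ≈⟨ +-identityˡ S ⟨
    0# + S                              ∎)
    where S = ∑+.∑ (λ x → x)

  private
    unless : ∀ {x} → Dec (x ≈ 0#) → Carrier → Carrier → Carrier
    unless (yes _) a b = a
    unless (no  _) a b = b

    unless-cong : ∀ {x y} (d : Dec (x ≈ 0#)) (d′ : Dec (y ≈ 0#)) → x ≈ y → ∀ {a b b′} → b ≈ b′ → unless d a b ≈ unless d′ a b′
    unless-cong (yes _) (yes _) _ _ = refl
    unless-cong (no _)  (no _)  _ e = e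
    unless-cong (yes p) (no ¬p) e _ = contradiction (trans (sym e) p) ¬p
    unless-cong (no ¬p) (yes p) e _ = contradiction (trans e p) ¬p

  -- Multiplication by a nonzero `a` permutes the nonzero elements, so it does not change their
  -- product. The products here run over the whole field: `g` replaces the factor 0 by 1, `h` is the
  -- factor by which `g` changes under x ↦ a x, and `k` supplies the one `a` that `h` lacks at zero.
  -- Hence a^N = ∏ h · ∏ k = 1 · a.
  x^N≈x : ∀ x → x ^ N ≈ x
  x^N≈x a with a ≟ 0#
  -- `idx 0#` inhabits `Fin N`, so N is positive; 0^0 would be 1.
  ... | yes a≈0 = go N (Fin.toℕ<n (idx 0#)) where
    go : ∀ n → toℕ (idx 0#) ℕ.< n → a ^ n ≈ a
    go (suc n) _ = trans (*-congʳ a≈0) (trans (zeroˡ _) (sym a≈0))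
  ... | no  a≉0 = begin
    a ^ N                      ≈⟨ ∏-const a ⟨
    ∏.∑ (λ _ → a)              ≈⟨ ∏.∑-cong (λ x → hk (x ≟ 0#)) ⟨
    ∏.∑ (λ x → h x * k x)      ≈⟨ ∏.∑-distrib-∙ h k ⟩
    ∏.∑ h * ∏.∑ k              ≈⟨ *-cong ∏h≈1 ∏k≈a ⟩
    1# * a                     ≈⟨ *-identityˡ a ⟩
    a                          ∎
    where
    g h k : Carrier → Carrier
    g x = unless (x ≟ 0#) 1# x
    h x = unless (x ≟ 0#) 1# a
    k x = unless (x ≟ 0#) a 1#
    hk : ∀ {x} (d : Dec (x ≈ 0#)) → unless d 1# a * unless d a 1# ≈ a
    hk (yes _) = *-identityˡ a
    hk (no _)  = *-identityʳ a
    g≉0 : ∀ {x} (d : Dec (x ≈ 0#)) → ¬ unless d 1# x ≈ 0#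
    g≉0 (yes _) = 1≉0
    g≉0 (no ¬p) = ¬p
    ga : ∀ x (d : Dec (x ≈ 0#)) (d′ : Dec (a * x ≈ 0#)) → unless d′ 1# (a * x) ≈ unless d 1# a * unless d 1# x
    ga x (yes _) (yes _) = sym (*-identityˡ 1#)
    ga x (no _)  (no _)  = refl
    ga x (yes p) (no ¬p) = contradiction (trans (*-congˡ p) (zeroʳ a)) ¬p
    ga x (no ¬p) (yes p) = contradiction p (*-nonzero a≉0 ¬p)
    ∏g≉0 : ¬ ∏.∑ g ≈ 0#
    ∏g≉0 = ∏.∑-induction (λ x → ¬ x ≈ 0#) 1≉0 *-nonzero (λ x → g≉0 (x ≟ 0#))
    ∏h≈1 : ∏.∑ h ≈ 1#
    ∏h≈1 = *-cancelʳ ∏g≉0 (begin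
      ∏.∑ h * ∏.∑ g               ≈⟨ ∏.∑-distrib-∙ h g ⟨
      ∏.∑ (λ x → h x * g x)       ≈⟨ ∏.∑-cong (λ x → ga x (x ≟ 0#) (a * x ≟ 0#)) ⟨
      ∏.∑ (λ x → g (a * x))  ≈⟨ ∏.∑-reindex g (λ e → unless-cong (_ ≟ 0#) (_ ≟ 0#) e e) (a *_) (a ⁻¹[ a≉0 ] *_) *-congˡ *-congˡ
                                       (cancel-inverse′ a≉0) (cancel-inverse a≉0) ⟨
      ∏.∑ g                       ≈⟨ *-identityˡ _ ⟨
      1# * ∏.∑ g                  ∎)
    ∏k≈a : ∏.∑ k ≈ a
    ∏k≈a = trans (∏.∑-support k (λ e → unless-cong (_ ≟ 0#) (_ ≟ 0#) e refl) 0# (λ x x≉0 → k1 (x ≟ 0#) x≉0)) (k0 (0# ≟ 0#))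
      where
      k1 : ∀ {x} (d : Dec (x ≈ 0#)) → ¬ x ≈ 0# → unless d a 1# ≈ 1#
      k1 (yes p) ¬p = contradiction p ¬p
      k1 (no _)  _  = refl
      k0 : (d : Dec (0# ≈ 0#)) → unless d a 1# ≈ a
      k0 (yes _) = refl
      k0 (no ¬p) = contradiction refl ¬p

  x^n≈1 : ∀ {n} → N ≡ suc n → ∀ {x} → ¬ x ≈ 0# → x ^ n ≈ 1#
  x^n≈1 {n} eq {x} x≉0 = *-cancelˡ x≉0 (begin
    x ^ suc n  ≈⟨ ^-congʳ x (≡.sym eq) ⟩
    x ^ N      ≈⟨ x^N≈x x ⟩
    x          ≈⟨ *-identityʳ x ⟨
    x * 1#     ∎)

  ·-zeroʳ : ∀ j → j · 0# ≈ 0#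
  ·-zeroʳ zero    = refl
  ·-zeroʳ (suc j) = trans (+-identityˡ _) (·-zeroʳ j)

  ×1-^ : ∀ m k → (m ℕ.^ k) · 1# ≈ (m · 1#) ^ k
  ×1-^ m zero    = +-identityʳ 1#
  ×1-^ m (suc k) = trans (×1-homo-* m (m ℕ.^ k)) (*-congˡ (×1-^ m k))

  ^-zero : ∀ {x} k → x ^ k ≈ 0# → x ≈ 0#
  ^-zero zero    e = contradiction e 1≉0
  ^-zero (suc k) e with zero-product e
  ... | inj₁ e′ = e′
  ... | inj₂ e′ = ^-zero k e′

  module Characteristic {p} (p-prime : Prime p) {k} (N≡p^k : N ≡ p ℕ.^ k) where

    p×1≈0 : p · 1# ≈ 0#
    p×1≈0 = ^-zero k (trans (sym (×1-^ p k)) (trans (×-congˡ (≡.sym N≡p^k)) N×≈0))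

    p∣m⇒m×x≈0 : ∀ {m} → p ∣ m → ∀ x → m · x ≈ 0#
    p∣m⇒m×x≈0 {m} (divides j eq) x = begin
      m · x                 ≈⟨ ×-congˡ eq ⟩
      (j ℕ.* p) · x         ≈⟨ ×-assocˡ x j p ⟨
      j · (p · x)           ≈⟨ ×-congʳ j (begin
        p · x                 ≈⟨ ×-congʳ p (*-identityˡ x) ⟨
        p · (1# * x)          ≈⟨ ×-assoc-* p 1# x ⟨
        (p · 1#) * x          ≈⟨ *-congʳ p×1≈0 ⟩
        0# * x                ≈⟨ zeroˡ x ⟩
        0#                    ∎) ⟩
      j · 0#                ≈⟨ ·-zeroʳ j ⟩
      0#                    ∎

    frobenius : ∀ x y → (x + y) ^ p ≈ x ^ p + y ^ p
    frobenius x y = go p ≡.refl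
      where
      import Algebra.Properties.CommutativeSemiring.Binomial commutativeSemiring as B
      import Algebra.Properties.CommutativeMonoid.Sum +-commutativeMonoid as S
      -- The exponent is generalised to a variable so that it can be split as a successor, which
      -- separates the two outer binomial terms from the middle ones.
      go : ∀ m → m ≡ p → (x + y) ^ m ≈ x ^ m + y ^ m
      go zero eq = contradiction (≡.sym eq) (ℕ.≢-nonZero⁻¹ p {{prime⇒nonZero p-prime}})
      go (suc m) eq = begin
        (x + y) ^ suc m                              ≈⟨ B.theorem (suc m) x y ⟩
        t zero + S.sum (t ∘ suc)                     ≈⟨ +-cong first (S.sum-init-last (t ∘ suc)) ⟩
        y ^ suc m + (S.sum (λ i → t (suc (inject₁ i))) + t (suc (fromℕ m)))
          ≈⟨ +-congˡ (+-cong (trans (S.sum-cong-≋ middle) (S.sum-replicate-zero m)) last) ⟩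
        y ^ suc m + (0# + x ^ suc m)                 ≈⟨ +-congˡ (+-identityˡ _) ⟩
        y ^ suc m + x ^ suc m                        ≈⟨ +-comm _ _ ⟩
        x ^ suc m + y ^ suc m                        ∎
        where
        t : Fin (suc (suc m)) → Carrier
        t = B.binomialTerm x y (suc m)
        first : t zero ≈ y ^ suc m
        first = trans (+-identityʳ _) (*-identityˡ _)
        middle : ∀ i → t (suc (inject₁ i)) ≈ 0#
        middle i = p∣m⇒m×x≈0 (subst (_∣ suc m C suc (toℕ (inject₁ i))) eq
          (prime∣C (subst Prime (≡.sym eq) p-prime) (ℕ.s≤s ℕ.z≤n)
            (ℕ.s≤s (subst (ℕ._< m) (≡.sym (Fin.toℕ-inject₁ i)) (Fin.toℕ<n i))))) _
        last : t (suc (fromℕ m)) ≈ x ^ suc m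
        last = begin
          (suc m C suc (toℕ (fromℕ m))) · (x ^ suc (toℕ (fromℕ m)) * y ^ (m ∸ toℕ (fromℕ m)))
            ≡⟨ cong (λ j → (suc m C suc j) · (x ^ suc j * y ^ (m ∸ j))) (Fin.toℕ-fromℕ m) ⟩
          (suc m C suc m) · (x ^ suc m * y ^ (m ∸ m))
            ≡⟨ cong₂ (λ a b → a · (x ^ suc m * y ^ b)) (nCn≡1 (suc m)) (ℕ.n∸n≡0 m) ⟩
          1 · (x ^ suc m * 1#)  ≈⟨ +-identityʳ _ ⟩
          x ^ suc m * 1#        ≈⟨ *-identityʳ _ ⟩
          x ^ suc m             ∎

    frobenius-iterate : ∀ j x y → (x + y) ^ (p ℕ.^ j) ≈ x ^ (p ℕ.^ j) + y ^ (p ℕ.^ j)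
    frobenius-iterate zero x y = trans (*-identityʳ _) (sym (+-cong (*-identityʳ x) (*-identityʳ y)))
    frobenius-iterate (suc j) x y = begin
      (x + y) ^ (p ℕ.* p ℕ.^ j)                   ≈⟨ ^-* _ p (p ℕ.^ j) ⟩
      ((x + y) ^ p) ^ (p ℕ.^ j)                   ≈⟨ ^-congˡ (p ℕ.^ j) (frobenius x y) ⟩
      (x ^ p + y ^ p) ^ (p ℕ.^ j)                 ≈⟨ frobenius-iterate j _ _ ⟩
      (x ^ p) ^ (p ℕ.^ j) + (y ^ p) ^ (p ℕ.^ j)   ≈⟨ +-cong (^-* x p (p ℕ.^ j)) (^-* y p (p ℕ.^ j)) ⟨
      x ^ (p ℕ.^ suc j) + y ^ (p ℕ.^ suc j)       ∎

-- Integer indicators, integer sums and root counting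

⟦_⟧ : ∀ {a} {P : Set a} → Dec P → ℤ
⟦ yes _ ⟧ = 1ℤ
⟦ no  _ ⟧ = 0ℤ

⟦⟧-cong : ∀ {a b} {P : Set a} {Q : Set b} (d : Dec P) (e : Dec Q) → (P → Q) → (Q → P) → ⟦ d ⟧ ≡ ⟦ e ⟧
⟦⟧-cong (yes p) (yes q) f g = ≡.refl
⟦⟧-cong (no ¬p) (no ¬q) f g = ≡.refl
⟦⟧-cong (yes p) (no ¬q) f g = contradiction (f p) ¬q
⟦⟧-cong (no ¬p) (yes q) f g = contradiction (g q) ¬p

⟦⟧-true : ∀ {a} {P : Set a} (d : Dec P) → P → ⟦ d ⟧ ≡ 1ℤ
⟦⟧-true (yes _) p = ≡.refl
⟦⟧-true (no ¬p) p = contradiction p ¬p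

⟦⟧-false : ∀ {a} {P : Set a} (d : Dec P) → ¬ P → ⟦ d ⟧ ≡ 0ℤ
⟦⟧-false (yes p) ¬p = contradiction p ¬p
⟦⟧-false (no _)  ¬p = ≡.refl

0≤⟦⟧ : ∀ {a} {P : Set a} (d : Dec P) → 0ℤ ℤ.≤ ⟦ d ⟧
0≤⟦⟧ (yes _) = ℤ.+≤+ ℕ.z≤n
0≤⟦⟧ (no _)  = ℤ.≤-refl

⟦⟧-≤ : ∀ {a b} {P : Set a} {Q : Set b} (d : Dec P) (e : Dec Q) → (P → Q) → ⟦ d ⟧ ℤ.≤ ⟦ e ⟧
⟦⟧-≤ (yes p) e f = ℤ.≤-reflexive (≡.sym (⟦⟧-true e (f p)))
⟦⟧-≤ (no _)  e f = 0≤⟦⟧ e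

⟦⟧-idem : ∀ {a} {P : Set a} (d : Dec P) → ⟦ d ⟧ ℤ.* ⟦ d ⟧ ≡ ⟦ d ⟧
⟦⟧-idem (yes _) = ≡.refl
⟦⟧-idem (no _)  = ≡.refl

⟦⟧-*-congˡ : ∀ {a} {P : Set a} (d : Dec P) {x y : ℤ} → (P → x ≡ y) → ⟦ d ⟧ ℤ.* x ≡ ⟦ d ⟧ ℤ.* y
⟦⟧-*-congˡ (yes p) f = cong (1ℤ ℤ.*_) (f p)
⟦⟧-*-congˡ (no _)  f = ≡.refl

module IntegerSums {N : ℕ} {c ℓ : Level} (K : FiniteField N c ℓ) where
  open FieldTheory K
  open Sum ℤ.+-0-commutativeMonoid public
  import Algebra.Properties.Semiring.Sum (Algebra.Bundles.CommutativeSemiring.semiring ℤ.+-*-commutativeSemiring) as S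
  import Algebra.Properties.CommutativeMonoid.Sum ℤ.+-0-commutativeMonoid as M

  Respects : (Carrier → ℤ) → Set _
  Respects f = ∀ {x y} → x ≈ y → f x ≡ f y

  ∑-*ˡ : ∀ a f → ∑ (λ x → a ℤ.* f x) ≡ a ℤ.* ∑ f
  ∑-*ˡ a f = ≡.trans (∑≡sum _) (≡.trans (≡.sym (S.*-distribˡ-sum a (f ∘ elt))) (cong (λ z → a ℤ.* z) (≡.sym (∑≡sum f))))

  ∑-*ʳ : ∀ a f → ∑ (λ x → f x ℤ.* a) ≡ ∑ f ℤ.* a
  ∑-*ʳ a f = ≡.trans (∑≡sum _) (≡.trans (≡.sym (S.*-distribʳ-sum a (f ∘ elt))) (cong (λ z → z ℤ.* a) (≡.sym (∑≡sum f))))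

  ∑-neg : ∀ f → ∑ (λ x → ℤ.- f x) ≡ ℤ.- ∑ f
  ∑-neg f = ≡.trans (∑-cong λ x → ≡.sym (ℤ.-1*i≡-i (f x))) (≡.trans (∑-*ˡ ℤ.-1ℤ f) (ℤ.-1*i≡-i (∑ f)))

  ∑-minus : ∀ f g → ∑ (λ x → f x ℤ.- g x) ≡ ∑ f ℤ.- ∑ g
  ∑-minus f g = ≡.trans (∑-distrib-∙ f (ℤ.-_ ∘ g)) (cong (λ z → ∑ f ℤ.+ z) (∑-neg g))

  ∑-swap : ∀ (f : Carrier → Carrier → ℤ) → ∑ (λ x → ∑ (λ y → f x y)) ≡ ∑ (λ y → ∑ (λ x → f x y))
  ∑-swap f = ≡.trans (unfold f) (≡.trans (M.∑-comm (λ i j → f (elt i) (elt j))) (≡.sym (unfold (λ y x → f x y))))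
    where
    unfold : ∀ f → ∑ (λ x → ∑ (λ y → f x y)) ≡ M.sum (λ i → M.sum (λ j → f (elt i) (elt j)))
    unfold f = ≡.trans (∑≡sum _) (M.sum-cong-≗ λ i → ∑≡sum (f (elt i)))

  ∑-mono : ∀ {f g} → (∀ x → f x ℤ.≤ g x) → ∑ f ℤ.≤ ∑ g
  ∑-mono {f} {g} f≤g = ≡.subst₂ ℤ._≤_ (≡.sym (∑≡sum f)) (≡.sym (∑≡sum g)) (lemma (f≤g ∘ elt))
    where
    lemma : ∀ {m} {s t : Fin m → ℤ} → (∀ i → s i ℤ.≤ t i) → M.sum s ℤ.≤ M.sum t
    lemma {zero}  e = ℤ.≤-refl
    lemma {suc m} e = ℤ.+-mono-≤ (e zero) (lemma (e ∘ suc))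

  ∑-nonneg : ∀ {f} → (∀ x → 0ℤ ℤ.≤ f x) → 0ℤ ℤ.≤ ∑ f
  ∑-nonneg = ∑-induction (0ℤ ℤ.≤_) ℤ.≤-refl ℤ.+-mono-≤

  ∑-1 : ∑ (λ _ → 1ℤ) ≡ + N
  ∑-1 = ≡.trans (∑≡sum _) (≡.trans (M.sum-replicate N) (lemma N))
    where
    open import Algebra.Definitions.RawMonoid (Algebra.Bundles.CommutativeMonoid.rawMonoid ℤ.+-0-commutativeMonoid) renaming (_×_ to _·_)
    lemma : ∀ m → m · 1ℤ ≡ + m
    lemma zero    = ≡.refl
    lemma (suc m) = cong ℤ.suc (lemma m)

  ≟-respˡ : ∀ {x y z} → x ≈ y → ⟦ x ≟ z ⟧ ≡ ⟦ y ≟ z ⟧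
  ≟-respˡ e = ⟦⟧-cong (_ ≟ _) (_ ≟ _) (trans (sym e)) (trans e)

  ≟-cong : ∀ {x y z w} → x ≈ y → z ≈ w → ⟦ x ≟ z ⟧ ≡ ⟦ y ≟ w ⟧
  ≟-cong e e′ = ⟦⟧-cong (_ ≟ _) (_ ≟ _) (λ h → trans (sym e) (trans h e′)) (λ h → trans e (trans h (sym e′)))

  ∑-δ : ∀ a (f : Carrier → ℤ) → Respects f → ∑ (λ x → ⟦ x ≟ a ⟧ ℤ.* f x) ≡ f a
  ∑-δ a f f-resp = ≡.trans
    (∑-support _ (λ e → cong₂ ℤ._*_ (≟-respˡ e) (f-resp e)) a
      (λ x x≉a → cong (λ z → z ℤ.* f x) (⟦⟧-false (x ≟ a) x≉a)))
    (≡.trans (cong (λ z → z ℤ.* f a) (⟦⟧-true (a ≟ a) refl)) (ℤ.*-identityˡ (f a)))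

  ∑-δ₁ : ∀ a → ∑ (λ x → ⟦ x ≟ a ⟧) ≡ 1ℤ
  ∑-δ₁ a = ≡.trans (∑-cong λ x → ≡.sym (ℤ.*-identityʳ ⟦ x ≟ a ⟧)) (∑-δ a (λ _ → 1ℤ) (λ _ → ≡.refl))

  ∑-δ₁′ : ∀ a → ∑ (λ x → ⟦ a ≟ x ⟧) ≡ 1ℤ
  ∑-δ₁′ a = ≡.trans (∑-cong λ x → ⟦⟧-cong (a ≟ x) (x ≟ a) sym sym) (∑-δ₁ a)

  any? : ∀ {p} {P : Carrier → Set p} → (∀ {x y} → x ≈ y → P x → P y) → Decidable P → Dec (∃ P)
  any? {P = P} resp P? with Fin.any? (λ i → P? (elt i))
  ... | yes (i , p) = yes (elt i , p)
  ... | no  ¬p      = no λ (x , px) → ¬p (idx x , resp (sym (elt-idx x)) px)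

  -- A function together with a Horner form of exact degree: the innermost constant is the leading
  -- coefficient and must be nonzero. Working with functions avoids any equality of coefficient
  -- lists.
  data Polynomial : ℕ → (Carrier → Carrier) → Set (c Level.⊔ ℓ) where
    const  : ∀ {f a} → ¬ a ≈ 0# → (∀ x → f x ≈ a) → Polynomial 0 f
    horner : ∀ {d f g} a → Polynomial d g → (∀ x → f x ≈ a + x * g x) → Polynomial (suc d) f

  Polynomial-cong : ∀ {d f} → Polynomial d f → ∀ {x y} → x ≈ y → f x ≈ f y
  Polynomial-cong (const _ e) x≈y = trans (e _) (sym (e _))
  Polynomial-cong (horner a g e) x≈y =
    trans (e _) (trans (+-congˡ (*-cong x≈y (Polynomial-cong g x≈y))) (sym (e _)))

  monomial : ∀ d → Polynomial d (_^ d)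
  monomial zero    = const 1≉0 (λ _ → refl)
  monomial (suc d) = horner 0# (monomial d) (λ _ → sym (+-identityˡ _))

  module _ where
    open import Relation.Binary.Reasoning.Setoid setoid
    open import Algebra.Solver.Ring.NaturalCoefficients.Default commutativeSemiring using (solve; _:+_; _:*_; _:=_)

    -- The second summand has smaller degree, so the leading coefficient of the first one survives.
    add-scaled : ∀ {d g h} r → Polynomial (suc d) g → Polynomial d h → Polynomial (suc d) (λ x → g x + r * h x)
    add-scaled r (horner {g = g₁} a G eg) (const {a = b} b≉0 eh) = horner (a + r * b) G λ x →
      trans (+-cong (eg x) (*-congˡ (eh x)))
        (solve 5 (λ a x g r b → (a :+ x :* g) :+ r :* b := (a :+ r :* b) :+ x :* g) refl a x (g₁ x) r b)
    add-scaled r (horner {g = g₁} a G eg) (horner {g = h₁} b H eh) = horner (a + r * b) (add-scaled r G H) λ x →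
      trans (+-cong (eg x) (*-congˡ (eh x)))
        (solve 6 (λ a x g r b h → (a :+ x :* g) :+ r :* (b :+ x :* h) := (a :+ r :* b) :+ x :* (g :+ r :* h)) refl a x (g₁ x) r b (h₁ x))

    -- Synthetic division. If f = a + x g and g = g(r) + (x - r) h, then writing x = (x - r) + r
    -- gives the quotient g + r h.
    divide : ∀ {d f} → Polynomial (suc d) f → ∀ r → ∃ λ g → Polynomial d g × (∀ x → f x ≈ f r + (x - r) * g x)
    divide {zero} {f} (horner {g = g} a G@(const {a = b} b≉0 eg) ef) r = g , G , λ x → begin
      f x                          ≈⟨ ef x ⟩
      a + x * g x                  ≈⟨ +-congˡ (*-cong (x≈ x) (eg x)) ⟩
      a + ((x - r) + r) * b  ≈⟨ solve 4 (λ a e r b → a :+ (e :+ r) :* b := (a :+ r :* b) :+ e :* b) refl a (x - r) r b ⟩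
      (a + r * b) + (x - r) * b  ≈⟨ +-cong (trans (+-congˡ (*-congˡ (sym (eg r)))) (sym (ef r))) (*-congˡ (sym (eg x))) ⟩
      f r + (x - r) * g x          ∎
      where
      x≈ : ∀ x → x ≈ (x - r) + r
      x≈ x = sym (trans (+-assoc _ _ _) (trans (+-congˡ (-‿inverseˡ r)) (+-identityʳ x)))
    divide {suc d} {f} (horner {g = g} a G ef) r with divide G r
    ... | h , H , eh = (λ x → g x + r * h x) , add-scaled r G H , λ x → begin
      f x                                                ≈⟨ ef x ⟩
      a + x * g x                                        ≈⟨ +-congˡ (*-congʳ (x≈ x)) ⟩
      a + ((x - r) + r) * g x  ≈⟨ solve 4 (λ a e r g → a :+ (e :+ r) :* g := (a :+ r :* g) :+ e :* g) refl a (x - r) r (g x) ⟩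
      (a + r * g x) + (x - r) * g x                      ≈⟨ +-congʳ (+-congˡ (*-congˡ (eh x))) ⟩
      (a + r * (g r + (x - r) * h x)) + (x - r) * g x  ≈⟨ solve 6 (λ a r gr e h g → (a :+ r :* (gr :+ e :* h)) :+ e :* g := (a :+ r :* gr) :+ e :* (g :+ r :* h)) refl a r (g r) (x - r) (h x) (g x) ⟩
      (a + r * g r) + (x - r) * (g x + r * h x)          ≈⟨ +-congʳ (ef r) ⟨
      f r + (x - r) * (g x + r * h x)                    ∎
      where
      x≈ : ∀ x → x ≈ (x - r) + r
      x≈ x = sym (trans (+-assoc _ _ _) (trans (+-congˡ (-‿inverseˡ r)) (+-identityʳ x)))

  root-bound : ∀ {d f} → Polynomial d f → ∑ (λ x → ⟦ f x ≟ 0# ⟧) ℤ.≤ + d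
  root-bound (const a≉0 e) = ℤ.≤-reflexive
    (≡.trans (∑-cong λ x → ⟦⟧-false (_ ≟ 0#) λ h → a≉0 (trans (sym (e x)) h)) ∑-ε)
  root-bound {suc d} {f} p with any? (λ e → trans (sym (Polynomial-cong p e))) (λ x → f x ≟ 0#)
  ... | no ¬root = ℤ.≤-trans (ℤ.≤-reflexive
    (≡.trans (∑-cong λ x → ⟦⟧-false (_ ≟ 0#) λ h → ¬root (x , h)) ∑-ε)) (ℤ.+≤+ ℕ.z≤n)
  ... | yes (r , fr≈0) with divide p r
  ... | g , G , e = begin
    ∑ (λ x → ⟦ f x ≟ 0# ⟧)  ≤⟨ ∑-mono (λ x → bound x (f x ≟ 0#) (x ≟ r) (g x ≟ 0#)) ⟩
    ∑ (λ x → ⟦ x ≟ r ⟧ ℤ.+ ⟦ g x ≟ 0# ⟧)                   ≡⟨ ∑-distrib-∙ (λ x → ⟦ x ≟ r ⟧) (λ x → ⟦ g x ≟ 0# ⟧) ⟩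
    ∑ (λ x → ⟦ x ≟ r ⟧) ℤ.+ ∑ (λ x → ⟦ g x ≟ 0# ⟧)         ≤⟨ ℤ.+-mono-≤ (ℤ.≤-reflexive (∑-δ₁ r)) (root-bound G) ⟩
    + suc d                                                ∎
    where
    open ℤ.≤-Reasoning
    bound : ∀ x (a : Dec (f x ≈ 0#)) (b : Dec (x ≈ r)) (c : Dec (g x ≈ 0#)) → ⟦ a ⟧ ℤ.≤ ⟦ b ⟧ ℤ.+ ⟦ c ⟧
    bound x (no _)  b       c       = ℤ.+-mono-≤ (0≤⟦⟧ b) (0≤⟦⟧ c)
    bound x (yes _) (yes _) c       = ℤ.+-mono-≤ {1ℤ} {1ℤ} {0ℤ} ℤ.≤-refl (0≤⟦⟧ c)
    bound x (yes _) (no _)  (yes _) = ℤ.≤-refl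
    bound x (yes h) (no x≉r) (no gx≉0) = ⊥-elim (*-nonzero (λ z → x≉r (x-y≈0⇒x≈y x r z)) gx≉0
      (trans (sym (+-identityˡ _)) (trans (+-congʳ (sym fr≈0)) (trans (sym (e x)) h))))

1<prime-power : ∀ {p k} → Prime p → 1 ℕ.≤ k → 1 ℕ.< p ℕ.^ k
1<prime-power {p} {suc k} pp _ = ℕ.<-≤-trans (prime>1 pp)
  (ℕ.m≤m*n p (p ℕ.^ k) {{ℕ.m^n≢0 p k {{prime⇒nonZero pp}}}})

-- The field of q² elements over its subfield of q elements

module QuadraticExtension {c ℓ : Level} (q : ℕ) (q-odd : q ℕ.% 2 ≡ 1)
  {p k : ℕ} (p-prime : Prime p) (1≤k : 1 ℕ.≤ k) (q≡p^k : q ≡ p ℕ.^ k) (K : FiniteField (q ℕ.* q) c ℓ) where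

  open FieldTheory K public
  open IntegerSums K public
  open import Relation.Binary.Reasoning.Setoid setoid
  open import Algebra.Solver.CommutativeMonoid +-commutativeMonoid using (solve; _⊕_; _⊜_)
  open import Algebra.Properties.Semiring.Mult semiring using (×-homo-+; ×-congˡ; ×-congʳ; ×-assocˡ) renaming (_×_ to infixr 8 _·_)

  private
    q²≡ : q ℕ.* q ≡ p ℕ.^ (k ℕ.+ k)
    q²≡ = ≡.trans (cong₂ ℕ._*_ q≡p^k q≡p^k) (≡.sym (ℕ.^-distribˡ-+-* p k k))
    module C = Characteristic p-prime {k ℕ.+ k} q²≡

  1<q : 1 ℕ.< q
  1<q = subst (1 ℕ.<_) (≡.sym q≡p^k) (1<prime-power p-prime 1≤k)

  n : ℕ
  n = ℕ.pred (q ℕ.* q)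

  instance
    q-nonZero : ℕ.NonZero q
    q-nonZero = ℕ.>-nonZero (ℕ.<-trans ℕ.z<s 1<q)

  q²≡1+n : q ℕ.* q ≡ suc n
  q²≡1+n = ≡.sym (ℕ.suc-pred (q ℕ.* q) {{ℕ.m*n≢0 q q}})

  ^n≈1 : ∀ {x} → ¬ x ≈ 0# → x ^ n ≈ 1#
  ^n≈1 = x^n≈1 q²≡1+n

  Fr : Carrier → Carrier
  Fr x = x ^ q

  Fr-cong : ∀ {x y} → x ≈ y → Fr x ≈ Fr y
  Fr-cong = ^-congˡ q

  Fr-+ : ∀ x y → Fr (x + y) ≈ Fr x + Fr y
  Fr-+ x y = subst (λ m → (x + y) ^ m ≈ x ^ m + y ^ m) (≡.sym q≡p^k) (C.frobenius-iterate k x y)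

  Fr-* : ∀ x y → Fr (x * y) ≈ Fr x * Fr y
  Fr-* x y = ^-distrib-* x y q

  Fr-1 : Fr 1# ≈ 1#
  Fr-1 = 1^n≈1 q

  Fr-0 : Fr 0# ≈ 0#
  Fr-0 = +-cancelʳ (Fr 0#) (Fr 0#) 0# (trans (sym (Fr-+ 0# 0#)) (trans (Fr-cong (+-identityˡ 0#)) (sym (+-identityˡ _))))

  Fr-neg : ∀ x → Fr (- x) ≈ - Fr x
  Fr-neg x = +-inverseʳ-unique (Fr x) (Fr (- x)) (trans (sym (Fr-+ x (- x))) (trans (Fr-cong (-‿inverseʳ x)) Fr-0))

  Fr-minus : ∀ x y → Fr (x - y) ≈ Fr x - Fr y
  Fr-minus x y = trans (Fr-+ x (- y)) (+-congˡ (Fr-neg y))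

  Fr-Fr : ∀ x → Fr (Fr x) ≈ x
  Fr-Fr x = trans (^-assocʳ x q q) (x^N≈x x)

  -- As q is odd and q · 1 = 0, the relation 1 + 1 = 0 would give 1 = 1 + (q / 2)(1 + 1) = q · 1 =
  -- 0.
  1+1≉0 : ¬ 1# + 1# ≈ 0#
  1+1≉0 e = 1≉0 (begin
    1#                              ≈⟨ +-identityʳ 1# ⟨
    1# + 0#                         ≈⟨ +-congˡ (·-zeroʳ (q ℕ./ 2)) ⟨
    1# + (q ℕ./ 2) · 0#             ≈⟨ +-congˡ (×-congʳ (q ℕ./ 2) (trans (+-congˡ (+-identityʳ 1#)) e)) ⟨
    1# + (q ℕ./ 2) · (2 · 1#)       ≈⟨ +-cong (sym (+-identityʳ 1#)) (×-assocˡ 1# (q ℕ./ 2) 2) ⟩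
    1 · 1# + (q ℕ./ 2 ℕ.* 2) · 1#   ≈⟨ ×-homo-+ 1# 1 (q ℕ./ 2 ℕ.* 2) ⟨
    (1 ℕ.+ q ℕ./ 2 ℕ.* 2) · 1#  ≈⟨ ×-congˡ (≡.trans (cong (λ r → r ℕ.+ q ℕ./ 2 ℕ.* 2) (≡.sym q-odd)) (≡.sym (m≡m%n+[m/n]*n q 2))) ⟩
    q · 1#                          ≈⟨ C.p∣m⇒m×x≈0 (p∣q k 1≤k q≡p^k) 1# ⟩
    0#                              ∎)
    where
    p∣q : ∀ k → 1 ℕ.≤ k → q ≡ p ℕ.^ k → p ∣ q
    p∣q (suc k) _ eq = divides (p ℕ.^ k) (≡.trans eq (ℕ.*-comm p _))

  x≉-x : ∀ {x} → ¬ x ≈ 0# → ¬ x ≈ - x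
  x≉-x {x} x≉0 e = *-nonzero x≉0 1+1≉0 (begin
    x * (1# + 1#)    ≈⟨ distribˡ x 1# 1# ⟩
    x * 1# + x * 1#  ≈⟨ +-cong (*-identityʳ x) (*-identityʳ x) ⟩
    x + x            ≈⟨ +-congʳ e ⟩
    - x + x          ≈⟨ -‿inverseˡ x ⟩
    0#               ∎)

  Trace : Carrier → Carrier
  Trace x = x + Fr x

  Trace-cong : ∀ {x y} → x ≈ y → Trace x ≈ Trace y
  Trace-cong e = +-cong e (Fr-cong e)

  Trace-+ : ∀ x y → Trace (x + y) ≈ Trace x + Trace y
  Trace-+ x y = trans (+-congˡ (Fr-+ x y)) (solve 4 (λ a b c d → (a ⊕ b) ⊕ (c ⊕ d) ⊜ (a ⊕ c) ⊕ (b ⊕ d)) refl x y (Fr x) (Fr y))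

  Base : Carrier → Set ℓ
  Base x = Fr x ≈ x

  base? : ∀ x → Dec (Base x)
  base? x = Fr x ≟ x

  Base-resp : ∀ {x y} → x ≈ y → Base x → Base y
  Base-resp e h = trans (Fr-cong (sym e)) (trans h e)

  base?-cong : ∀ {x y} → x ≈ y → ⟦ base? x ⟧ ≡ ⟦ base? y ⟧
  base?-cong e = ⟦⟧-cong (base? _) (base? _) (Base-resp e) (Base-resp (sym e))

  Base-* : ∀ {x y} → Base x → Base y → Base (x * y)
  Base-* {x} {y} bx by = trans (Fr-* x y) (*-cong bx by)

  Base-⁻¹ : ∀ {x} → Base x → (x≉0 : ¬ x ≈ 0#) → Base (x ⁻¹[ x≉0 ])
  Base-⁻¹ {x} bx x≉0 = *-cancelˡ x≉0 (begin
    x * Fr (x ⁻¹[ x≉0 ])     ≈⟨ *-congʳ bx ⟨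
    Fr x * Fr (x ⁻¹[ x≉0 ])  ≈⟨ Fr-* _ _ ⟨
    Fr (x * x ⁻¹[ x≉0 ])     ≈⟨ Fr-cong (*-inverse x≉0) ⟩
    Fr 1#                    ≈⟨ Fr-1 ⟩
    1#                       ≈⟨ *-inverse x≉0 ⟨
    x * x ⁻¹[ x≉0 ]          ∎)

  Trace-base : ∀ x → Base (Trace x)
  Trace-base x = begin
    Fr (x + Fr x)      ≈⟨ Fr-+ x (Fr x) ⟩
    Fr x + Fr (Fr x)   ≈⟨ +-congˡ (Fr-Fr x) ⟩
    Fr x + x           ≈⟨ +-comm _ _ ⟩
    x + Fr x           ∎

  Trace-*-base : ∀ {r} → Base r → ∀ x → Trace (r * x) ≈ r * Trace x
  Trace-*-base {r} br x = begin
    r * x + Fr (r * x)   ≈⟨ +-congˡ (trans (Fr-* r x) (*-congʳ br)) ⟩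
    r * x + r * Fr x     ≈⟨ distribˡ r x (Fr x) ⟨
    r * (x + Fr x)       ∎

  -- The trace doubles elements of the base field, so c / 2 works.
  half : ∀ c → Base c → ∃ λ h → Trace h ≈ c
  half c bc = c * i , (begin
    c * i + Fr (c * i)           ≈⟨ +-congˡ (Base-* bc (Base-⁻¹ b2 1+1≉0)) ⟩
    c * i + c * i                ≈⟨ distribˡ c i i ⟨
    c * (i + i)  ≈⟨ *-congˡ (trans (+-cong (sym (*-identityˡ i)) (sym (*-identityˡ i))) (sym (distribʳ i 1# 1#))) ⟩
    c * ((1# + 1#) * i)          ≈⟨ *-congˡ (*-inverse 1+1≉0) ⟩
    c * 1#                       ≈⟨ *-identityʳ c ⟩
    c                            ∎)
    where
    i = (1# + 1#) ⁻¹[ 1+1≉0 ]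
    b2 : Base (1# + 1#)
    b2 = trans (Fr-+ 1# 1#) (+-cong Fr-1 Fr-1)

  #Base : ℤ
  #Base = ∑ (λ x → ⟦ base? x ⟧)

  #Trace : Carrier → ℤ
  #Trace c = ∑ (λ x → ⟦ Trace x ≟ c ⟧)

  -- The fibre over c is the kernel of the trace translated by one element of trace c.
  #Trace-base : ∀ c → Base c → #Trace c ≡ #Trace 0#
  #Trace-base c bc with half c bc
  ... | h , th = ≡.trans
    (∑-reindex (λ x → ⟦ Trace x ≟ c ⟧) (λ e → ≟-respˡ (Trace-cong e)) (_+ h) (_+ - h) +-congʳ +-congʳ
      (λ x → trans (+-assoc _ _ _) (trans (+-congˡ (-‿inverseˡ h)) (+-identityʳ x)))
      (λ x → trans (+-assoc _ _ _) (trans (+-congˡ (-‿inverseʳ h)) (+-identityʳ x))))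
    (∑-cong λ x → ⟦⟧-cong (_ ≟ _) (_ ≟ _)
      (λ e → +-cancelʳ c _ _ (trans (+-congˡ (sym th)) (trans (sym (Trace-+ x h)) (trans e (sym (+-identityˡ c))))))
      (λ e → trans (Trace-+ x h) (trans (+-cong e th) (+-identityˡ c))))

  -- Traces lie in the base field and the fibres over it are equally large; together these fibres
  -- partition the q² elements.
  #Base*#Trace : #Base ℤ.* #Trace 0# ≡ + (q ℕ.* q)
  #Base*#Trace = ≡.sym (≡.trans (≡.sym ∑-1) (≡.trans (∑-cong λ x → ≡.sym (∑-δ₁′ (Trace x)))
    (≡.trans (∑-swap λ x c → ⟦ Trace x ≟ c ⟧) (≡.trans (∑-cong fibre) (∑-*ʳ (#Trace 0#) (λ c → ⟦ base? c ⟧))))))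
    where
    fibre : ∀ c → #Trace c ≡ ⟦ base? c ⟧ ℤ.* #Trace 0#
    fibre c with base? c
    ... | yes bc = ≡.trans (#Trace-base c bc) (≡.sym (ℤ.*-identityˡ _))
    ... | no ¬bc = ≡.trans (∑-cong λ x → ⟦⟧-false (Trace x ≟ c) λ e → ¬bc (Base-resp e (Trace-base x))) ∑-ε

  private
    binomial : ∀ q → 1 ℕ.< q → ∀ a → Polynomial q (λ x → x ^ q + a * x)
    binomial (suc (suc m)) _ a = horner 0# (horner a (monomial m) λ _ → refl) λ x → begin
      x * (x * x ^ m) + a * x     ≈⟨ +-congˡ (*-comm a x) ⟩
      x * (x * x ^ m) + x * a     ≈⟨ distribˡ x _ _ ⟨
      x * (x * x ^ m + a)         ≈⟨ *-congˡ (+-comm _ _) ⟩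
      x * (a + x * x ^ m)         ≈⟨ +-identityˡ _ ⟨
      0# + x * (a + x * x ^ m)    ∎
    binomial (suc zero) (ℕ.s≤s ()) a

  #Base≤q : #Base ℤ.≤ + q
  #Base≤q = ℤ.≤-trans (ℤ.≤-reflexive (∑-cong λ x → ⟦⟧-cong (base? x) (Fr x + - 1# * x ≟ 0#)
      (λ e → trans (+-cong e (-1*x≈-x x)) (-‿inverseʳ x))
      (λ e → x-y≈0⇒x≈y (Fr x) x (trans (+-congˡ (sym (-1*x≈-x x))) e))))
    (root-bound (binomial q 1<q (- 1#)))

  #Trace≤q : #Trace 0# ℤ.≤ + q
  #Trace≤q = ℤ.≤-trans (ℤ.≤-reflexive (∑-cong λ x → ≟-respˡ {x + Fr x} {Fr x + 1# * x}
      (trans (+-comm x (Fr x)) (+-congˡ {Fr x} (sym (*-identityˡ x))))))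
    (root-bound (binomial q 1<q 1#))

  private
    -- This turns the root bounds for x^q - x and x^q + x into exact counts.
    factors-maximal : ∀ {a b m} .{{_ : ℕ.NonZero m}} → a ℤ.≤ + m → b ℤ.≤ + m → 0ℤ ℤ.≤ a → 0ℤ ℤ.≤ b → a ℤ.* b ≡ + (m ℕ.* m) → a ≡ + m
    factors-maximal {+ a} {+ b} {m} (ℤ.+≤+ a≤m) (ℤ.+≤+ b≤m) _ _ e = cong +_ (ℕ.≤-antisym a≤m (ℕ.*-cancelʳ-≤ m a m
      (ℕ.≤-trans (ℕ.≤-reflexive (≡.sym (ℤ.+-injective (≡.trans (ℤ.pos-* a b) e)))) (ℕ.*-monoʳ-≤ a b≤m))))

  #Base≡q : #Base ≡ + q
  #Base≡q = factors-maximal #Base≤q #Trace≤q (∑-nonneg λ x → 0≤⟦⟧ (base? x)) (∑-nonneg λ x → 0≤⟦⟧ (Trace x ≟ 0#)) #Base*#Trace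

  #Trace≡q : ∀ c → Base c → #Trace c ≡ + q
  #Trace≡q c bc = ≡.trans (#Trace-base c bc)
    (factors-maximal #Trace≤q #Base≤q (∑-nonneg λ x → 0≤⟦⟧ (Trace x ≟ 0#)) (∑-nonneg λ x → 0≤⟦⟧ (base? x))
      (≡.trans (ℤ.*-comm (#Trace 0#) #Base) #Base*#Trace))

  private
    [a-b]-[a-c] : ∀ a b c → (a - b) - (a - c) ≈ c - b
    [a-b]-[a-c] a b c = begin
      (a - b) - (a - c)           ≈⟨ +-congˡ (-‿+-comm a (- c)) ⟨
      (a - b) + (- a + - - c)     ≈⟨ +-congˡ (+-congˡ (-‿involutive c)) ⟩
      (a - b) + (- a + c)  ≈⟨ solve 4 (λ a b a′ c → (a ⊕ b) ⊕ (a′ ⊕ c) ⊜ (a ⊕ a′) ⊕ (c ⊕ b)) refl a (- b) (- a) c ⟩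
      (a - a) + (c - b)           ≈⟨ +-congʳ (-‿inverseʳ a) ⟩
      0# + (c - b)                ≈⟨ +-identityˡ _ ⟩
      c - b                       ∎

    [a-w]-[b-w] : ∀ a b w → (a - w) - (b - w) ≈ a - b
    [a-w]-[b-w] a b w = begin
      (a - w) - (b - w)           ≈⟨ +-congˡ (-‿+-comm b (- w)) ⟨
      (a - w) + (- b + - - w)     ≈⟨ +-congˡ (+-congˡ (-‿involutive w)) ⟩
      (a - w) + (- b + w)  ≈⟨ solve 4 (λ a w′ b′ w → (a ⊕ w′) ⊕ (b′ ⊕ w) ⊜ (a ⊕ b′) ⊕ (w′ ⊕ w)) refl a (- w) (- b) w ⟩
      (a - b) + (- w + w)         ≈⟨ +-congˡ (-‿inverseˡ w) ⟩
      (a - b) + 0#                ≈⟨ +-identityʳ _ ⟩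
      a - b                       ∎

  -- Ratios of two points of the line of trace β

  module TraceLine (β : Carrier) (β≉0 : ¬ β ≈ 0#) (β-base : Base β) where

    𝟙T : Carrier → ℤ
    𝟙T x = ⟦ Trace x ≟ β ⟧

    𝟙T-cong : ∀ {x y} → x ≈ y → 𝟙T x ≡ 𝟙T y
    𝟙T-cong e = ≟-respˡ (Trace-cong e)

    Trace-0 : ∀ {x} → x ≈ 0# → ¬ Trace x ≈ β
    Trace-0 e h = β≉0 (trans (sym h) (trans (Trace-cong e) (trans (+-congˡ Fr-0) (+-identityˡ 0#))))

    -- With s = Fr r the two conditions are the linear system x + y = β, r x + s y = β in x and y =
    -- Fr x. Its determinant is nonzero exactly because r is not fixed by Frobenius, and η is
    -- Cramer's solution for x. Frobenius exchanges r and s and so negates δ = r - s, which is why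
    -- Fr η is Cramer's solution for y.
    common-root : ∀ r → ¬ Base r → ∃ λ η → (Trace η ≈ β) × (Trace (r * η) ≈ β) ×
                  (∀ x → Trace x ≈ β → Trace (r * x) ≈ β → x ≈ η)
    common-root r r∉ = η , Tη , Trη , unique
      where
      s = Fr r
      δ = r - s
      δ≉0 : ¬ δ ≈ 0#
      δ≉0 e = r∉ (sym (x-y≈0⇒x≈y r s e))
      κ = β - s * β
      η = δ ⁻¹[ δ≉0 ] * κ
      δη : δ * η ≈ κ
      δη = cancel-inverse′ δ≉0 κ
      Frδ : Fr δ ≈ - δ
      Frδ = begin
        Fr (r - s)   ≈⟨ Fr-minus r s ⟩
        s - Fr s     ≈⟨ +-congˡ (-‿cong (Fr-Fr r)) ⟩
        s - r        ≈⟨ +-comm _ _ ⟩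
        - r + s      ≈⟨ +-congˡ (-‿involutive s) ⟨
        - r + - - s  ≈⟨ -‿+-comm r (- s) ⟩
        - (r - s)    ∎
      Frκ : Fr κ ≈ β - r * β
      Frκ = trans (Fr-minus β (s * β)) (+-cong β-base (-‿cong (trans (Fr-* s β) (*-cong (Fr-Fr r) β-base))))
      δFrη : δ * Fr η ≈ - (β - r * β)
      δFrη = begin
        δ * Fr η           ≈⟨ -‿involutive _ ⟨
        - - (δ * Fr η)     ≈⟨ -‿cong (-‿distribˡ-* δ (Fr η)) ⟩
        - (- δ * Fr η)     ≈⟨ -‿cong (*-congʳ Frδ) ⟨
        - (Fr δ * Fr η)    ≈⟨ -‿cong (Fr-* δ η) ⟨
        - Fr (δ * η)       ≈⟨ -‿cong (Fr-cong δη) ⟩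
        - Fr κ             ≈⟨ -‿cong Frκ ⟩
        - (β - r * β)      ∎
      Tη : Trace η ≈ β
      Tη = *-cancelˡ δ≉0 (begin
        δ * (η + Fr η)                 ≈⟨ distribˡ δ η (Fr η) ⟩
        δ * η + δ * Fr η               ≈⟨ +-cong δη δFrη ⟩
        (β - s * β) - (β - r * β)      ≈⟨ [a-b]-[a-c] β (s * β) (r * β) ⟩
        r * β - s * β                  ≈⟨ [y-z]x≈yx-zx β r s ⟨
        δ * β                          ∎)
      Trη : Trace (r * η) ≈ β
      Trη = *-cancelˡ δ≉0 (begin
        δ * (r * η + Fr (r * η))       ≈⟨ *-congˡ (+-congˡ (Fr-* r η)) ⟩
        δ * (r * η + s * Fr η)         ≈⟨ distribˡ δ _ _ ⟩
        δ * (r * η) + δ * (s * Fr η)   ≈⟨ +-cong (swap r η) (swap s (Fr η)) ⟩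
        r * (δ * η) + s * (δ * Fr η)   ≈⟨ +-cong (*-congˡ δη) (trans (*-congˡ δFrη) (sym (-‿distribʳ-* s _))) ⟩
        r * (β - s * β) - s * (β - r * β)  ≈⟨ +-cong (x[y-z]≈xy-xz r β (s * β)) (-‿cong (x[y-z]≈xy-xz s β (r * β))) ⟩
        (r * β - r * (s * β)) - (s * β - s * (r * β))  ≈⟨ +-congˡ (-‿cong (+-congˡ (-‿cong (swap′ s r β)))) ⟩
        (r * β - r * (s * β)) - (s * β - r * (s * β))  ≈⟨ [a-w]-[b-w] _ _ _ ⟩
        r * β - s * β                  ≈⟨ [y-z]x≈yx-zx β r s ⟨
        δ * β                          ∎)
        where
        swap′ : ∀ a b c → a * (b * c) ≈ b * (a * c)
        swap′ a b c = trans (sym (*-assoc a b c)) (trans (*-congʳ (*-comm a b)) (*-assoc b a c))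
        swap : ∀ a b → δ * (a * b) ≈ a * (δ * b)
        swap a b = swap′ δ a b
      unique : ∀ x → Trace x ≈ β → Trace (r * x) ≈ β → x ≈ η
      unique x Tx Trx = *-cancelˡ δ≉0 (trans (begin
        (r - s) * x                                  ≈⟨ [y-z]x≈yx-zx x r s ⟩
        -- Adding s · Fr x to both terms completes them to Trace (r x) and s · Trace x.
        r * x - s * x                                ≈⟨ [a-w]-[b-w] (r * x) (s * x) (- (s * Fr x)) ⟨
        (r * x - - (s * Fr x)) - (s * x - - (s * Fr x))  ≈⟨ +-cong (+-congˡ (-‿involutive _)) (-‿cong (+-congˡ (-‿involutive _))) ⟩
        (r * x + s * Fr x) - (s * x + s * Fr x)  ≈⟨ +-cong (+-congˡ (sym (Fr-* r x))) (-‿cong (sym (distribˡ s x (Fr x)))) ⟩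
        Trace (r * x) - s * Trace x                  ≈⟨ +-cong Trx (-‿cong (*-congˡ Tx)) ⟩
        κ                                            ∎) (sym δη))

    -- Counts the representations of r as a ratio of two points of the line.
    coincidences : Carrier → ℤ
    coincidences r = ∑ (λ η → 𝟙T (r * η) ℤ.* 𝟙T η)

    -- Off the base field `common-root` supplies exactly one point. For r in the base field the
    -- trace is r-linear, so two points of ratio r give r β = β: this leaves only r = 1, where all q
    -- points of the line count.
    coincidences-formula : ∀ r → coincidences r ≡ (1ℤ ℤ.- ⟦ base? r ⟧) ℤ.+ + q ℤ.* ⟦ r ≟ 1# ⟧
    coincidences-formula r with base? r
    ... | no r∉ = ≡.trans (≡.trans (∑-cong pointwise) (∑-δ₁ η))
        (≡.sym (cong (λ z → 1ℤ ℤ.+ z) (≡.trans (cong (λ z → + q ℤ.* z) (⟦⟧-false (r ≟ 1#) λ e → r∉ (Base-resp (sym e) Fr-1))) (ℤ.*-zeroʳ (+ q)))))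
      where
      η = proj₁ (common-root r r∉)
      Tη = proj₁ (proj₂ (common-root r r∉))
      Trη = proj₁ (proj₂ (proj₂ (common-root r r∉)))
      unique = proj₂ (proj₂ (proj₂ (common-root r r∉)))
      pointwise : ∀ x → 𝟙T (r * x) ℤ.* 𝟙T x ≡ ⟦ x ≟ η ⟧
      pointwise x with x ≟ η
      ... | yes e = cong₂ ℤ._*_ (⟦⟧-true (_ ≟ β) (trans (Trace-cong (*-congˡ e)) Trη)) (⟦⟧-true (_ ≟ β) (trans (Trace-cong e) Tη))
      ... | no x≉η with Trace (r * x) ≟ β | Trace x ≟ β
      ...   | yes a | yes b = contradiction (unique x b a) x≉η
      ...   | yes a | no  b = ≡.refl
      ...   | no  a | yes b = ≡.refl
      ...   | no  a | no  b = ≡.refl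
    ... | yes r∈ with r ≟ 1#
    ...   | yes r≈1 = ≡.trans (∑-cong λ x → ≡.trans (cong (λ z → z ℤ.* 𝟙T x) (𝟙T-cong (trans (*-congʳ r≈1) (*-identityˡ x)))) (⟦⟧-idem (_ ≟ β)))
        (≡.trans (#Trace≡q β β-base) (≡.sym (≡.trans (ℤ.+-identityˡ _) (ℤ.*-identityʳ (+ q)))))
    ...   | no r≉1 = ≡.trans (≡.trans (∑-cong pointwise) ∑-ε) (≡.sym (≡.trans (ℤ.+-identityˡ _) (ℤ.*-zeroʳ (+ q))))
      where
      pointwise : ∀ x → 𝟙T (r * x) ℤ.* 𝟙T x ≡ 0ℤ
      pointwise x with Trace (r * x) ≟ β | Trace x ≟ β
      ... | yes a | yes b = contradiction (*-cancelʳ β≉0 (trans (trans (*-congˡ (sym b)) (trans (sym (Trace-*-base r∈ x)) a)) (sym (*-identityˡ β)))) r≉1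
      ... | yes a | no  b = ≡.refl
      ... | no  a | yes b = ≡.refl
      ... | no  a | no  b = ≡.refl

-- Positive semidefinite integer kernels

-- Division made total by the default 0 at divisor 0, so that definitions by recursion over lists of
-- divisors need no proofs that the entries are nonzero.
quotient : ℕ → ℕ → ℕ
quotient m zero    = 0
quotient m (suc d) = m ℕ./ suc d

quotient-* : ∀ {m d} .{{_ : ℕ.NonZero d}} → d ∣ m → quotient m d ℕ.* d ≡ m
quotient-* {d = suc d} d∣m = m/n*n≡m d∣m

-- The order 1, 2 or 4 of the 2-part of a character. Higher powers of 2 never occur, since only
-- squares and fourth powers have to be told apart.
data TwoPart : Set where
  none two four : TwoPart

φ₂ : TwoPart → ℕ
φ₂ none = 1
φ₂ two  = 1
φ₂ four = 2

φ : List ℕ → ℕ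
φ []      = 1
φ (ℓ ∷ d) = (ℓ ∸ 1) ℕ.* φ d

module PositiveKernels {N : ℕ} {c ℓ : Level} (K : FiniteField N c ℓ) where
  open FieldTheory K
  open IntegerSums K

  Kernel : Set c
  Kernel = Carrier → Carrier → ℤ

  𝟙* : Carrier → ℤ
  𝟙* x = ⟦ ¬? (x ≟ 0#) ⟧

  𝟙*-cong : Respects 𝟙*
  𝟙*-cong e = ⟦⟧-cong (¬? (_ ≟ 0#)) (¬? (_ ≟ 0#)) (λ h z → h (trans e z)) (λ h z → h (trans (sym e) z))

  𝟙*-nonzero : ∀ {x} → ¬ x ≈ 0# → 𝟙* x ≡ 1ℤ
  𝟙*-nonzero {x} = ⟦⟧-true (¬? (x ≟ 0#))

  form : Kernel → (Carrier → ℤ) → (Carrier → ℤ) → ℤ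
  form M f g = ∑ λ x → ∑ λ y → (f x ℤ.* g y) ℤ.* M x y

  form-cong : ∀ {M M′ f f′ g g′} → (∀ x y → (f x ℤ.* g y) ℤ.* M x y ≡ (f′ x ℤ.* g′ y) ℤ.* M′ x y) → form M f g ≡ form M′ f′ g′
  form-cong e = ∑-cong λ x → ∑-cong λ y → e x y

  restrict : (Carrier → ℤ) → Carrier → ℤ
  restrict f x = 𝟙* x ℤ.* f x

  -- Only functions vanishing at 0 are tested: the Gram identity of `kernₚ` holds for nonzero
  -- arguments, whose powers are roots of unity.
  PSD : Kernel → Set c
  PSD M = ∀ f → 0ℤ ℤ.≤ form M (restrict f) (restrict f)

  0≤square : ∀ z → 0ℤ ℤ.≤ z ℤ.* z
  0≤square (+ m)      = ℤ.≤-trans (ℤ.+≤+ ℕ.z≤n) (ℤ.≤-reflexive (ℤ.pos-* m m))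
  0≤square ℤ.-[1+ m ] = ℤ.+≤+ ℕ.z≤n

  PSD-one : PSD (λ _ _ → 1ℤ)
  PSD-one f = ℤ.≤-trans (0≤square (∑ g)) (ℤ.≤-reflexive (≡.sym
    (≡.trans (∑-cong λ x → ≡.trans (∑-cong λ y → ℤ.*-identityʳ _) (∑-*ˡ (g x) g)) (∑-*ʳ (∑ g) g))))
    where g = restrict f

  -- Schur's product theorem, for a factor that is a nonnegative combination of squares away from 0.
  PSD-* : ∀ {M M′ : Kernel} D .{{_ : ℕ.NonZero D}} (w : Carrier → ℤ) (h : Carrier → Carrier → ℤ) → (∀ i → 0ℤ ℤ.≤ w i) →
    (∀ x y → ¬ x ≈ 0# → ¬ y ≈ 0# → + D ℤ.* M x y ≡ ∑ λ i → w i ℤ.* (h i x ℤ.* h i y)) →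
    PSD M′ → PSD (λ x y → M x y ℤ.* M′ x y)
  PSD-* {M} {M′} (suc D-1) w h 0≤w gram psd f = ℤ.*-cancelˡ-≤-pos 0ℤ _ (+ D) (begin
    + D ℤ.* 0ℤ                                                              ≡⟨ ℤ.*-zeroʳ (+ D) ⟩
    0ℤ  ≤⟨ ∑-nonneg (λ i → 0≤* (0≤w i) (psd (λ x → h i x ℤ.* f x))) ⟩
    ∑ (λ i → w i ℤ.* form M′ (g i) (g i))  ≡⟨ ∑-cong (λ i → ≡.trans (≡.sym (∑-*ˡ (w i) _)) (∑-cong λ x → ≡.sym (∑-*ˡ (w i) _))) ⟩
    ∑ (λ i → ∑ λ x → ∑ λ y → w i ℤ.* ((g i x ℤ.* g i y) ℤ.* M′ x y))  ≡⟨ ∑-swap (λ i x → ∑ λ y → w i ℤ.* ((g i x ℤ.* g i y) ℤ.* M′ x y)) ⟩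
    ∑ (λ x → ∑ λ i → ∑ λ y → w i ℤ.* ((g i x ℤ.* g i y) ℤ.* M′ x y))  ≡⟨ ∑-cong (λ x → ∑-swap (λ i y → w i ℤ.* ((g i x ℤ.* g i y) ℤ.* M′ x y))) ⟩
    ∑ (λ x → ∑ λ y → ∑ λ i → w i ℤ.* ((g i x ℤ.* g i y) ℤ.* M′ x y))  ≡⟨ ∑-cong (λ x → ∑-cong λ y → pointwise x y) ⟩
    ∑ (λ x → ∑ λ y → + D ℤ.* ((r x ℤ.* r y) ℤ.* (M x y ℤ.* M′ x y)))        ≡⟨ ∑-cong (λ x → ∑-*ˡ (+ D) _) ⟩
    ∑ (λ x → + D ℤ.* ∑ λ y → (r x ℤ.* r y) ℤ.* (M x y ℤ.* M′ x y))          ≡⟨ ∑-*ˡ (+ D) _ ⟩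
    + D ℤ.* form (λ x y → M x y ℤ.* M′ x y) r r                             ∎)
    where
    open ℤ.≤-Reasoning
    D = suc D-1
    r = restrict f
    g : Carrier → Carrier → ℤ
    g i = restrict (λ x → h i x ℤ.* f x)
    0≤* : ∀ {a b} → 0ℤ ℤ.≤ a → 0ℤ ℤ.≤ b → 0ℤ ℤ.≤ a ℤ.* b
    0≤* {+ a} {+ b} _ _ = ℤ.≤-trans (ℤ.+≤+ ℕ.z≤n) (ℤ.≤-reflexive (ℤ.pos-* a b))
    0≤* {+ a} {ℤ.-[1+ _ ]} _ ()
    0≤* {ℤ.-[1+ _ ]} ()
    pull : ∀ u v w hx hy fx fy m → w ℤ.* (((u ℤ.* (hx ℤ.* fx)) ℤ.* (v ℤ.* (hy ℤ.* fy))) ℤ.* m) ≡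
             (w ℤ.* (hx ℤ.* hy)) ℤ.* ((u ℤ.* v) ℤ.* ((fx ℤ.* fy) ℤ.* m))
    pull = solve-∀
    push : ∀ u v D a fx fy m → (D ℤ.* a) ℤ.* ((u ℤ.* v) ℤ.* ((fx ℤ.* fy) ℤ.* m)) ≡ D ℤ.* (((u ℤ.* fx) ℤ.* (v ℤ.* fy)) ℤ.* (a ℤ.* m))
    push = solve-∀
    move : ∀ s u v m → s ℤ.* ((u ℤ.* v) ℤ.* m) ≡ u ℤ.* (v ℤ.* (s ℤ.* m))
    move = solve-∀
    pointwise : ∀ x y → ∑ (λ i → w i ℤ.* ((g i x ℤ.* g i y) ℤ.* M′ x y)) ≡ + D ℤ.* ((r x ℤ.* r y) ℤ.* (M x y ℤ.* M′ x y))
    pointwise x y =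
      ≡.trans (∑-cong λ i → pull (𝟙* x) (𝟙* y) (w i) (h i x) (h i y) (f x) (f y) (M′ x y))
      (≡.trans (∑-*ʳ t (λ i → w i ℤ.* (h i x ℤ.* h i y)))
      (≡.trans (move (∑ (λ i → w i ℤ.* (h i x ℤ.* h i y))) (𝟙* x) (𝟙* y) t′)
      (≡.trans (⟦⟧-*-congˡ (¬? (x ≟ 0#)) λ x≉0 → ⟦⟧-*-congˡ (¬? (y ≟ 0#)) λ y≉0 → cong (λ z → z ℤ.* t′) (≡.sym (gram x y x≉0 y≉0)))
      (≡.trans (≡.sym (move (+ D ℤ.* M x y) (𝟙* x) (𝟙* y) t′))
      (push (𝟙* x) (𝟙* y) (+ D) (M x y) (f x) (f y) (M′ x y))))))
      where
      t′ = (f x ℤ.* f y) ℤ.* M′ x y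
      t = (𝟙* x ℤ.* 𝟙* y) ℤ.* t′

  -- Homogeneity makes M x y, for nonzero y, a function of the ratio x / y, namely M (x / y) 1. This
  -- is what reduces a quadratic form in M to a count of ratios.
  record IsCharacterKernel (M : Kernel) : Set (c Level.⊔ ℓ) where
    field
      psd       : PSD M
      symmetric : ∀ x y → M x y ≡ M y x
      respects  : ∀ {x x′ y y′} → x ≈ x′ → y ≈ y′ → M x y ≡ M x′ y′
      homogeneous : ∀ {z} → ¬ z ≈ 0# → ∀ x y → M (x * z) (y * z) ≡ M x y

  module _ {M : Kernel} (isKernel : IsCharacterKernel M) where
    open IsCharacterKernel isKernel

    form-expand : ∀ a b f g → form M (λ x → a ℤ.* f x ℤ.- b ℤ.* g x) (λ x → a ℤ.* f x ℤ.- b ℤ.* g x) ≡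
      (a ℤ.* a) ℤ.* form M f f ℤ.- (a ℤ.* b) ℤ.* (form M f g ℤ.+ form M g f) ℤ.+ (b ℤ.* b) ℤ.* form M g g
    form-expand a b f g =
      ≡.trans (∑-cong λ x → ≡.trans (∑-cong λ y → expand a b (f x) (f y) (g x) (g y) (M x y)) (combine (λ y → (f x ℤ.* f y) ℤ.* M x y) (λ y → (f x ℤ.* g y) ℤ.* M x y) (λ y → (g x ℤ.* f y) ℤ.* M x y) (λ y → (g x ℤ.* g y) ℤ.* M x y)))
        (combine (λ x → ∑ λ y → (f x ℤ.* f y) ℤ.* M x y) (λ x → ∑ λ y → (f x ℤ.* g y) ℤ.* M x y) (λ x → ∑ λ y → (g x ℤ.* f y) ℤ.* M x y) (λ x → ∑ λ y → (g x ℤ.* g y) ℤ.* M x y))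
      where
      expand : ∀ a b fx fy gx gy m → ((a ℤ.* fx ℤ.- b ℤ.* gx) ℤ.* (a ℤ.* fy ℤ.- b ℤ.* gy)) ℤ.* m ≡
        (a ℤ.* a) ℤ.* ((fx ℤ.* fy) ℤ.* m) ℤ.- (a ℤ.* b) ℤ.* ((fx ℤ.* gy) ℤ.* m ℤ.+ (gx ℤ.* fy) ℤ.* m) ℤ.+ (b ℤ.* b) ℤ.* ((gx ℤ.* gy) ℤ.* m)
      expand = solve-∀
      combine : ∀ p r s t → ∑ (λ x → (a ℤ.* a) ℤ.* p x ℤ.- (a ℤ.* b) ℤ.* (r x ℤ.+ s x) ℤ.+ (b ℤ.* b) ℤ.* t x) ≡
        (a ℤ.* a) ℤ.* ∑ p ℤ.- (a ℤ.* b) ℤ.* (∑ r ℤ.+ ∑ s) ℤ.+ (b ℤ.* b) ℤ.* ∑ t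
      combine p r s t = ≡.trans (∑-distrib-∙ (λ x → (a ℤ.* a) ℤ.* p x ℤ.- (a ℤ.* b) ℤ.* (r x ℤ.+ s x)) (λ x → (b ℤ.* b) ℤ.* t x))
        (cong₂ ℤ._+_ (≡.trans (∑-minus (λ x → (a ℤ.* a) ℤ.* p x) (λ x → (a ℤ.* b) ℤ.* (r x ℤ.+ s x)))
            (cong₂ ℤ._-_ (∑-*ˡ (a ℤ.* a) p) (≡.trans (∑-*ˡ (a ℤ.* b) (λ x → r x ℤ.+ s x)) (cong (λ z → (a ℤ.* b) ℤ.* z) (∑-distrib-∙ r s)))))
          (∑-*ˡ (b ℤ.* b) t))

    -- Positivity of the form at U·1_{1} − M(1,1)·t, where U = Σ t(x) M(x,1).
    cauchy-schwarz : ∀ m .{{_ : ℕ.NonZero m}} → M 1# 1# ≡ + m → (t : Carrier → ℤ) → (∀ x → restrict t x ≡ t x) →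
      let U = ∑ (λ x → t x ℤ.* M x 1#) in U ℤ.* U ℤ.≤ + m ℤ.* form M t t
    cauchy-schwarz m@(suc _) M11 t t* = ℤ.0≤i-j⇒j≤i (ℤ.*-cancelˡ-≤-pos 0ℤ _ (+ m) (begin
        + m ℤ.* 0ℤ                     ≡⟨ ℤ.*-zeroʳ (+ m) ⟩
        0ℤ                             ≤⟨ psd f ⟩
        form M (restrict f) (restrict f) ≡⟨ form-cong {M} {M} {restrict f} {f} {restrict f} {f} (λ x y → cong₂ (λ u v → (u ℤ.* v) ℤ.* M x y) (restrict-f x) (restrict-f y)) ⟩
        form M f f                     ≡⟨ form-expand U (+ m) e t ⟩
        (U ℤ.* U) ℤ.* form M e e ℤ.- (U ℤ.* + m) ℤ.* (form M e t ℤ.+ form M t e) ℤ.+ (+ m ℤ.* + m) ℤ.* form M t t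
                                       ≡⟨ cong₂ (λ u v → (U ℤ.* U) ℤ.* u ℤ.- (U ℤ.* + m) ℤ.* v ℤ.+ (+ m ℤ.* + m) ℤ.* form M t t) ee (cong₂ ℤ._+_ et te) ⟩
        (U ℤ.* U) ℤ.* + m ℤ.- (U ℤ.* + m) ℤ.* (U ℤ.+ U) ℤ.+ (+ m ℤ.* + m) ℤ.* form M t t
                                       ≡⟨ final U (+ m) (form M t t) ⟩
        + m ℤ.* (+ m ℤ.* form M t t ℤ.- U ℤ.* U) ∎))
      where
      open ℤ.≤-Reasoning
      U = ∑ (λ x → t x ℤ.* M x 1#)
      e : Carrier → ℤ
      e x = ⟦ x ≟ 1# ⟧
      f : Carrier → ℤ
      f x = U ℤ.* e x ℤ.- + m ℤ.* t x
      final : ∀ U m E → (U ℤ.* U) ℤ.* m ℤ.- (U ℤ.* m) ℤ.* (U ℤ.+ U) ℤ.+ (m ℤ.* m) ℤ.* E ≡ m ℤ.* (m ℤ.* E ℤ.- U ℤ.* U)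
      final = solve-∀
      restrict-e : ∀ x → restrict e x ≡ e x
      restrict-e x with x ≟ 1#
      ... | yes x≈1 = ≡.trans (ℤ.*-identityʳ (𝟙* x)) (𝟙*-nonzero λ x≈0 → 1≉0 (trans (sym x≈1) x≈0))
      ... | no _    = ℤ.*-zeroʳ (𝟙* x)
      distribute : ∀ s U e m t → s ℤ.* (U ℤ.* e ℤ.- m ℤ.* t) ≡ U ℤ.* (s ℤ.* e) ℤ.- m ℤ.* (s ℤ.* t)
      distribute = solve-∀
      restrict-f : ∀ x → restrict f x ≡ f x
      restrict-f x = ≡.trans (distribute (𝟙* x) U (e x) (+ m) (t x)) (cong₂ (λ u v → U ℤ.* u ℤ.- + m ℤ.* v) (restrict-e x) (t* x))
      ∑e : ∀ (g : Carrier → ℤ) → Respects g → ∑ (λ x → e x ℤ.* g x) ≡ g 1#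
      ∑e = ∑-δ 1#
      inner : ∀ s x → ∑ (λ y → (s ℤ.* e y) ℤ.* M x y) ≡ s ℤ.* M x 1#
      inner s x = ≡.trans (∑-cong λ y → ℤ.*-assoc s (e y) (M x y)) (≡.trans (∑-*ˡ s (λ y → e y ℤ.* M x y)) (cong (λ z → s ℤ.* z) (∑e (M x) (respects refl))))
      te : form M t e ≡ U
      te = ∑-cong λ x → inner (t x) x
      ee : form M e e ≡ + m
      ee = ≡.trans (∑-cong λ x → inner (e x) x) (≡.trans (∑e (λ x → M x 1#) (λ h → respects h refl)) M11)
      et : form M e t ≡ U
      et = ≡.trans (∑-swap (λ x y → (e x ℤ.* t y) ℤ.* M x y)) (≡.trans (∑-cong λ y → ∑-cong λ x →
        ≡.trans (cong (λ z → z ℤ.* M x y) (ℤ.*-comm (e x) (t y))) (cong (λ z → (t y ℤ.* e x) ℤ.* z) (symmetric x y))) te)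

    column-sum : ∀ (f : Carrier → ℤ) → Respects f → ∀ {y} → ¬ y ≈ 0# →
      ∑ (λ x → f x ℤ.* M x y) ≡ ∑ (λ r → f (r * y) ℤ.* M r 1#)
    column-sum f f-resp {y} y≉0 = ≡.trans
      (∑-reindex (λ x → f x ℤ.* M x y) (λ e → cong₂ ℤ._*_ (f-resp e) (respects e refl)) (_* y) (_* y ⁻¹[ y≉0 ]) *-congʳ *-congʳ
        (λ x → trans (*-assoc _ _ _) (trans (*-congˡ (trans (*-comm _ _) (*-inverse y≉0))) (*-identityʳ x)))
        (λ x → trans (*-assoc _ _ _) (trans (*-congˡ (*-inverse y≉0)) (*-identityʳ x))))
      (∑-cong λ r → cong (λ z → f (r * y) ℤ.* z) (≡.trans (respects refl (sym (*-identityˡ y))) (homogeneous y≉0 r 1#)))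

    -- Substituting x = r y in each column collects the pairs of ratio r, on which M has the
    -- constant value M r 1. The substitution is invertible because g lives on nonzero y.
    form-columns : ∀ (f g : Carrier → ℤ) → Respects f → (∀ y → restrict g y ≡ g y) →
      form M f g ≡ ∑ λ r → M r 1# ℤ.* ∑ (λ y → f (r * y) ℤ.* g y)
    form-columns f g f-resp g* =
      ≡.trans (∑-swap (λ x y → (f x ℤ.* g y) ℤ.* M x y))
      (≡.trans (∑-cong λ y → ≡.trans (∑-cong λ x → rearrange (f x) (g y) (M x y)) (≡.trans (∑-*ˡ (g y) (λ x → f x ℤ.* M x y)) (column y)))
      (≡.trans (∑-cong λ y → ≡.sym (∑-*ˡ (g y) _))
      (≡.trans (∑-swap (λ y r → g y ℤ.* (f (r * y) ℤ.* M r 1#)))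
      (∑-cong λ r → ≡.trans (∑-cong λ y → rearrange′ (f (r * y)) (g y) (M r 1#)) (∑-*ˡ (M r 1#) _)))))
      where
      rearrange : ∀ a b m → (a ℤ.* b) ℤ.* m ≡ b ℤ.* (a ℤ.* m)
      rearrange = solve-∀
      rearrange′ : ∀ a b m → b ℤ.* (a ℤ.* m) ≡ m ℤ.* (a ℤ.* b)
      rearrange′ = solve-∀
      column : ∀ y → g y ℤ.* ∑ (λ x → f x ℤ.* M x y) ≡ g y ℤ.* ∑ (λ r → f (r * y) ℤ.* M r 1#)
      column y = ≡.trans (cong (λ z → z ℤ.* ∑ (λ x → f x ℤ.* M x y)) (≡.sym (g* y)))
        (≡.trans (ℤ.*-assoc (𝟙* y) (g y) _)
        (≡.trans (⟦⟧-*-congˡ (¬? (y ≟ 0#)) λ y≉0 → cong (λ z → g y ℤ.* z) (column-sum f f-resp y≉0))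
        (≡.trans (≡.sym (ℤ.*-assoc (𝟙* y) (g y) _)) (cong (λ z → z ℤ.* ∑ (λ r → f (r * y) ℤ.* M r 1#)) (g* y)))))

-- The character kernels and their Gram vectors

OddPrime : ℕ → Set
OddPrime ℓ = Prime ℓ × ℓ ≢ 2

prime∤product : ∀ {ℓ d} → Prime ℓ → All Prime d → All (ℓ ≢_) d → ¬ ℓ ∣ product d
prime∤product pℓ [] [] ℓ∣1 = ℕ.<⇒≢ (prime>1 pℓ) (≡.sym (∣1⇒≡1 ℓ∣1))
prime∤product {ℓ} {p ∷ d} pℓ (pp ∷ ps) (ℓ≢p ∷ ℓ≢) ℓ∣ with euclidsLemma p (product d) pℓ ℓ∣
... | inj₂ ℓ∣d = prime∤product pℓ ps ℓ≢ ℓ∣d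
... | inj₁ ℓ∣p with prime⇒irreducible pp ℓ∣p
...   | inj₁ ℓ≡1 = ℕ.<⇒≢ (prime>1 pℓ) (≡.sym ℓ≡1)
...   | inj₂ ℓ≡p = ℓ≢p ℓ≡p

prime-coprime : ∀ {ℓ m} → Prime ℓ → ¬ ℓ ∣ m → Coprime ℓ m
prime-coprime pℓ ℓ∤m (i∣ℓ , i∣m) with prime⇒irreducible pℓ i∣ℓ
... | inj₁ i≡1 = i≡1
... | inj₂ ≡.refl = contradiction i∣m ℓ∤m

all∣product : ∀ d → All (_∣ product d) d
all∣product [] = []
all∣product (ℓ ∷ d) = m∣m*n (product d) ∷ All.map (λ h → ∣n⇒∣m*n ℓ h) (all∣product d)

module Kernels {c ℓ : Level} (q : ℕ) (q-odd : q ℕ.% 2 ≡ 1)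
  {p k : ℕ} (p-prime : Prime p) (1≤k : 1 ℕ.≤ k) (q≡p^k : q ≡ p ℕ.^ k) (K : FiniteField (q ℕ.* q) c ℓ) where

  open QuadraticExtension q q-odd p-prime 1≤k q≡p^k K public
  open PositiveKernels K public

  -- For m = n/2 and nonzero arguments this is the quadratic character of x / y. For m = n/4 it is
  -- the real part of a character of order 4, that is, half the sum of the two conjugate characters;
  -- hence the factor 2 in `kern₂ four`.
  sign : ℕ → Kernel
  sign m x y = ⟦ x ^ m ≟ y ^ m ⟧ ℤ.- ⟦ x ^ m ≟ - (y ^ m) ⟧

  kern₂ : TwoPart → Kernel
  kern₂ none x y = 1ℤ
  kern₂ two  x y = sign (quotient n 2) x y
  kern₂ four x y = + 2 ℤ.* sign (quotient n 4) x y

  kernₚ : ℕ → Kernel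
  kernₚ ℓ x y = + ℓ ℤ.* ⟦ x ^ quotient n ℓ ≟ y ^ quotient n ℓ ⟧ ℤ.- 1ℤ

  kernₒ : List ℕ → Kernel
  kernₒ []      x y = 1ℤ
  kernₒ (ℓ ∷ d) x y = kernₚ ℓ x y ℤ.* kernₒ d x y

  kern : TwoPart → List ℕ → Kernel
  kern a d x y = kern₂ a x y ℤ.* kernₒ d x y

  neg-swap : ∀ {x y} → x ≈ - y → y ≈ - x
  neg-swap {x} {y} e = trans (sym (-‿involutive y)) (-‿cong (sym e))

  ^-cancel : ∀ {x y z} m → ¬ z ≈ 0# → (x * z) ^ m ≈ (y * z) ^ m → x ^ m ≈ y ^ m
  ^-cancel m z≉0 e = *-cancelʳ (^-nonzero z≉0 m) (trans (sym (^-distrib-* _ _ m)) (trans e (^-distrib-* _ _ m)))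

  ^-cancel-neg : ∀ {x y z} m → ¬ z ≈ 0# → (x * z) ^ m ≈ - ((y * z) ^ m) → x ^ m ≈ - (y ^ m)
  ^-cancel-neg m z≉0 e = *-cancelʳ (^-nonzero z≉0 m) (trans (sym (^-distrib-* _ _ m)) (trans e (trans (-‿cong (^-distrib-* _ _ m)) (-‿distribˡ-* _ _))))

  ^-multiply : ∀ {x y} z m → x ^ m ≈ y ^ m → (x * z) ^ m ≈ (y * z) ^ m
  ^-multiply z m e = trans (^-distrib-* _ _ m) (trans (*-congʳ e) (sym (^-distrib-* _ _ m)))

  ^-multiply-neg : ∀ {x y} z m → x ^ m ≈ - (y ^ m) → (x * z) ^ m ≈ - ((y * z) ^ m)
  ^-multiply-neg z m e = trans (^-distrib-* _ _ m) (trans (*-congʳ e) (trans (sym (-‿distribˡ-* _ _)) (-‿cong (sym (^-distrib-* _ _ m)))))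

  sign-sym : ∀ m x y → sign m x y ≡ sign m y x
  sign-sym m x y = cong₂ ℤ._-_ (⟦⟧-cong (_ ≟ _) (_ ≟ _) sym sym) (⟦⟧-cong (_ ≟ _) (_ ≟ _) neg-swap neg-swap)

  sign-cong : ∀ m {x x′ y y′} → x ≈ x′ → y ≈ y′ → sign m x y ≡ sign m x′ y′
  sign-cong m e e′ = cong₂ ℤ._-_ (≟-cong (^-congˡ m e) (^-congˡ m e′)) (≟-cong (^-congˡ m e) (-‿cong (^-congˡ m e′)))

  sign-homo : ∀ m {z} → ¬ z ≈ 0# → ∀ x y → sign m (x * z) (y * z) ≡ sign m x y
  sign-homo m {z} z≉0 x y = cong₂ ℤ._-_
    (⟦⟧-cong (_ ≟ _) (_ ≟ _) (^-cancel m z≉0) (^-multiply z m))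
    (⟦⟧-cong (_ ≟ _) (_ ≟ _) (^-cancel-neg m z≉0) (^-multiply-neg z m))

  ∑-δ′ : ∀ a (f : Carrier → ℤ) → Respects f → ∑ (λ x → ⟦ a ≟ x ⟧ ℤ.* f x) ≡ f a
  ∑-δ′ a f f-resp = ≡.trans (∑-cong λ x → cong (λ z → z ℤ.* f x) (⟦⟧-cong (a ≟ x) (x ≟ a) sym sym)) (∑-δ a f f-resp)

  -- The Gram vectors are e_u - e_(-u) with u = x^m, indexed by the whole field. At u = 0 the vector
  -- and the sign both vanish, so no argument has to be excluded.
  sign-gram : ∀ m x y → + 2 ℤ.* sign m x y ≡ ∑ (λ i → 1ℤ ℤ.* ((⟦ x ^ m ≟ i ⟧ ℤ.- ⟦ - (x ^ m) ≟ i ⟧) ℤ.* (⟦ y ^ m ≟ i ⟧ ℤ.- ⟦ - (y ^ m) ≟ i ⟧)))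
  sign-gram m x y = ≡.sym (≡.trans (∑-cong λ i → expand ⟦ u ≟ i ⟧ ⟦ - u ≟ i ⟧ ⟦ v ≟ i ⟧ ⟦ - v ≟ i ⟧)
    (≡.trans (∑-minus (λ i → ⟦ u ≟ i ⟧ ℤ.* h i) (λ i → ⟦ - u ≟ i ⟧ ℤ.* h i))
    (≡.trans (cong₂ ℤ._-_ (∑-δ′ u h h-resp) (∑-δ′ (- u) h h-resp))
    (≡.trans (cong₂ (λ a b → (⟦ v ≟ u ⟧ ℤ.- a) ℤ.- (b ℤ.- ⟦ - v ≟ - u ⟧))
        (⟦⟧-cong (- v ≟ u) (u ≟ - v) sym sym) (⟦⟧-cong (v ≟ - u) (u ≟ - v) neg-swap neg-swap))
    (≡.trans (cong₂ (λ a b → (a ℤ.- ⟦ u ≟ - v ⟧) ℤ.- (⟦ u ≟ - v ⟧ ℤ.- b))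
        (⟦⟧-cong (v ≟ u) (u ≟ v) sym sym) (⟦⟧-cong (- v ≟ - u) (u ≟ v) (λ e → sym (-‿injective e)) (λ e → -‿cong (sym e))))
    (double ⟦ u ≟ v ⟧ ⟦ u ≟ - v ⟧))))))
    where
    u = x ^ m
    v = y ^ m
    h : Carrier → ℤ
    h i = ⟦ v ≟ i ⟧ ℤ.- ⟦ - v ≟ i ⟧
    h-resp : Respects h
    h-resp e = cong₂ ℤ._-_ (≟-cong refl e) (≟-cong refl e)
    expand : ∀ a b c d → 1ℤ ℤ.* ((a ℤ.- b) ℤ.* (c ℤ.- d)) ≡ a ℤ.* (c ℤ.- d) ℤ.- b ℤ.* (c ℤ.- d)
    expand = solve-∀
    double : ∀ a b → (a ℤ.- b) ℤ.- (b ℤ.- a) ≡ + 2 ℤ.* (a ℤ.- b)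
    double = solve-∀

  -- Orders and residues

  ∑𝟙* : ∑ 𝟙* ≡ + n
  ∑𝟙* = ≡.trans (≡.sym (ℤ.pred-suc (∑ 𝟙*))) (cong ℤ.pred (≡.trans (cong (λ z → z ℤ.+ ∑ 𝟙*) (≡.sym (∑-δ₁ 0#)))
    (≡.trans (≡.sym (∑-distrib-∙ (λ x → ⟦ x ≟ 0# ⟧) 𝟙*)) (≡.trans (∑-cong split) (≡.trans ∑-1 (cong +_ q²≡1+n))))))
    where
    split : ∀ x → ⟦ x ≟ 0# ⟧ ℤ.+ 𝟙* x ≡ 1ℤ
    split x with x ≟ 0#
    ... | yes _ = ≡.refl
    ... | no _  = ≡.refl

  power-fibre : ∀ m .{{_ : ℕ.NonZero m}} a → ∑ (λ x → ⟦ x ^ m ≟ a ⟧) ℤ.≤ + m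
  power-fibre (suc m) a = ℤ.≤-trans (ℤ.≤-reflexive (∑-cong λ x → ⟦⟧-cong (x ^ suc m ≟ a) (- a + x ^ suc m ≟ 0#)
      (λ e → trans (+-congˡ e) (-‿inverseˡ a))
      (λ e → x-y≈0⇒x≈y (x ^ suc m) a (trans (+-comm (x ^ suc m) (- a)) e))))
    (root-bound (horner (- a) (monomial m) (λ x → refl)))

  module PowerResidue {ℓ} (ℓ-nonZero : ℕ.NonZero ℓ) (ℓ∣n : ℓ ∣ n) where

    m = quotient n ℓ

    m*ℓ≡n : m ℕ.* ℓ ≡ n
    m*ℓ≡n = quotient-* {{ℓ-nonZero}} ℓ∣n

    0<n : 0 ℕ.< n
    0<n = ℕ.s≤s⁻¹ (subst (1 ℕ.<_) q²≡1+n (ℕ.*-mono-< 1<q 1<q))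

    m-nonZero : ℕ.NonZero m
    m-nonZero = ℕ.≢-nonZero λ m≡0 → ℕ.<⇒≢ 0<n (≡.trans (≡.sym (cong (ℕ._* ℓ) m≡0)) m*ℓ≡n)

    instance
      _ = m-nonZero
      _ = ℓ-nonZero

    ^m^ℓ : ∀ {x} → ¬ x ≈ 0# → (x ^ m) ^ ℓ ≈ 1#
    ^m^ℓ {x} x≉0 = trans (^-assocʳ x m ℓ) (trans (^-congʳ x m*ℓ≡n) (^n≈1 x≉0))

    𝟙μ : Carrier → ℤ
    𝟙μ i = ⟦ i ^ ℓ ≟ 1# ⟧

    𝟙μ-cong : Respects 𝟙μ
    𝟙μ-cong e = ≟-respˡ (^-congˡ ℓ e)

    private
      residue-split : ∀ x → 𝟙* x ≡ ∑ (λ i → 𝟙* x ℤ.* ⟦ x ^ m ≟ i ⟧)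
      residue-split x = ≡.sym (≡.trans (∑-*ˡ (𝟙* x) (λ i → ⟦ x ^ m ≟ i ⟧)) (≡.trans (cong (λ z → 𝟙* x ℤ.* z) (∑-δ₁′ (x ^ m))) (ℤ.*-identityʳ (𝟙* x))))

      -- Double counting of the n nonzero elements by the value of x^m, each value being taken at
      -- most m times. The weight w only has to dominate the indicator of the values taken: all ℓ-th
      -- roots of unity for `#μ`, all but one for `surjective`.
      count : ∀ (w : Carrier → ℤ) → (∀ i → 0ℤ ℤ.≤ w i) → (∀ x i → 𝟙* x ℤ.* ⟦ x ^ m ≟ i ⟧ ℤ.≤ w i ℤ.* ⟦ x ^ m ≟ i ⟧) →
              + n ℤ.≤ ∑ w ℤ.* + m
      count w 0≤w bound = begin
        + n                                                   ≡⟨ ∑𝟙* ⟨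
        ∑ 𝟙*                                                  ≡⟨ ∑-cong residue-split ⟩
        ∑ (λ x → ∑ λ i → 𝟙* x ℤ.* ⟦ x ^ m ≟ i ⟧)              ≤⟨ ∑-mono (λ x → ∑-mono λ i → bound x i) ⟩
        ∑ (λ x → ∑ λ i → w i ℤ.* ⟦ x ^ m ≟ i ⟧)               ≡⟨ ∑-swap (λ x i → w i ℤ.* ⟦ x ^ m ≟ i ⟧) ⟩
        ∑ (λ i → ∑ λ x → w i ℤ.* ⟦ x ^ m ≟ i ⟧)               ≡⟨ ∑-cong (λ i → ∑-*ˡ (w i) (λ x → ⟦ x ^ m ≟ i ⟧)) ⟩
        ∑ (λ i → w i ℤ.* ∑ λ x → ⟦ x ^ m ≟ i ⟧)  ≤⟨ ∑-mono (λ i → ℤ.*-monoˡ-≤-nonNeg (w i) {{ℤ.nonNegative (0≤w i)}} (power-fibre m i)) ⟩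
        ∑ (λ i → w i ℤ.* + m)                                 ≡⟨ ∑-*ʳ (+ m) w ⟩
        ∑ w ℤ.* + m                                           ∎
        where open ℤ.≤-Reasoning

    -- At most ℓ by root counting; at least ℓ because n = m ℓ elements are distributed over fibres
    -- of size at most m.
    #μ : ∑ 𝟙μ ≡ + ℓ
    #μ = ℤ.≤-antisym (power-fibre ℓ 1#) (ℤ.*-cancelʳ-≤-pos (+ ℓ) (∑ 𝟙μ) (+ m) {{ℤ.positive (ℤ.+<+ (ℕ.>-nonZero⁻¹ m))}}
      (ℤ.≤-trans (ℤ.≤-reflexive (≡.trans (≡.sym (ℤ.pos-* ℓ m)) (cong +_ (≡.trans (ℕ.*-comm ℓ m) m*ℓ≡n)))) (count 𝟙μ (λ i → 0≤⟦⟧ (i ^ ℓ ≟ 1#)) bound)))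
      where
      bound : ∀ x i → 𝟙* x ℤ.* ⟦ x ^ m ≟ i ⟧ ℤ.≤ 𝟙μ i ℤ.* ⟦ x ^ m ≟ i ⟧
      bound x i with x ^ m ≟ i
      ... | no _ = ℤ.≤-reflexive (≡.trans (ℤ.*-zeroʳ (𝟙* x)) (≡.sym (ℤ.*-zeroʳ (𝟙μ i))))
      ... | yes e = ≡.subst₂ ℤ._≤_ (≡.sym (ℤ.*-identityʳ (𝟙* x))) (≡.sym (ℤ.*-identityʳ (𝟙μ i)))
        (⟦⟧-≤ (¬? (x ≟ 0#)) (i ^ ℓ ≟ 1#) λ x≉0 → trans (^-congˡ ℓ (sym e)) (^m^ℓ x≉0))

    -- If j were missed, the other ℓ - 1 roots of unity would have to receive n = ℓ m elements in
    -- fibres of size at most m.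
    surjective : ∀ j → j ^ ℓ ≈ 1# → ∃ λ z → ¬ z ≈ 0# × z ^ m ≈ j
    surjective j jμ with any? {P = λ z → ¬ z ≈ 0# × z ^ m ≈ j}
        (λ e (z≉0 , h) → (λ y≈0 → z≉0 (trans e y≈0)) , trans (^-congˡ m (sym e)) h)
        (λ z → (¬? (z ≟ 0#)) ×-dec (z ^ m ≟ j))
    ... | yes w = w
    ... | no ¬w = contradiction (ℤ.≤-trans (count w (λ i → 0≤w i) bound) (ℤ.≤-reflexive (cong (λ z → z ℤ.* + m) ∑w)))
        (ℤ.<⇒≱ (begin-strict
          (+ ℓ ℤ.- 1ℤ) ℤ.* + m  <⟨ ℤ.*-monoʳ-<-pos (+ m) {{ℤ.positive (ℤ.+<+ (ℕ.>-nonZero⁻¹ m))}} (ℤ.<-≤-trans (ℤ.+-monoʳ-< (+ ℓ) (ℤ.-<+ {0} {0})) (ℤ.≤-reflexive (ℤ.+-identityʳ (+ ℓ)))) ⟩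
          + ℓ ℤ.* + m                 ≡⟨ ≡.trans (≡.sym (ℤ.pos-* ℓ m)) (cong +_ (≡.trans (ℕ.*-comm ℓ m) m*ℓ≡n)) ⟩
          + n                         ∎))
      where
      open ℤ.≤-Reasoning
      w : Carrier → ℤ
      w i = 𝟙μ i ℤ.- ⟦ i ≟ j ⟧
      ∑w : ∑ w ≡ + ℓ ℤ.- 1ℤ
      ∑w = ≡.trans (∑-minus 𝟙μ (λ i → ⟦ i ≟ j ⟧)) (cong₂ ℤ._-_ #μ (∑-δ₁ j))
      0≤w : ∀ i → 0ℤ ℤ.≤ w i
      0≤w i = ℤ.i≤j⇒0≤j-i (⟦⟧-≤ (i ≟ j) (i ^ ℓ ≟ 1#) λ e → trans (^-congˡ ℓ e) jμ)
      bound : ∀ x i → 𝟙* x ℤ.* ⟦ x ^ m ≟ i ⟧ ℤ.≤ w i ℤ.* ⟦ x ^ m ≟ i ⟧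
      bound x i with x ^ m ≟ i
      ... | no _ = ℤ.≤-reflexive (≡.trans (ℤ.*-zeroʳ (𝟙* x)) (≡.sym (ℤ.*-zeroʳ (w i))))
      ... | yes e with x ≟ 0#
      -- The element 0 has weight 0 on the left, so nonnegativity of w is enough here.
      ...   | yes _ = ℤ.≤-trans (0≤w i) (ℤ.≤-reflexive (≡.sym (ℤ.*-identityʳ (w i))))
      ...   | no x≉0 = ℤ.≤-reflexive (≡.sym (≡.trans (ℤ.*-identityʳ (w i)) (cong₂ ℤ._-_
               (⟦⟧-true (i ^ ℓ ≟ 1#) (trans (^-congˡ ℓ (sym e)) (^m^ℓ x≉0)))
               (⟦⟧-false (i ≟ j) λ i≈j → ¬w (x , x≉0 , trans e i≈j)))))

    -- Since u = x^m and v = y^m are among the ℓ roots of unity, the sum is ℓ²[u = v] - ℓ - ℓ + ℓ.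
    -- In the code `h` gathers the factors that do not involve u, and its total is ℓ - ℓ = 0.
    kernₚ-gram : ∀ x y → ¬ x ≈ 0# → ¬ y ≈ 0# → + ℓ ℤ.* kernₚ ℓ x y ≡
      ∑ (λ i → 𝟙μ i ℤ.* ((+ ℓ ℤ.* ⟦ x ^ m ≟ i ⟧ ℤ.- 1ℤ) ℤ.* (+ ℓ ℤ.* ⟦ y ^ m ≟ i ⟧ ℤ.- 1ℤ)))
    kernₚ-gram x y x≉0 y≉0 = ≡.sym (≡.trans (∑-cong λ i → expand (+ ℓ) ⟦ u ≟ i ⟧ ⟦ v ≟ i ⟧ (𝟙μ i))
      (≡.trans (∑-minus (λ i → (+ ℓ) ℤ.* (⟦ u ≟ i ⟧ ℤ.* h i)) h)
      (≡.trans (cong₂ ℤ._-_ (≡.trans (∑-*ˡ (+ ℓ) (λ i → ⟦ u ≟ i ⟧ ℤ.* h i)) (cong (λ z → + ℓ ℤ.* z) (≡.trans (∑-δ′ u h h-resp) hu))) ∑h)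
      (finish (+ ℓ) ⟦ u ≟ v ⟧))))
      where
      u = x ^ m
      v = y ^ m
      h : Carrier → ℤ
      h i = + ℓ ℤ.* (⟦ v ≟ i ⟧ ℤ.* 𝟙μ i) ℤ.- 𝟙μ i
      h-resp : Respects h
      h-resp e = cong₂ ℤ._-_ (cong (λ z → + ℓ ℤ.* z) (cong₂ ℤ._*_ (≟-cong refl e) (𝟙μ-cong e))) (𝟙μ-cong e)
      expand : ∀ L a b w → w ℤ.* ((L ℤ.* a ℤ.- 1ℤ) ℤ.* (L ℤ.* b ℤ.- 1ℤ)) ≡ L ℤ.* (a ℤ.* (L ℤ.* (b ℤ.* w) ℤ.- w)) ℤ.- (L ℤ.* (b ℤ.* w) ℤ.- w)
      expand = solve-∀
      finish : ∀ L a → L ℤ.* (L ℤ.* a ℤ.- 1ℤ) ℤ.- 0ℤ ≡ L ℤ.* (L ℤ.* a ℤ.- 1ℤ)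
      finish = solve-∀
      uμ : 𝟙μ u ≡ 1ℤ
      uμ = ⟦⟧-true (u ^ ℓ ≟ 1#) (^m^ℓ x≉0)
      vμ : 𝟙μ v ≡ 1ℤ
      vμ = ⟦⟧-true (v ^ ℓ ≟ 1#) (^m^ℓ y≉0)
      hu : h u ≡ + ℓ ℤ.* ⟦ u ≟ v ⟧ ℤ.- 1ℤ
      hu = cong₂ (λ a b → + ℓ ℤ.* a ℤ.- b) (≡.trans (cong (λ z → ⟦ v ≟ u ⟧ ℤ.* z) uμ) (≡.trans (ℤ.*-identityʳ ⟦ v ≟ u ⟧) (⟦⟧-cong (v ≟ u) (u ≟ v) sym sym))) uμ
      ∑h : ∑ h ≡ 0ℤ
      ∑h = ≡.trans (∑-minus (λ i → + ℓ ℤ.* (⟦ v ≟ i ⟧ ℤ.* 𝟙μ i)) 𝟙μ)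
        (≡.trans (cong₂ ℤ._-_ (≡.trans (∑-*ˡ (+ ℓ) (λ i → ⟦ v ≟ i ⟧ ℤ.* 𝟙μ i)) (≡.trans (cong (λ z → + ℓ ℤ.* z) (≡.trans (∑-δ′ v 𝟙μ 𝟙μ-cong) vμ)) (ℤ.*-identityʳ (+ ℓ)))) #μ)
          (ℤ.+-inverseʳ (+ ℓ)))

-- Character sums over the multiplicative group

2∣n[1+n] : ∀ j → 2 ∣ j ℕ.* suc j
2∣n[1+n] zero    = 2 ∣0
2∣n[1+n] (suc j) = subst (2 ∣_) (eq j) (∣m∣n⇒∣m+n (2∣n[1+n] j) (m∣m*n (suc j)))
  where
  open +-*-Solver
  eq : ∀ j → j ℕ.* suc j ℕ.+ 2 ℕ.* suc j ≡ suc j ℕ.* suc (suc j)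
  eq = solve 1 (λ j → j :* (con 1 :+ j) :+ con 2 :* (con 1 :+ j) := (con 1 :+ j) :* (con 2 :+ j)) ≡.refl

8∣odd²-1 : ∀ q → q ℕ.% 2 ≡ 1 → 8 ∣ ℕ.pred (q ℕ.* q)
8∣odd²-1 q odd = subst (8 ∣_) (≡.sym (cong ℕ.pred (≡.trans (cong₂ ℕ._*_ q≡ q≡) (eq j)))) (*-monoʳ-∣ 4 (2∣n[1+n] j))
  where
  open +-*-Solver
  j = q ℕ./ 2
  q≡ : q ≡ 1 ℕ.+ j ℕ.* 2
  q≡ = ≡.trans (m≡m%n+[m/n]*n q 2) (cong (ℕ._+ j ℕ.* 2) odd)
  eq : ∀ j → (1 ℕ.+ j ℕ.* 2) ℕ.* (1 ℕ.+ j ℕ.* 2) ≡ suc (4 ℕ.* (j ℕ.* suc j))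
  eq = solve 1 (λ j → (con 1 :+ j :* con 2) :* (con 1 :+ j :* con 2) := con 1 :+ con 4 :* (j :* (con 1 :+ j))) ≡.refl

2∤product : ∀ {d} → All OddPrime d → ¬ 2 ∣ product d
2∤product ps = prime∤product prime[2] (All.map proj₁ ps) (All.map (λ (_ , ℓ≢2) 2≡ℓ → ℓ≢2 (≡.sym 2≡ℓ)) ps)

record Admissible (n : ℕ) (d : List ℕ) : Set where
  constructor admissible
  field
    primes   : All OddPrime d
    divisors : All (_∣ n) d
    distinct : AllPairs _≢_ d

φ-nonZero : ∀ {d} → All OddPrime d → ℕ.NonZero (φ d)
φ-nonZero [] = _
φ-nonZero {ℓ ∷ d} ((pℓ , _) ∷ ps) = ℕ.m*n≢0 (ℓ ∸ 1) (φ d) {{ℕ.>-nonZero (ℕ.m<n⇒0<n∸m (prime>1 pℓ))}} {{φ-nonZero ps}}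

module CharacterSums {c ℓ : Level} (q : ℕ) (q-odd : q ℕ.% 2 ≡ 1)
  {p k : ℕ} (p-prime : Prime p) (1≤k : 1 ℕ.≤ k) (q≡p^k : q ≡ p ℕ.^ k) (K : FiniteField (q ℕ.* q) c ℓ) where

  open Kernels q q-odd p-prime 1≤k q≡p^k K public
  private
    module Reason where
      open import Relation.Binary.Reasoning.Setoid setoid public

  8∣n : 8 ∣ n
  8∣n = 8∣odd²-1 q q-odd

  4∣n : 4 ∣ n
  4∣n = ∣-trans (divides 2 ≡.refl) 8∣n

  2∣n : 2 ∣ n
  2∣n = ∣-trans (divides 4 ≡.refl) 8∣n

  one-kernel : IsCharacterKernel (λ _ _ → 1ℤ)
  one-kernel = record { psd = PSD-one ; symmetric = λ _ _ → ≡.refl ; respects = λ _ _ → ≡.refl ; homogeneous = λ _ _ _ → ≡.refl }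

  kernₚ-cong : ∀ ℓ {x x′ y y′} → x ≈ x′ → y ≈ y′ → kernₚ ℓ x y ≡ kernₚ ℓ x′ y′
  kernₚ-cong ℓ e e′ = cong (λ z → + ℓ ℤ.* z ℤ.- 1ℤ) (≟-cong (^-congˡ (quotient n ℓ) e) (^-congˡ (quotient n ℓ) e′))

  kernₒ-isKernel : ∀ {d} → All OddPrime d → All (_∣ n) d → IsCharacterKernel (kernₒ d)
  kernₒ-isKernel [] [] = one-kernel
  kernₒ-isKernel {ℓ ∷ d} ((pℓ , _) ∷ ps) (ℓ∣n ∷ ds) = record
    { psd = PSD-* {kernₚ ℓ} {kernₒ d} ℓ {{prime⇒nonZero pℓ}} 𝟙μ (λ i x → + ℓ ℤ.* ⟦ x ^ m ≟ i ⟧ ℤ.- 1ℤ) (λ i → 0≤⟦⟧ (i ^ ℓ ≟ 1#)) kernₚ-gram psd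
    ; symmetric = λ x y → cong₂ ℤ._*_ (cong (λ z → + ℓ ℤ.* z ℤ.- 1ℤ) (⟦⟧-cong (x ^ m ≟ y ^ m) (y ^ m ≟ x ^ m) sym sym)) (symmetric x y)
    ; respects = λ e e′ → cong₂ ℤ._*_ (kernₚ-cong ℓ e e′) (respects e e′)
    ; homogeneous = λ {z} z≉0 x y → cong₂ ℤ._*_ (cong (λ z → + ℓ ℤ.* z ℤ.- 1ℤ)
        (⟦⟧-cong ((x * z) ^ m ≟ (y * z) ^ m) (x ^ m ≟ y ^ m) (^-cancel m z≉0) (^-multiply z m))) (homogeneous z≉0 x y)
    }
    where
    open IsCharacterKernel (kernₒ-isKernel ps ds)
    open PowerResidue (prime⇒nonZero pℓ) ℓ∣n using (m; 𝟙μ; kernₚ-gram)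

  kern-isKernel : ∀ a {d} → All OddPrime d → All (_∣ n) d → IsCharacterKernel (kern a d)
  kern-isKernel a {d} ps ds = record
    { psd = psd₂ a
    ; symmetric = λ x y → cong₂ ℤ._*_ (symmetric₂ a x y) (symmetric x y)
    ; respects = λ e e′ → cong₂ ℤ._*_ (respects₂ a e e′) (respects e e′)
    ; homogeneous = λ z≉0 x y → cong₂ ℤ._*_ (homogeneous₂ a z≉0 x y) (homogeneous z≉0 x y)
    }
    where
    open IsCharacterKernel (kernₒ-isKernel ps ds)
    h : ℕ → Carrier → Carrier → ℤ
    h m i x = ⟦ x ^ m ≟ i ⟧ ℤ.- ⟦ - (x ^ m) ≟ i ⟧
    psd₂ : ∀ a → PSD (kern a d)
    -- The constant kernel 1 is the square of a single vector; concentrating the weight at one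
    -- index, here 1, makes the sum over i equal to 1.
    psd₂ none = PSD-* {λ _ _ → 1ℤ} {kernₒ d} 1 (λ i → ⟦ i ≟ 1# ⟧) (λ _ _ → 1ℤ) (λ i → 0≤⟦⟧ (i ≟ 1#)) (λ _ _ _ _ → ≡.sym (∑-δ 1# (λ _ → 1ℤ) (λ _ → ≡.refl))) psd
    psd₂ two  = PSD-* {sign (quotient n 2)} {kernₒ d} 2 (λ _ → 1ℤ) (h (quotient n 2)) (λ _ → ℤ.+≤+ ℕ.z≤n) (λ x y _ _ → sign-gram (quotient n 2) x y) psd
    -- The kernel already contains the factor 2 of `sign-gram`, so the denominator is 1 here and not
    -- 2.
    psd₂ four = PSD-* {kern₂ four} {kernₒ d} 1 (λ _ → 1ℤ) (h (quotient n 4)) (λ _ → ℤ.+≤+ ℕ.z≤n) (λ x y _ _ → ≡.trans (ℤ.*-identityˡ (kern₂ four x y)) (sign-gram (quotient n 4) x y)) psd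
    symmetric₂ : ∀ a x y → kern₂ a x y ≡ kern₂ a y x
    symmetric₂ none x y = ≡.refl
    symmetric₂ two  x y = sign-sym (quotient n 2) x y
    symmetric₂ four x y = cong (λ z → + 2 ℤ.* z) (sign-sym (quotient n 4) x y)
    respects₂ : ∀ a {x x′ y y′} → x ≈ x′ → y ≈ y′ → kern₂ a x y ≡ kern₂ a x′ y′
    respects₂ none e e′ = ≡.refl
    respects₂ two  e e′ = sign-cong (quotient n 2) e e′
    respects₂ four e e′ = cong (λ z → + 2 ℤ.* z) (sign-cong (quotient n 4) e e′)
    homogeneous₂ : ∀ a {z} → ¬ z ≈ 0# → ∀ x y → kern₂ a (x * z) (y * z) ≡ kern₂ a x y
    homogeneous₂ none z≉0 x y = ≡.refl
    homogeneous₂ two  z≉0 x y = sign-homo (quotient n 2) z≉0 x y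
    homogeneous₂ four z≉0 x y = cong (λ z → + 2 ℤ.* z) (sign-homo (quotient n 4) z≉0 x y)

  Trivial₂ : TwoPart → Carrier → Set ℓ
  Trivial₂ none r = Level.Lift ℓ ⊤
  Trivial₂ two  r = r ^ quotient n 2 ≈ 1#
  Trivial₂ four r = r ^ quotient n 4 ≈ 1#

  sign-trivial : ∀ m {r} → r ^ m ≈ 1# → sign m r 1# ≡ 1ℤ
  sign-trivial m {r} e = cong₂ ℤ._-_ (⟦⟧-true (r ^ m ≟ 1# ^ m) (trans e (sym (1^n≈1 m))))
    (⟦⟧-false (r ^ m ≟ - (1# ^ m)) λ h → x≉-x 1≉0 (trans (sym e) (trans h (-‿cong (1^n≈1 m)))))

  -- Where all characters involved are trivial, each sum of characters equals their number. This is
  -- needed at r = 1 and, if the orders divide q + 1, on all of F_q*.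
  kern-trivial : ∀ a {d r} → All OddPrime d → Trivial₂ a r → All (λ ℓ → r ^ quotient n ℓ ≈ 1#) d →
    kern a d r 1# ≡ + (φ₂ a ℕ.* φ d)
  kern-trivial a {d} {r} ps ta td = ≡.trans (cong₂ ℤ._*_ (t₂ a ta) (tₒ ps td)) (≡.sym (ℤ.pos-* (φ₂ a) (φ d)))
    where
    t₂ : ∀ a → Trivial₂ a r → kern₂ a r 1# ≡ + φ₂ a
    t₂ none _ = ≡.refl
    t₂ two  e = sign-trivial (quotient n 2) e
    t₂ four e = cong (λ z → + 2 ℤ.* z) (sign-trivial (quotient n 4) e)
    tₒ : ∀ {d} → All OddPrime d → All (λ ℓ → r ^ quotient n ℓ ≈ 1#) d → kernₒ d r 1# ≡ + φ d
    tₒ [] [] = ≡.refl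
    tₒ {ℓ ∷ d} ((pℓ , _) ∷ ps) (e ∷ es) = ≡.trans (cong₂ ℤ._*_
        (≡.trans (cong (λ z → + ℓ ℤ.* z ℤ.- 1ℤ) (⟦⟧-true (r ^ quotient n ℓ ≟ 1# ^ quotient n ℓ) (trans e (sym (1^n≈1 (quotient n ℓ))))))
          (≡.trans (cong (λ z → z ℤ.- 1ℤ) (ℤ.*-identityʳ (+ ℓ))) (ℤ.⊖-≥ {ℓ} {1} (ℕ.>-nonZero⁻¹ ℓ {{prime⇒nonZero pℓ}}))))
        (tₒ ps es)) (≡.sym (ℤ.pos-* (ℓ ∸ 1) (φ d)))

  kern-1-1 : ∀ a {d} → All OddPrime d → kern a d 1# 1# ≡ + (φ₂ a ℕ.* φ d)
  kern-1-1 a {d} ps = kern-trivial a ps (t a) (All.map (λ {ℓ} _ → 1^n≈1 (quotient n ℓ)) ps)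
    where
    t : ∀ a → Trivial₂ a 1#
    t none = Level.lift tt
    t two  = 1^n≈1 (quotient n 2)
    t four = 1^n≈1 (quotient n 4)

  -- Sums over the multiplicative group vanish

  ∑* : (Carrier → ℤ) → ℤ
  ∑* f = ∑ (restrict f)

  ∑*-shift : ∀ {f} → Respects f → ∀ {v} → ¬ v ≈ 0# → ∑* f ≡ ∑* (λ x → f (x * v))
  ∑*-shift {f} f-resp {v} v≉0 = ≡.trans
    (∑-reindex (restrict f) (λ e → cong₂ ℤ._*_ (𝟙*-cong e) (f-resp e)) (_* v) (_* v ⁻¹[ v≉0 ]) *-congʳ *-congʳ
      (λ x → trans (*-assoc _ _ _) (trans (*-congˡ (trans (*-comm _ _) (*-inverse v≉0))) (*-identityʳ x)))
      (λ x → trans (*-assoc _ _ _) (trans (*-congˡ (*-inverse v≉0)) (*-identityʳ x))))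
    (∑-cong λ x → cong (λ z → z ℤ.* f (x * v)) (⟦⟧-cong (¬? (x * v ≟ 0#)) (¬? (x ≟ 0#))
      (λ h x≈0 → h (trans (*-congʳ x≈0) (zeroˡ v))) (λ h → *-nonzero h v≉0)))

  ∑*-cong : ∀ {f g} → (∀ x → ¬ x ≈ 0# → f x ≡ g x) → ∑* f ≡ ∑* g
  ∑*-cong e = ∑-cong λ x → ⟦⟧-*-congˡ (¬? (x ≟ 0#)) (e x)

  ^-invariant : ∀ {v} m → v ^ m ≈ 1# → ∀ x → (x * v) ^ m ≈ x ^ m
  ^-invariant {v} m e x = trans (^-distrib-* x v m) (trans (*-congˡ e) (*-identityʳ _))

  kernₒ-invariant : ∀ {d v} → All (λ ℓ → v ^ quotient n ℓ ≈ 1#) d → ∀ x → kernₒ d (x * v) 1# ≡ kernₒ d x 1#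
  kernₒ-invariant [] x = ≡.refl
  kernₒ-invariant {ℓ ∷ d} (e ∷ es) x = cong₂ ℤ._*_
    (cong (λ z → + ℓ ℤ.* z ℤ.- 1ℤ) (≟-respˡ (^-invariant (quotient n ℓ) e x))) (kernₒ-invariant es x)

  -- (z^e)^(n/ℓ) = (z^(e/ℓ))^n = 1. Multiplication by such a power is therefore invisible to
  -- `kernₒ d` and can be used to move the remaining factor alone.
  killed : ∀ {d z} → All OddPrime d → All (_∣ n) d → ¬ z ≈ 0# → ∀ e → product d ∣ e → All (λ ℓ → (z ^ e) ^ quotient n ℓ ≈ 1#) d
  killed {d} {z} ps ds z≉0 e Π∣e = All.zipWith (λ (((pℓ , _) , ℓ∣n) , ℓ∣Π) → kill pℓ ℓ∣n (∣-trans ℓ∣Π Π∣e)) (All.zip (ps , ds) , all∣product d)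
    where
    open Reason
    kill : ∀ {ℓ} → Prime ℓ → ℓ ∣ n → ℓ ∣ e → (z ^ e) ^ quotient n ℓ ≈ 1#
    kill {ℓ} pℓ ℓ∣n (divides j e≡) = begin
      (z ^ e) ^ m              ≈⟨ ^-assocʳ z e m ⟩
      z ^ (e ℕ.* m)  ≈⟨ ^-congʳ z (≡.trans (cong (ℕ._* m) (≡.trans e≡ (ℕ.*-comm j ℓ))) (≡.trans (cong (ℕ._* m) (ℕ.*-comm ℓ j)) (≡.trans (ℕ.*-assoc j ℓ m) (cong (j ℕ.*_) (≡.trans (ℕ.*-comm ℓ m) (quotient-* {{prime⇒nonZero pℓ}} ℓ∣n)))))) ⟩
      z ^ (j ℕ.* n)            ≈⟨ ^-* z j n ⟩
      (z ^ j) ^ n              ≈⟨ ^n≈1 (^-nonzero z≉0 j) ⟩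
      1#                       ∎
      where m = quotient n ℓ

  [-1]^odd : ∀ m → ¬ 2 ∣ m → (- 1#) ^ m ≈ - 1#
  [-1]^odd zero          2∤ = contradiction (2 ∣0) 2∤
  [-1]^odd (suc zero)    2∤ = *-identityʳ _
  [-1]^odd (suc (suc m)) 2∤ = begin
    - 1# * (- 1# * (- 1#) ^ m)   ≈⟨ -1*x≈-x _ ⟩
    - (- 1# * (- 1#) ^ m)        ≈⟨ -‿cong (-1*x≈-x _) ⟩
    - - ((- 1#) ^ m)             ≈⟨ -‿involutive _ ⟩
    (- 1#) ^ m                   ≈⟨ [-1]^odd m (λ 2∣m → 2∤ (∣m∣n⇒∣m+n (∣-refl {2}) 2∣m)) ⟩
    - 1#                         ∎
    where open Reason

  sign-antiinvariant : ∀ m {v} → v ^ m ≈ - 1# → ∀ x → sign m (x * v) 1# ≡ ℤ.- sign m x 1#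
  sign-antiinvariant m {v} e x = ≡.trans (cong₂ ℤ._-_
      (⟦⟧-cong ((x * v) ^ m ≟ 1# ^ m) (x ^ m ≟ - (1# ^ m)) (λ h → neg-swap (trans (sym h) flip)) (λ h → trans flip (sym (neg-swap h))))
      (⟦⟧-cong ((x * v) ^ m ≟ - (1# ^ m)) (x ^ m ≟ 1# ^ m) (λ h → -‿injective (trans (sym flip) h)) (λ h → trans flip (-‿cong h))))
    (swap ⟦ x ^ m ≟ - (1# ^ m) ⟧ ⟦ x ^ m ≟ 1# ^ m ⟧)
    where
    swap : ∀ a b → a ℤ.- b ≡ ℤ.- (b ℤ.- a)
    swap = solve-∀
    flip : (x * v) ^ m ≈ - (x ^ m)
    flip = trans (^-distrib-* x v m) (trans (*-congˡ e) (trans (*-comm _ _) (-1*x≈-x _)))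

  private
    self-negative : ∀ z → z ≡ ℤ.- z → z ≡ 0ℤ
    self-negative (+ zero)      e = ≡.refl
    self-negative (+ suc m)     ()
    self-negative (ℤ.-[1+ m ]) ()

  minus-one-residue : ∃ λ z → ¬ z ≈ 0# × z ^ quotient n 2 ≈ - 1#
  minus-one-residue = PowerResidue.surjective {2} _ 2∣n (- 1#)
    (trans (*-congˡ (*-identityʳ _)) (trans (-1*x≈-x _) (-‿involutive 1#)))

  -- Choose z with z^(n/2) = -1 and substitute x ↦ x v for v = z^(e ∏ d). The odd part of the kernel
  -- does not see v while the sign flips, so the sum equals its own negative.
  ∑*-even-vanishes : ∀ m e {d} → (∀ z → z ^ quotient n 2 ≈ - 1# → (z ^ (e ℕ.* product d)) ^ m ≈ - 1#) → All OddPrime d → All (_∣ n) d →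
    ∀ s → ∑* (λ x → (s ℤ.* sign m x 1#) ℤ.* kernₒ d x 1#) ≡ 0ℤ
  ∑*-even-vanishes m e {d} odd ps ds s = self-negative _ (≡.trans (∑*-shift {f} f-resp v≉0)
      (≡.trans (∑*-cong λ x _ → ≡.trans (cong₂ (λ a b → (s ℤ.* a) ℤ.* b) (sign-antiinvariant m (odd z z^) x) (kernₒ-invariant (killed ps ds z≉0 (e ℕ.* product d) (n∣m*n e)) x)) (pull s (sign m x 1#) (kernₒ d x 1#)))
      (≡.trans (∑-cong λ x → ≡.sym (ℤ.neg-distribʳ-* (𝟙* x) (f x))) (∑-neg (restrict f)))))
    where
    z = proj₁ minus-one-residue
    z≉0 = proj₁ (proj₂ minus-one-residue)
    z^ = proj₂ (proj₂ minus-one-residue)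
    v≉0 = ^-nonzero z≉0 (e ℕ.* product d)
    f : Carrier → ℤ
    f x = (s ℤ.* sign m x 1#) ℤ.* kernₒ d x 1#
    f-resp : Respects f
    f-resp h = cong₂ (λ a b → (s ℤ.* a) ℤ.* b) (sign-cong m h refl) (IsCharacterKernel.respects (kernₒ-isKernel ps ds) h refl)
    pull : ∀ s a b → (s ℤ.* (ℤ.- a)) ℤ.* b ≡ ℤ.- ((s ℤ.* a) ℤ.* b)
    pull = solve-∀

  module _ {ℓ d} (pℓ : Prime ℓ) (ℓ∣n : ℓ ∣ n) (ps : All OddPrime d) (ds : All (_∣ n) d) (ℓ≢ : All (ℓ ≢_) d) where
    open PowerResidue (prime⇒nonZero pℓ) ℓ∣n using (m; 𝟙μ; 𝟙μ-cong; #μ; surjective; ^m^ℓ)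
    private
      θ : Carrier → ℤ
      θ x = kernₒ d x 1#
      θ-resp : Respects θ
      θ-resp h = IsCharacterKernel.respects (kernₒ-isKernel ps ds) h refl
      fibre : Carrier → ℤ
      fibre i = ∑* λ x → ⟦ x ^ m ≟ i ⟧ ℤ.* θ x

      shift-fibre : ∀ i j {v} → ¬ v ≈ 0# → All (λ ℓ → v ^ quotient n ℓ ≈ 1#) d → j * v ^ m ≈ i → fibre i ≡ fibre j
      shift-fibre i j {v} v≉0 kills e = ≡.trans (∑*-shift (λ h → cong₂ ℤ._*_ (≟-respˡ (^-congˡ m h)) (θ-resp h)) v≉0)
        (∑*-cong λ x _ → cong₂ ℤ._*_ (⟦⟧-cong ((x * v) ^ m ≟ i) (x ^ m ≟ j)
          (λ h → *-cancelʳ (^-nonzero v≉0 m) (trans (sym (^-distrib-* x v m)) (trans h (sym e))))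
          (λ h → trans (^-distrib-* x v m) (trans (*-congʳ h) e))) (kernₒ-invariant kills x))

      -- A Bézout identity for ℓ and Π d turns z^(y·Π d), with z^m = i, into an element on which
      -- only the ℓ-part moves, by i or by i⁻¹.
      fibres-equal : ∀ i → i ^ ℓ ≈ 1# → fibre i ≡ fibre 1#
      fibres-equal i iμ with surjective i iμ | coprime-Bézout (prime-coprime pℓ (prime∤product pℓ (All.map proj₁ ps) ℓ≢))
      ... | z , z≉0 , zm≈i | Bézout.-+ x y eq = shift-fibre i 1# (^-nonzero z≉0 (y ℕ.* product d)) (killed ps ds z≉0 _ (n∣m*n y)) (begin
        1# * (z ^ (y ℕ.* product d)) ^ m       ≈⟨ *-identityˡ _ ⟩
        (z ^ (y ℕ.* product d)) ^ m            ≈⟨ ^-comm z (y ℕ.* product d) m ⟩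
        (z ^ m) ^ (y ℕ.* product d)            ≈⟨ ^-congˡ (y ℕ.* product d) zm≈i ⟩
        i ^ (y ℕ.* product d)                  ≈⟨ ^-congʳ i (≡.trans (≡.sym eq) (cong suc (ℕ.*-comm x ℓ))) ⟩
        i * i ^ (ℓ ℕ.* x)                      ≈⟨ *-congˡ (trans (^-* i ℓ x) (trans (^-congˡ x iμ) (1^n≈1 x))) ⟩
        i * 1#                                 ≈⟨ *-identityʳ i ⟩
        i                                      ∎)
        where open Reason
      ... | z , z≉0 , zm≈i | Bézout.+- x y eq = ≡.sym (shift-fibre 1# i (^-nonzero z≉0 (y ℕ.* product d)) (killed ps ds z≉0 _ (n∣m*n y)) (begin
        i * (z ^ (y ℕ.* product d)) ^ m  ≈⟨ *-congˡ (trans (^-comm z (y ℕ.* product d) m) (^-congˡ (y ℕ.* product d) zm≈i)) ⟩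
        i ^ suc (y ℕ.* product d)              ≈⟨ ^-congʳ i (≡.trans eq (ℕ.*-comm x ℓ)) ⟩
        i ^ (ℓ ℕ.* x)                          ≈⟨ trans (^-* i ℓ x) (trans (^-congˡ x iμ) (1^n≈1 x)) ⟩
        1#                                     ∎))
        where open Reason

    -- The sum of θ_d is the same over each of the ℓ fibres of x ↦ x^(n/ℓ). Hence ℓ times the sum
    -- over the fibre of 1 equals the full sum, and their difference is the sum of (ℓ[x^(n/ℓ) = 1] -
    -- 1) θ_d.
    ∑*-odd-vanishes : ∑* (λ x → kernₒ (ℓ ∷ d) x 1#) ≡ 0ℤ
    ∑*-odd-vanishes = ≡.trans (∑-cong λ x → ≡.trans (cong (λ z → 𝟙* x ℤ.* ((+ ℓ ℤ.* z ℤ.- 1ℤ) ℤ.* θ x)) (≟-cong refl (1^n≈1 m))) (expand (𝟙* x) (+ ℓ) ⟦ x ^ m ≟ 1# ⟧ (θ x)))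
      (≡.trans (∑-minus (λ x → + ℓ ℤ.* (𝟙* x ℤ.* (⟦ x ^ m ≟ 1# ⟧ ℤ.* θ x))) (restrict θ))
      (≡.trans (cong₂ ℤ._-_ (∑-*ˡ (+ ℓ) _) ∑θ) (ℤ.+-inverseʳ (+ ℓ ℤ.* fibre 1#))))
      where
      expand : ∀ s L a t → s ℤ.* ((L ℤ.* a ℤ.- 1ℤ) ℤ.* t) ≡ L ℤ.* (s ℤ.* (a ℤ.* t)) ℤ.- s ℤ.* t
      expand = solve-∀
      pull : ∀ s a t w → (s ℤ.* (a ℤ.* t)) ℤ.* w ≡ (s ℤ.* t) ℤ.* (a ℤ.* w)
      pull = solve-∀
      ∑θ : ∑* θ ≡ + ℓ ℤ.* fibre 1#
      ∑θ = begin
        ∑ (λ x → 𝟙* x ℤ.* θ x)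
          ≡⟨ ∑-cong (λ x → ℤ.*-identityʳ (𝟙* x ℤ.* θ x)) ⟨
        ∑ (λ x → (𝟙* x ℤ.* θ x) ℤ.* 1ℤ)
          ≡⟨ ∑-cong (λ x → ≡.trans (ℤ.*-assoc (𝟙* x) (θ x) 1ℤ) (≡.trans (⟦⟧-*-congˡ (¬? (x ≟ 0#)) (λ x≉0 → cong (λ z → θ x ℤ.* z) (≡.sym (≡.trans (∑-δ′ (x ^ m) 𝟙μ 𝟙μ-cong) (⟦⟧-true ((x ^ m) ^ ℓ ≟ 1#) (^m^ℓ x≉0)))))) (≡.sym (ℤ.*-assoc (𝟙* x) (θ x) _)))) ⟩
        ∑ (λ x → (𝟙* x ℤ.* θ x) ℤ.* ∑ (λ i → ⟦ x ^ m ≟ i ⟧ ℤ.* 𝟙μ i))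
          ≡⟨ ∑-cong (λ x → ∑-*ˡ (𝟙* x ℤ.* θ x) (λ i → ⟦ x ^ m ≟ i ⟧ ℤ.* 𝟙μ i)) ⟨
        ∑ (λ x → ∑ λ i → (𝟙* x ℤ.* θ x) ℤ.* (⟦ x ^ m ≟ i ⟧ ℤ.* 𝟙μ i))
          ≡⟨ ∑-swap (λ x i → (𝟙* x ℤ.* θ x) ℤ.* (⟦ x ^ m ≟ i ⟧ ℤ.* 𝟙μ i)) ⟩
        ∑ (λ i → ∑ λ x → (𝟙* x ℤ.* θ x) ℤ.* (⟦ x ^ m ≟ i ⟧ ℤ.* 𝟙μ i))
          ≡⟨ ∑-cong (λ i → ∑-cong λ x → pull (𝟙* x) ⟦ x ^ m ≟ i ⟧ (θ x) (𝟙μ i)) ⟨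
        ∑ (λ i → ∑ λ x → (𝟙* x ℤ.* (⟦ x ^ m ≟ i ⟧ ℤ.* θ x)) ℤ.* 𝟙μ i)
          ≡⟨ ∑-cong (λ i → ∑-*ʳ (𝟙μ i) (λ x → 𝟙* x ℤ.* (⟦ x ^ m ≟ i ⟧ ℤ.* θ x))) ⟩
        ∑ (λ i → fibre i ℤ.* 𝟙μ i)
          ≡⟨ ∑-cong (λ i → ≡.trans (ℤ.*-comm (fibre i) (𝟙μ i)) (⟦⟧-*-congˡ (i ^ ℓ ≟ 1#) (fibres-equal i))) ⟩
        ∑ (λ i → 𝟙μ i ℤ.* fibre 1#)
          ≡⟨ ∑-*ʳ (fibre 1#) 𝟙μ ⟩
        ∑ 𝟙μ ℤ.* fibre 1#
          ≡⟨ cong (λ z → z ℤ.* fibre 1#) #μ ⟩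
        + ℓ ℤ.* fibre 1# ∎
        where open ≡.≡-Reasoning

  NonPrincipal : TwoPart → List ℕ → Set
  NonPrincipal none []      = ⊥
  NonPrincipal none (_ ∷ _) = ⊤
  NonPrincipal two  _       = ⊤
  NonPrincipal four _       = ⊤

  ∑*-vanishes : ∀ a d → Admissible n d → NonPrincipal a d → ∑* (λ x → kern a d x 1#) ≡ 0ℤ
  ∑*-vanishes none (ℓ ∷ d) (admissible ((pℓ , _) ∷ ps) (ℓ∣n ∷ ds) (ℓ≢ ∷ _)) _ =
    ≡.trans (∑-cong λ x → cong (λ z → 𝟙* x ℤ.* z) (ℤ.*-identityˡ (kernₒ (ℓ ∷ d) x 1#))) (∑*-odd-vanishes pℓ ℓ∣n ps ds ℓ≢)
  ∑*-vanishes two d (admissible ps ds _) _ = ≡.trans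
    (∑-cong λ x → cong (λ z → 𝟙* x ℤ.* (z ℤ.* kernₒ d x 1#)) (≡.sym (ℤ.*-identityˡ (sign (quotient n 2) x 1#))))
    (∑*-even-vanishes (quotient n 2) 1 {d} (λ z e → begin
      (z ^ (1 ℕ.* product d)) ^ quotient n 2   ≈⟨ ^-comm z (1 ℕ.* product d) (quotient n 2) ⟩
      (z ^ quotient n 2) ^ (1 ℕ.* product d)   ≈⟨ ^-congˡ (1 ℕ.* product d) e ⟩
      (- 1#) ^ (1 ℕ.* product d)  ≈⟨ [-1]^odd (1 ℕ.* product d) (subst (λ j → ¬ 2 ∣ j) (≡.sym (ℕ.*-identityˡ (product d))) (2∤product ps)) ⟩
      - 1#                                     ∎) ps ds 1ℤ)
    where
    open Reason
  -- The extra exponent 2 turns the n/4-th power into z^(n/2) = -1; the odd exponent ∏ d keeps the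
  -- value -1.
  ∑*-vanishes four d (admissible ps ds _) _ = ∑*-even-vanishes (quotient n 4) 2 {d} (λ z e → begin
      (z ^ (2 ℕ.* product d)) ^ quotient n 4     ≈⟨ ^-assocʳ z (2 ℕ.* product d) (quotient n 4) ⟩
      z ^ (2 ℕ.* product d ℕ.* quotient n 4)     ≈⟨ ^-congʳ z (rearrange (product d)) ⟩
      z ^ (quotient n 2 ℕ.* product d)           ≈⟨ ^-* z (quotient n 2) (product d) ⟩
      (z ^ quotient n 2) ^ product d             ≈⟨ ^-congˡ (product d) e ⟩
      (- 1#) ^ product d                         ≈⟨ [-1]^odd (product d) (2∤product ps) ⟩
      - 1#                                       ∎) ps ds (+ 2)
    where
    open Reason
    halves : quotient n 4 ℕ.* 2 ≡ quotient n 2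
    halves = ℕ.*-cancelʳ-≡ (quotient n 4 ℕ.* 2) (quotient n 2) 2 (≡.trans (ℕ.*-assoc (quotient n 4) 2 2) (≡.trans (quotient-* 4∣n) (≡.sym (quotient-* 2∣n))))
    rearrange : ∀ P → 2 ℕ.* P ℕ.* quotient n 4 ≡ quotient n 2 ℕ.* P
    rearrange P = ≡.trans (solve 2 (λ P x → con 2 :* P :* x := x :* con 2 :* P) ≡.refl P (quotient n 4)) (cong (ℕ._* P) halves)
      where open +-*-Solver

-- Character sums over the line of trace β

order₂ : TwoPart → ℕ
order₂ none = 1
order₂ two  = 2
order₂ four = 4

module LineSums {c ℓ : Level} (q : ℕ) (q-odd : q ℕ.% 2 ≡ 1)
  {p k : ℕ} (p-prime : Prime p) (1≤k : 1 ℕ.≤ k) (q≡p^k : q ≡ p ℕ.^ k) (K : FiniteField (q ℕ.* q) c ℓ)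
  (β : FiniteField.Carrier K) (β≉0 : ¬ FiniteField._≈_ K β (FiniteField.0# K)) (β-base : InBaseField K q β) where

  open CharacterSums q q-odd p-prime 1≤k q≡p^k K public
  open TraceLine β β≉0 β-base public

  𝟙B : Carrier → ℤ
  𝟙B = restrict (λ x → ⟦ base? x ⟧)

  𝟙B-cong : Respects 𝟙B
  𝟙B-cong e = cong₂ ℤ._*_ (𝟙*-cong e) (base?-cong e)

  restrict-idem : ∀ f x → restrict (restrict f) x ≡ restrict f x
  restrict-idem f x = ≡.trans (≡.sym (ℤ.*-assoc (𝟙* x) (𝟙* x) (f x))) (cong (λ z → z ℤ.* f x) (⟦⟧-idem (¬? (x ≟ 0#))))

  restrict-𝟙T : ∀ x → restrict 𝟙T x ≡ 𝟙T x
  restrict-𝟙T x with x ≟ 0#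
  ... | no  _   = ℤ.*-identityˡ (𝟙T x)
  ... | yes x≈0 = ≡.sym (⟦⟧-false (Trace x ≟ β) (Trace-0 x≈0))

  base-0 : Base 0#
  base-0 = Fr-0

  -- Both differences are 0 at r = 0. In this form the quadratic form splits into a sum over the
  -- whole multiplicative group, which vanishes, and a sum over F_q*.
  coincidences-formula′ : ∀ r → coincidences r ≡ (𝟙* r ℤ.- 𝟙B r) ℤ.+ + q ℤ.* ⟦ r ≟ 1# ⟧
  coincidences-formula′ r = ≡.trans (coincidences-formula r) (cong (λ z → z ℤ.+ + q ℤ.* ⟦ r ≟ 1# ⟧) (cases r))
    where
    cases : ∀ r → 1ℤ ℤ.- ⟦ base? r ⟧ ≡ 𝟙* r ℤ.- 𝟙B r
    cases r with r ≟ 0#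
    ... | yes r≈0 = cong (λ z → 1ℤ ℤ.- z) (⟦⟧-true (base? r) (Base-resp (sym r≈0) base-0))
    ... | no  _   = cong (λ z → 1ℤ ℤ.- z) (≡.sym (ℤ.*-identityˡ ⟦ base? r ⟧))

  #B* : ∑ 𝟙B ≡ + (q ∸ 1)
  #B* = ≡.trans (≡.sym (≡.trans (cong ℤ.pred (≡.trans (≡.sym #Base≡q) (≡.trans (≡.trans (∑-cong split) (∑-distrib-∙ (λ x → ⟦ x ≟ 0# ⟧) 𝟙B)) (cong (λ z → z ℤ.+ ∑ 𝟙B) (∑-δ₁ 0#))))) (ℤ.pred-suc (∑ 𝟙B)))) (pred-pos q)
    where
    pred-pos : ∀ q .{{_ : ℕ.NonZero q}} → ℤ.pred (+ q) ≡ + (q ∸ 1)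
    pred-pos (suc q) = ≡.refl
    split : ∀ x → ⟦ base? x ⟧ ≡ ⟦ x ≟ 0# ⟧ ℤ.+ 𝟙B x
    split x with x ≟ 0#
    ... | yes x≈0 = ⟦⟧-true (base? x) (Base-resp (sym x≈0) base-0)
    ... | no _ = ≡.sym (≡.trans (ℤ.+-identityˡ _) (ℤ.*-identityˡ ⟦ base? x ⟧))

  module Energy {M : Kernel} (isKernel : IsCharacterKernel M) where
    open IsCharacterKernel isKernel

    ∑B : ℤ
    ∑B = ∑ (λ r → 𝟙B r ℤ.* M r 1#)

    -- F_q* is a group, so each of its elements is a ratio of two of its elements in q - 1 ways and
    -- nothing else is. With positivity of M this gives the sign of `∑B`.
    form-B : form M 𝟙B 𝟙B ≡ + (q ∸ 1) ℤ.* ∑B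
    form-B = ≡.trans (form-columns isKernel 𝟙B 𝟙B 𝟙B-cong (restrict-idem (λ x → ⟦ base? x ⟧)))
      (≡.trans (∑-cong λ r → ≡.trans (cong (λ z → M r 1# ℤ.* z) (≡.trans (∑-cong (translate r)) (≡.trans (∑-*ˡ (𝟙B r) 𝟙B) (cong (λ z → 𝟙B r ℤ.* z) #B*)))) (rearrange (M r 1#) (𝟙B r) (+ (q ∸ 1))))
        (∑-*ˡ (+ (q ∸ 1)) (λ r → 𝟙B r ℤ.* M r 1#)))
      where
      rearrange : ∀ m b t → m ℤ.* (b ℤ.* t) ≡ t ℤ.* (b ℤ.* m)
      rearrange = solve-∀
      translate : ∀ r y → 𝟙B (r * y) ℤ.* 𝟙B y ≡ 𝟙B r ℤ.* 𝟙B y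
      translate r y with y ≟ 0# | base? y
      ... | yes _  | _     = ≡.trans (ℤ.*-zeroʳ (𝟙B (r * y))) (≡.sym (ℤ.*-zeroʳ (𝟙B r)))
      ... | no _   | no _  = ≡.trans (ℤ.*-zeroʳ (𝟙B (r * y))) (≡.sym (ℤ.*-zeroʳ (𝟙B r)))
      ... | no y≉0 | yes by = cong (λ z → z ℤ.* 1ℤ) (cong₂ ℤ._*_
        (⟦⟧-cong (¬? (r * y ≟ 0#)) (¬? (r ≟ 0#)) (λ h r≈0 → h (trans (*-congʳ r≈0) (zeroˡ y))) (λ h → *-nonzero h y≉0))
        (⟦⟧-cong (base? (r * y)) (base? r)
          (λ h → *-cancelʳ y≉0 (trans (*-congˡ (sym by)) (trans (sym (Fr-* r y)) h)))
          (λ h → Base-* h by)))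

    0≤∑B : 0ℤ ℤ.≤ ∑B
    0≤∑B = ℤ.*-cancelˡ-≤-pos 0ℤ ∑B (+ (q ∸ 1)) {{ℤ.positive (ℤ.+<+ (ℕ.m<n⇒0<n∸m 1<q))}}
      (ℤ.≤-trans (ℤ.≤-reflexive (ℤ.*-zeroʳ (+ (q ∸ 1)))) (ℤ.≤-trans (psd (λ x → ⟦ base? x ⟧)) (ℤ.≤-reflexive form-B)))

    energy : form M 𝟙T 𝟙T ≡ (∑* (λ r → M r 1#) ℤ.- ∑B) ℤ.+ + q ℤ.* M 1# 1#
    energy = ≡.trans (form-columns isKernel 𝟙T 𝟙T 𝟙T-cong restrict-𝟙T)
      (≡.trans (∑-cong λ r → ≡.trans (cong (λ z → M r 1# ℤ.* z) (coincidences-formula′ r)) (expand (M r 1#) (𝟙* r) (𝟙B r) (+ q) ⟦ r ≟ 1# ⟧))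
      (≡.trans (∑-distrib-∙ (λ r → 𝟙* r ℤ.* M r 1# ℤ.- 𝟙B r ℤ.* M r 1#) (λ r → + q ℤ.* (⟦ r ≟ 1# ⟧ ℤ.* M r 1#)))
      (cong₂ ℤ._+_ (∑-minus (restrict (λ r → M r 1#)) (λ r → 𝟙B r ℤ.* M r 1#))
        (≡.trans (∑-*ˡ (+ q) (λ r → ⟦ r ≟ 1# ⟧ ℤ.* M r 1#)) (cong (λ z → + q ℤ.* z) (∑-δ 1# (λ r → M r 1#) (λ h → respects h refl)))))))
      where
      expand : ∀ m s b q e → m ℤ.* ((s ℤ.- b) ℤ.+ q ℤ.* e) ≡ (s ℤ.* m ℤ.- b ℤ.* m) ℤ.+ q ℤ.* (e ℤ.* m)
      expand = solve-∀

  U : TwoPart → List ℕ → ℤ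
  U a d = ∑ (λ x → 𝟙T x ℤ.* kern a d x 1#)

  U-principal : U none [] ≡ + q
  U-principal = ≡.trans (∑-cong λ x → ℤ.*-identityʳ (𝟙T x)) (#Trace≡q β β-base)

  Φ : TwoPart → List ℕ → ℕ
  Φ a d = φ₂ a ℕ.* φ d

  Φ-nonZero : ∀ a {d} → All OddPrime d → ℕ.NonZero (Φ a d)
  Φ-nonZero none ps = ℕ.m*n≢0 1 _ {{_}} {{φ-nonZero ps}}
  Φ-nonZero two  ps = ℕ.m*n≢0 1 _ {{_}} {{φ-nonZero ps}}
  Φ-nonZero four ps = ℕ.m*n≢0 2 _ {{_}} {{φ-nonZero ps}}

  private
    square-abs : ∀ z → z ℤ.* z ≡ + (ℤ.∣ z ∣ ℕ.* ℤ.∣ z ∣)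
    square-abs (+ m)      = ≡.sym (ℤ.pos-* m m)
    square-abs ℤ.-[1+ m ] = ≡.refl

  module _ {a d} (adm : Admissible n d) (np : NonPrincipal a d) where
    open Admissible adm
    private
      isKernel = kern-isKernel a primes divisors
      module E = Energy isKernel
      f = Φ a d
      instance _ = Φ-nonZero a primes

    U² : U a d ℤ.* U a d ℤ.≤ + f ℤ.* (ℤ.- E.∑B ℤ.+ + q ℤ.* + f)
    U² = ℤ.≤-trans (cauchy-schwarz isKernel f (kern-1-1 a primes) 𝟙T restrict-𝟙T)
      (ℤ.≤-reflexive (cong (λ z → + f ℤ.* z) (≡.trans E.energy (cong₂ (λ s t → (s ℤ.- E.∑B) ℤ.+ + q ℤ.* t) (∑*-vanishes a d adm np) (kern-1-1 a primes) ⟨≡⟩ cong (λ z → z ℤ.+ + q ℤ.* + f) (ℤ.+-identityˡ (ℤ.- E.∑B))))))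
      where
      _⟨≡⟩_ : ∀ {x y z : ℤ} → x ≡ y → y ≡ z → x ≡ z
      _⟨≡⟩_ = ≡.trans

    -- The contribution of the ratios in F_q* enters `U²` as -`E.∑B`, which is at most 0 and is
    -- dropped.
    U-bound : ℤ.∣ U a d ∣ ℕ.* ℤ.∣ U a d ∣ ℕ.≤ (f ℕ.* f) ℕ.* q
    U-bound = ℤ.drop‿+≤+ (begin
      + (ℤ.∣ U a d ∣ ℕ.* ℤ.∣ U a d ∣)           ≡⟨ square-abs (U a d) ⟨
      U a d ℤ.* U a d                           ≤⟨ U² ⟩
      + f ℤ.* (ℤ.- E.∑B ℤ.+ + q ℤ.* + f)  ≤⟨ ℤ.*-monoˡ-≤-nonNeg (+ f) (ℤ.+-monoˡ-≤ (+ q ℤ.* + f) (ℤ.neg-mono-≤ E.0≤∑B)) ⟩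
      + f ℤ.* (0ℤ ℤ.+ + q ℤ.* + f)  ≡⟨ cong (λ z → + f ℤ.* z) (≡.trans (ℤ.+-identityˡ _) (≡.sym (ℤ.pos-* q f))) ⟩
      + f ℤ.* + (q ℕ.* f)                       ≡⟨ ℤ.pos-* f (q ℕ.* f) ⟨
      + (f ℕ.* (q ℕ.* f))  ≡⟨ cong +_ (≡.trans (cong (f ℕ.*_) (ℕ.*-comm q f)) (≡.sym (ℕ.*-assoc f f q))) ⟩
      + ((f ℕ.* f) ℕ.* q)                       ∎)
      where open ℤ.≤-Reasoning

    private
      -- n/m = (q - 1) · (q + 1)/m, and r^(q-1) = 1 on F_q*.
      base-killed : ∀ {m r} .{{_ : ℕ.NonZero m}} → m ∣ n → m ∣ suc q → ¬ r ≈ 0# → Base r → r ^ quotient n m ≈ 1#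
      base-killed {m} {r} m∣n (divides j 1+q≡) r≉0 br = begin
        r ^ quotient n m           ≈⟨ ^-congʳ r exponent ⟩
        r ^ ((q ∸ 1) ℕ.* j)        ≈⟨ ^-* r (q ∸ 1) j ⟩
        (r ^ (q ∸ 1)) ^ j  ≈⟨ ^-congˡ j (*-cancelˡ r≉0 (trans (^-congʳ r (ℕ.suc-pred q)) (trans br (sym (*-identityʳ r))))) ⟩
        1# ^ j                     ≈⟨ 1^n≈1 j ⟩
        1#                         ∎
        where
        open import Relation.Binary.Reasoning.Setoid setoid
        open +-*-Solver
        q²-1 : ∀ q .{{_ : ℕ.NonZero q}} → ℕ.pred (q ℕ.* q) ≡ (q ∸ 1) ℕ.* suc q
        q²-1 (suc t) = solve 1 (λ t → t :+ t :* (con 1 :+ t) := t :* (con 2 :+ t)) ≡.refl t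
        exponent : quotient n m ≡ (q ∸ 1) ℕ.* j
        exponent = ℕ.*-cancelʳ-≡ (quotient n m) ((q ∸ 1) ℕ.* j) m (≡.trans (quotient-* m∣n) (≡.trans (q²-1 q)
          (≡.trans (cong ((q ∸ 1) ℕ.*_) 1+q≡) (≡.sym (ℕ.*-assoc (q ∸ 1) j m)))))

    -- All characters involved are trivial on F_q*, so `E.∑B` takes its maximal value (q - 1) f and
    -- leaves only f of the diagonal term q f.
    U-bound-split : order₂ a ∣ suc q → All (_∣ suc q) d → ℤ.∣ U a d ∣ ℕ.≤ f
    U-bound-split a∣ d∣ = ℕ.≮⇒≥ λ f<U → ℕ.<⇒≱ (ℕ.*-mono-< f<U f<U) (ℤ.drop‿+≤+ (begin
      + (ℤ.∣ U a d ∣ ℕ.* ℤ.∣ U a d ∣)           ≡⟨ square-abs (U a d) ⟨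
      U a d ℤ.* U a d                           ≤⟨ U² ⟩
      + f ℤ.* (ℤ.- E.∑B ℤ.+ + q ℤ.* + f)        ≡⟨ cong (λ z → + f ℤ.* (ℤ.- z ℤ.+ + q ℤ.* + f)) ∑B≡ ⟩
      + f ℤ.* (ℤ.- (+ (q ∸ 1) ℤ.* + f) ℤ.+ + q ℤ.* + f) ≡⟨ cong (λ z → + f ℤ.* z) (difference q) ⟩
      + f ℤ.* + f                               ≡⟨ ℤ.pos-* f f ⟨
      + (f ℕ.* f)                               ∎))
      where
      open ℤ.≤-Reasoning
      telescope : ∀ t x → ℤ.- (t ℤ.* x) ℤ.+ (1ℤ ℤ.+ t) ℤ.* x ≡ x
      telescope = solve-∀
      difference : ∀ q .{{_ : ℕ.NonZero q}} → ℤ.- (+ (q ∸ 1) ℤ.* + f) ℤ.+ + q ℤ.* + f ≡ + f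
      difference (suc t) = telescope (+ t) (+ f)
      value : ∀ r → ¬ r ≈ 0# → Base r → kern a d r 1# ≡ + f
      value r r≉0 br = kern-trivial a primes (t a a∣)
        (All.zipWith (λ ((ℓ∣n , ℓ∣1+q) , (pℓ , _)) → base-killed {{prime⇒nonZero pℓ}} ℓ∣n ℓ∣1+q r≉0 br) (All.zip (divisors , d∣) , primes))
        where
        t : ∀ a → order₂ a ∣ suc q → Trivial₂ a r
        t none _ = Level.lift tt
        t two  h = base-killed 2∣n h r≉0 br
        t four h = base-killed 4∣n h r≉0 br
      ∑B≡ : E.∑B ≡ + (q ∸ 1) ℤ.* + f
      ∑B≡ = ≡.trans (∑-cong λ r → ≡.trans (ℤ.*-assoc (𝟙* r) ⟦ base? r ⟧ (kern a d r 1#)) (≡.trans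
          (⟦⟧-*-congˡ (¬? (r ≟ 0#)) λ r≉0 → ⟦⟧-*-congˡ (base? r) λ br → value r r≉0 br)
          (≡.sym (ℤ.*-assoc (𝟙* r) ⟦ base? r ⟧ (+ f)))))
        (≡.trans (∑-*ʳ (+ f) 𝟙B) (cong (λ z → z ℤ.* + f) #B*))

-- The numerical criterion

infix 4 _∣ᵇ_
_∣ᵇ_ : ℕ → ℕ → Bool
zero  ∣ᵇ m = false
suc d ∣ᵇ m = (m ℕ.% suc d) ℕ.≡ᵇ 0

∣ᵇ⇒∣ : ∀ d m → T (d ∣ᵇ m) → d ∣ m
∣ᵇ⇒∣ (suc d) m t = m%n≡0⇒n∣m m (suc d) (ℕ.≡ᵇ⇒≡ _ _ t)

T-both : ∀ {a b} → T (a ∧ b) → T a × T b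
T-both = Equivalence.to T-∧

T-either : ∀ {a b} → T (a ∨ b) → T a ⊎ T b
T-either = Equivalence.to T-∨

-- R and s encode the rational upper bound s/R of √q.
module Criterion (q R s : ℕ) where

  weight : Bool → ℕ
  weight b = if b then R else s

  -- One weight for each subset of `es`, that is, for each term in the expansion of ∏ (ℓ - 1 - θ_ℓ),
  -- after division by the common factor φ. The flag says whether the primes chosen so far, and the
  -- character started from, all divide q + 1; a term keeps the small weight R only as long as it
  -- does.
  bound : Bool → List ℕ → ℕ
  bound b []       = weight b
  bound b (ℓ ∷ es) = bound b es ℕ.+ bound (b ∧ (ℓ ∣ᵇ suc q)) es

  -- The same expansion without the empty subset, whose term is the main term q.
  deficit : List ℕ → ℕ
  deficit []       = 0
  deficit (ℓ ∷ es) = deficit es ℕ.+ bound (ℓ ∣ᵇ suc q) es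

  -- Contributions of the characters whose 2-part has order 1, 2 and 4. Order 2 starts with the flag
  -- `true` because q + 1 is even; the factor 2 counts the characters of order 4.
  mainError : List ℕ → ℕ
  mainError es = deficit es ℕ.+ bound true es ℕ.+ 2 ℕ.* bound (4 ∣ᵇ suc q) es

  primeError : List ℕ → ℕ → ℕ
  primeError es ℓ = bound b es ℕ.+ bound b es ℕ.+ 2 ℕ.* bound ((4 ∣ᵇ suc q) ∧ b) es
    where b = ℓ ∣ᵇ suc q

  cofactors : ℕ → List ℕ → ℕ
  cofactors P []       = 0
  cofactors P (ℓ ∷ ss) = quotient P ℓ ℕ.+ cofactors P ss

  sieveError : ℕ → List ℕ → List ℕ → ℕ
  sieveError P es []       = 0
  sieveError P es (ℓ ∷ ss) = quotient P ℓ ℕ.* ((ℓ ∸ 1) ℕ.* primeError es ℓ) ℕ.+ sieveError P es ss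

  -- P (1 - Σ 1/ℓ) with P = ∏ ℓ, truncated at 0. A truncated value makes `Holds` false, so no
  -- separate positivity condition is imposed.
  margin : List ℕ → ℕ
  margin ss = product ss ∸ cofactors (product ss) ss

  -- The sieve inequality Σ (1 - 1/ℓ) `primeError es ℓ` < δ (R q - `mainError es`), where δ = 1 - Σ
  -- 1/ℓ over `ss`, multiplied by P to clear denominators.
  Holds : List ℕ → List ℕ → Set
  Holds es ss = margin ss ℕ.* mainError es ℕ.+ sieveError (product ss) es ss ℕ.< margin ss ℕ.* (R ℕ.* q)

-- Möbius inversion and the sieve

module Existence {c ℓ : Level} (q : ℕ) (q-odd : q ℕ.% 2 ≡ 1)
  {p k : ℕ} (p-prime : Prime p) (1≤k : 1 ℕ.≤ k) (q≡p^k : q ≡ p ℕ.^ k) (K : FiniteField (q ℕ.* q) c ℓ)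
  (β : FiniteField.Carrier K) (β≉0 : ¬ FiniteField._≈_ K β (FiniteField.0# K)) (β-base : InBaseField K q β)
  (R s : ℕ) .{{R-nonZero : ℕ.NonZero R}} (R²q≤s² : (R ℕ.* R) ℕ.* q ℕ.≤ s ℕ.* s) where

  open LineSums q q-odd p-prime 1≤k q≡p^k K β β≉0 β-base
  open Criterion q R s

  2∣1+q : 2 ∣ suc q
  2∣1+q = subst (λ j → 2 ∣ suc j) (≡.sym q≡) (divides (suc (q ℕ./ 2)) ≡.refl)
    where
    q≡ : q ≡ 1 ℕ.+ (q ℕ./ 2) ℕ.* 2
    q≡ = ≡.trans (m≡m%n+[m/n]*n q 2) (cong (ℕ._+ (q ℕ./ 2) ℕ.* 2) q-odd)

  Split : TwoPart → List ℕ → Set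
  Split a d = order₂ a ∣ suc q × All (_∣ suc q) d

  U-weight : ∀ {a d} → Admissible n d → NonPrincipal a d → ∀ b → (T b → Split a d) → R ℕ.* ℤ.∣ U a d ∣ ℕ.≤ Φ a d ℕ.* weight b
  U-weight {a} {d} adm np true split = ℕ.≤-trans (ℕ.*-monoʳ-≤ R (U-bound-split adm np (proj₁ (split tt)) (proj₂ (split tt)))) (ℕ.≤-reflexive (ℕ.*-comm R (Φ a d)))
  U-weight {a} {d} adm np false _ = ℕ.≮⇒≥ λ lt → ℕ.<⇒≱ (ℕ.*-mono-< lt lt) (begin
    (R ℕ.* u) ℕ.* (R ℕ.* u)        ≡⟨ solve 2 (λ R u → (R :* u) :* (R :* u) := (R :* R) :* (u :* u)) ≡.refl R u ⟩
    (R ℕ.* R) ℕ.* (u ℕ.* u)        ≤⟨ ℕ.*-monoʳ-≤ (R ℕ.* R) (U-bound adm np) ⟩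
    (R ℕ.* R) ℕ.* (f ℕ.* f ℕ.* q)  ≡⟨ solve 3 (λ R f q → (R :* R) :* (f :* f :* q) := (f :* f) :* (R :* R :* q)) ≡.refl R f q ⟩
    (f ℕ.* f) ℕ.* (R ℕ.* R ℕ.* q)  ≤⟨ ℕ.*-monoʳ-≤ (f ℕ.* f) R²q≤s² ⟩
    (f ℕ.* f) ℕ.* (s ℕ.* s)        ≡⟨ solve 2 (λ f s → (f :* f) :* (s :* s) := (f :* s) :* (f :* s)) ≡.refl f s ⟩
    (f ℕ.* s) ℕ.* (f ℕ.* s)        ∎)
    where
    open ℕ.≤-Reasoning
    open +-*-Solver
    u = ℤ.∣ U a d ∣
    f = Φ a d

  -- Equals ∏ ℓ if x^(n/ℓ) ≠ 1 for all ℓ in the list, and 0 otherwise.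
  möbius : List ℕ → Carrier → ℤ
  möbius []       x = 1ℤ
  möbius (ℓ ∷ es) x = (+ (ℓ ∸ 1) ℤ.- kernₚ ℓ x 1#) ℤ.* möbius es x

  S : List ℕ → TwoPart → List ℕ → ℤ
  S es a d = ∑ (λ x → 𝟙T x ℤ.* (kern a d x 1# ℤ.* möbius es x))

  S-[] : ∀ a d → S [] a d ≡ U a d
  S-[] a d = ∑-cong λ x → cong (λ z → 𝟙T x ℤ.* z) (ℤ.*-identityʳ (kern a d x 1#))

  S-∷ : ∀ ℓ es a d → S (ℓ ∷ es) a d ≡ + (ℓ ∸ 1) ℤ.* S es a d ℤ.- S es a (ℓ ∷ d)
  S-∷ ℓ es a d = ≡.trans (∑-cong λ x → expand (𝟙T x) (kern₂ a x 1#) (kernₒ d x 1#) (+ (ℓ ∸ 1)) (kernₚ ℓ x 1#) (möbius es x))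
    (≡.trans (∑-minus (λ x → + (ℓ ∸ 1) ℤ.* (𝟙T x ℤ.* (kern a d x 1# ℤ.* möbius es x))) (λ x → 𝟙T x ℤ.* (kern a (ℓ ∷ d) x 1# ℤ.* möbius es x)))
      (cong (λ z → z ℤ.- S es a (ℓ ∷ d)) (∑-*ˡ (+ (ℓ ∸ 1)) (λ x → 𝟙T x ℤ.* (kern a d x 1# ℤ.* möbius es x)))))
    where
    expand : ∀ t a o L θ m → t ℤ.* ((a ℤ.* o) ℤ.* ((L ℤ.- θ) ℤ.* m)) ≡ L ℤ.* (t ℤ.* ((a ℤ.* o) ℤ.* m)) ℤ.- t ℤ.* ((a ℤ.* (θ ℤ.* o)) ℤ.* m)
    expand = solve-∀

  private
    ∣-∣-≤ : ∀ i j → ℤ.∣ i ℤ.- j ∣ ℕ.≤ ℤ.∣ i ∣ ℕ.+ ℤ.∣ j ∣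
    ∣-∣-≤ i j = ℕ.≤-trans (ℤ.∣i+j∣≤∣i∣+∣j∣ i (ℤ.- j)) (ℕ.≤-reflexive (cong (ℤ.∣ i ∣ ℕ.+_) (ℤ.∣-i∣≡∣i∣ j)))

  -- The invariant of the expansion: each step either drops the first prime of `es` or moves it into
  -- the character index `d`, which must stay free of repetitions.
  record Extendable (es d : List ℕ) : Set where
    constructor extendable
    field
      es-admissible : Admissible n es
      d-admissible  : Admissible n d
      disjoint      : All (λ ℓ → All (ℓ ≢_) d) es

  extend : ∀ {ℓ es d} → Extendable (ℓ ∷ es) d → Extendable es (ℓ ∷ d)
  extend (extendable (admissible (pℓ ∷ ps) (ℓ∣n ∷ ds) (ℓ≢ ∷ ne)) (admissible qs fs nf) (dis ∷ diss)) =
    extendable (admissible ps ds ne) (admissible (pℓ ∷ qs) (ℓ∣n ∷ fs) (dis ∷ nf))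
      (All.zipWith (λ (ℓ≢ℓ′ , ds) → (λ e → ℓ≢ℓ′ (≡.sym e)) ∷ ds) (ℓ≢ , diss))

  retract : ∀ {ℓ es d} → Extendable (ℓ ∷ es) d → Extendable es d
  retract (extendable (admissible (_ ∷ ps) (_ ∷ ds) (_ ∷ ne)) adm (_ ∷ diss)) = extendable (admissible ps ds ne) adm diss

  nonPrincipal-∷ : ∀ a {ℓ d} → NonPrincipal a (ℓ ∷ d)
  nonPrincipal-∷ none = tt
  nonPrincipal-∷ two  = tt
  nonPrincipal-∷ four = tt

  -- By `S-∷`, the two branches for ℓ acquire the same factor ℓ - 1: the first from the coefficient,
  -- the second from φ of the enlarged index. It can therefore be pulled out and only weights are
  -- added.
  S-bound : ∀ es {a d} → Extendable es d → NonPrincipal a d → ∀ b → (T b → Split a d) →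
    R ℕ.* ℤ.∣ S es a d ∣ ℕ.≤ Φ a d ℕ.* φ es ℕ.* bound b es
  S-bound [] {a} {d} ext np b split = ℕ.≤-trans (ℕ.≤-reflexive (cong (λ z → R ℕ.* ℤ.∣ z ∣) (S-[] a d)))
    (ℕ.≤-trans (U-weight (Extendable.d-admissible ext) np b split) (ℕ.≤-reflexive (cong (ℕ._* weight b) (≡.sym (ℕ.*-identityʳ (Φ a d))))))
  S-bound (ℓ ∷ es) {a} {d} ext np b split = begin
    R ℕ.* ℤ.∣ S (ℓ ∷ es) a d ∣
      ≡⟨ cong (λ z → R ℕ.* ℤ.∣ z ∣) (S-∷ ℓ es a d) ⟩
    R ℕ.* ℤ.∣ + (ℓ ∸ 1) ℤ.* S es a d ℤ.- S es a (ℓ ∷ d) ∣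
      ≤⟨ ℕ.*-monoʳ-≤ R (∣-∣-≤ (+ (ℓ ∸ 1) ℤ.* S es a d) (S es a (ℓ ∷ d))) ⟩
    R ℕ.* (ℤ.∣ + (ℓ ∸ 1) ℤ.* S es a d ∣ ℕ.+ ℤ.∣ S es a (ℓ ∷ d) ∣)
      ≡⟨ cong (λ z → R ℕ.* (z ℕ.+ ℤ.∣ S es a (ℓ ∷ d) ∣)) (ℤ.abs-* (+ (ℓ ∸ 1)) (S es a d)) ⟩
    R ℕ.* ((ℓ ∸ 1) ℕ.* ℤ.∣ S es a d ∣ ℕ.+ ℤ.∣ S es a (ℓ ∷ d) ∣)
      ≡⟨ solve 4 (λ R L u v → R :* (L :* u :+ v) := L :* (R :* u) :+ R :* v) ≡.refl R (ℓ ∸ 1) (ℤ.∣ S es a d ∣) (ℤ.∣ S es a (ℓ ∷ d) ∣) ⟩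
    (ℓ ∸ 1) ℕ.* (R ℕ.* ℤ.∣ S es a d ∣) ℕ.+ R ℕ.* ℤ.∣ S es a (ℓ ∷ d) ∣
      ≤⟨ ℕ.+-mono-≤ (ℕ.*-monoʳ-≤ (ℓ ∸ 1) (S-bound es {a} (retract ext) np b split)) (S-bound es {a} (extend ext) (nonPrincipal-∷ a) (b ∧ (ℓ ∣ᵇ suc q)) split′) ⟩
    (ℓ ∸ 1) ℕ.* (Φ a d ℕ.* φ es ℕ.* bound b es) ℕ.+ Φ a (ℓ ∷ d) ℕ.* φ es ℕ.* bound (b ∧ (ℓ ∣ᵇ suc q)) es
      ≡⟨ solve 6 (λ L x y f u v → L :* (x :* y :* f :* u) :+ x :* (L :* y) :* f :* v := x :* y :* (L :* f) :* (u :+ v)) ≡.refl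
           (ℓ ∸ 1) (φ₂ a) (φ d) (φ es) (bound b es) (bound (b ∧ (ℓ ∣ᵇ suc q)) es) ⟩
    Φ a d ℕ.* φ (ℓ ∷ es) ℕ.* bound b (ℓ ∷ es) ∎
    where
    open ℕ.≤-Reasoning
    open +-*-Solver
    split′ : T (b ∧ (ℓ ∣ᵇ suc q)) → Split a (ℓ ∷ d)
    split′ t with T-both {b} t
    ... | tb , tℓ = proj₁ (split tb) , ∣ᵇ⇒∣ ℓ (suc q) tℓ ∷ proj₂ (split tb)

  private
    i<j⇒0<j-i : ∀ {i j} → i ℤ.< j → 0ℤ ℤ.< j ℤ.- i
    i<j⇒0<j-i {i} {j} i<j = subst (λ z → z ℤ.< j ℤ.- i) (ℤ.+-inverseʳ i) (ℤ.+-monoˡ-< (ℤ.- i) i<j)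

    -∣∣≤ : ∀ i → ℤ.- + ℤ.∣ i ∣ ℤ.≤ i
    -∣∣≤ (+ m)       = ℤ.neg-≤-pos {m} {m}
    -∣∣≤ ℤ.-[1+ m ] = ℤ.≤-refl

    ≤∣∣ : ∀ i → i ℤ.≤ + ℤ.∣ i ∣
    ≤∣∣ (+ m)       = ℤ.≤-refl
    ≤∣∣ ℤ.-[1+ m ] = ℤ.-≤+

    upper : ∀ {z B} → R ℕ.* ℤ.∣ z ∣ ℕ.≤ B → + R ℤ.* z ℤ.≤ + B
    upper {z} {B} h = ℤ.≤-trans (ℤ.*-monoˡ-≤-nonNeg (+ R) (≤∣∣ z)) (ℤ.≤-trans (ℤ.≤-reflexive (≡.sym (ℤ.pos-* R ℤ.∣ z ∣))) (ℤ.+≤+ h))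

    lower : ∀ {z B} → R ℕ.* ℤ.∣ z ∣ ℕ.≤ B → ℤ.- + B ℤ.≤ + R ℤ.* z
    lower {z} {B} h = ℤ.≤-trans (ℤ.neg-mono-≤ (ℤ.+≤+ h)) (ℤ.≤-trans (ℤ.≤-reflexive (≡.trans (cong ℤ.-_ (ℤ.pos-* R ℤ.∣ z ∣)) (ℤ.neg-distribʳ-* (+ R) (+ ℤ.∣ z ∣)))) (ℤ.*-monoˡ-≤-nonNeg (+ R) (-∣∣≤ z)))

  []-extendable : ∀ {es} → Admissible n es → Extendable es []
  []-extendable adm = extendable adm (admissible [] [] []) (All.tabulate λ _ → [])

  [ℓ]-extendable : ∀ {es ℓ} → Admissible n es → OddPrime ℓ → ℓ ∣ n → All (_≢ ℓ) es → Extendable es (ℓ ∷ [])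
  [ℓ]-extendable adm pℓ ℓ∣n ≢ℓ = extendable adm (admissible (pℓ ∷ []) (ℓ∣n ∷ []) ([] ∷ [])) (All.map (λ e → e ∷ []) ≢ℓ)

  -- The principal term is followed down to `U none [] = q`; every branch that leaves it has a
  -- nontrivial index and is estimated by `S-bound`.
  S-main : ∀ es → Admissible n es → + (φ es) ℤ.* (+ (R ℕ.* q) ℤ.- + deficit es) ℤ.≤ + R ℤ.* S es none []
  S-main [] adm = ℤ.≤-reflexive (≡.trans (ℤ.*-identityˡ _) (≡.trans (ℤ.+-identityʳ _) (≡.trans (ℤ.pos-* R q) (cong (λ z → + R ℤ.* z) (≡.sym (≡.trans (S-[] none []) U-principal))))))
  S-main (ℓ ∷ es) adm = begin
    + φ (ℓ ∷ es) ℤ.* (+ (R ℕ.* q) ℤ.- + (deficit es ℕ.+ B))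
      ≡⟨ cong₂ (λ a b → a ℤ.* (+ (R ℕ.* q) ℤ.- b)) (ℤ.pos-* (ℓ ∸ 1) (φ es)) (ℤ.pos-+ (deficit es) B) ⟩
    (+ (ℓ ∸ 1) ℤ.* + φ es) ℤ.* (+ (R ℕ.* q) ℤ.- (+ deficit es ℤ.+ + B))
      ≡⟨ rearrange (+ (ℓ ∸ 1)) (+ φ es) (+ (R ℕ.* q)) (+ deficit es) (+ B) ⟩
    + (ℓ ∸ 1) ℤ.* (+ φ es ℤ.* (+ (R ℕ.* q) ℤ.- + deficit es)) ℤ.- (+ (ℓ ∸ 1) ℤ.* + φ es) ℤ.* + B
      ≤⟨ ℤ.+-mono-≤ (ℤ.*-monoˡ-≤-nonNeg (+ (ℓ ∸ 1)) (S-main es (Extendable.es-admissible (retract ext)))) (ℤ.neg-mono-≤ (ℤ.≤-trans (upper {S es none (ℓ ∷ [])} (S-bound es {none} (extend ext) tt (ℓ ∣ᵇ suc q) split)) (ℤ.≤-reflexive B≡))) ⟩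
    + (ℓ ∸ 1) ℤ.* (+ R ℤ.* S es none []) ℤ.- + R ℤ.* S es none (ℓ ∷ [])
      ≡⟨ rearrange′ (+ (ℓ ∸ 1)) (+ R) (S es none []) (S es none (ℓ ∷ [])) ⟩
    + R ℤ.* (+ (ℓ ∸ 1) ℤ.* S es none [] ℤ.- S es none (ℓ ∷ []))
      ≡⟨ cong (λ z → + R ℤ.* z) (S-∷ ℓ es none []) ⟨
    + R ℤ.* S (ℓ ∷ es) none [] ∎
    where
    open ℤ.≤-Reasoning
    ext = []-extendable adm
    B = bound (ℓ ∣ᵇ suc q) es
    split : T (ℓ ∣ᵇ suc q) → Split none (ℓ ∷ [])
    split t = divides (suc q) (≡.sym (ℕ.*-identityʳ (suc q))) , ∣ᵇ⇒∣ ℓ (suc q) t ∷ []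
    rearrange : ∀ L f X D B → (L ℤ.* f) ℤ.* (X ℤ.- (D ℤ.+ B)) ≡ L ℤ.* (f ℤ.* (X ℤ.- D)) ℤ.- (L ℤ.* f) ℤ.* B
    rearrange = solve-∀
    rearrange′ : ∀ L R a b → L ℤ.* (R ℤ.* a) ℤ.- R ℤ.* b ≡ R ℤ.* (L ℤ.* a ℤ.- b)
    rearrange′ = solve-∀
    B≡ : + (Φ none (ℓ ∷ []) ℕ.* φ es ℕ.* B) ≡ (+ (ℓ ∸ 1) ℤ.* + φ es) ℤ.* + B
    B≡ = ≡.trans (cong (λ z → + (z ℕ.* φ es ℕ.* B)) (≡.trans (ℕ.+-identityʳ _) (ℕ.*-identityʳ (ℓ ∸ 1)))) (≡.trans (ℤ.pos-* ((ℓ ∸ 1) ℕ.* φ es) B) (cong (λ z → z ℤ.* + B) (ℤ.pos-* (ℓ ∸ 1) (φ es))))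

  -- 4 times the indicator of the squares that are not fourth powers.
  twoPart : Carrier → ℤ
  twoPart x = 1ℤ ℤ.+ kern₂ two x 1# ℤ.- kern₂ four x 1#

  V : List ℕ → List ℕ → ℤ
  V es d = S es none d ℤ.+ S es two d ℤ.- S es four d

  V-main : ∀ es → Admissible n es → + φ es ℤ.* (+ (R ℕ.* q) ℤ.- + mainError es) ℤ.≤ + R ℤ.* V es []
  V-main es adm = begin
    + φ es ℤ.* (+ (R ℕ.* q) ℤ.- + mainError es)
      ≡⟨ cong (λ z → + φ es ℤ.* (+ (R ℕ.* q) ℤ.- z)) (≡.trans (ℤ.pos-+ (deficit es ℕ.+ B₂) (2 ℕ.* B₄)) (cong₂ ℤ._+_ (ℤ.pos-+ (deficit es) B₂) (ℤ.pos-* 2 B₄))) ⟩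
    + φ es ℤ.* (+ (R ℕ.* q) ℤ.- (+ deficit es ℤ.+ + B₂ ℤ.+ + 2 ℤ.* + B₄))
      ≡⟨ rearrange (+ φ es) (+ (R ℕ.* q)) (+ deficit es) (+ B₂) (+ B₄) ⟩
    + φ es ℤ.* (+ (R ℕ.* q) ℤ.- + deficit es) ℤ.+ ℤ.- (+ φ es ℤ.* + B₂) ℤ.- + 2 ℤ.* + φ es ℤ.* + B₄
      ≤⟨ ℤ.+-mono-≤ (ℤ.+-mono-≤ (S-main es adm) (ℤ.≤-trans (ℤ.≤-reflexive b₂) (lower {S es two []} (S-bound es {two} ext tt true λ _ → 2∣1+q , []))))
                    (ℤ.neg-mono-≤ (ℤ.≤-trans (upper {S es four []} (S-bound es {four} ext tt (4 ∣ᵇ suc q) λ t → ∣ᵇ⇒∣ 4 (suc q) t , [])) (ℤ.≤-reflexive b₄))) ⟩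
    + R ℤ.* S es none [] ℤ.+ + R ℤ.* S es two [] ℤ.- + R ℤ.* S es four []
      ≡⟨ rearrange′ (+ R) (S es none []) (S es two []) (S es four []) ⟩
    + R ℤ.* V es [] ∎
    where
    open ℤ.≤-Reasoning
    ext = []-extendable adm
    B₂ = bound true es
    B₄ = bound (4 ∣ᵇ suc q) es
    rearrange : ∀ f X D a b → f ℤ.* (X ℤ.- (D ℤ.+ a ℤ.+ + 2 ℤ.* b)) ≡ f ℤ.* (X ℤ.- D) ℤ.+ ℤ.- (f ℤ.* a) ℤ.- + 2 ℤ.* f ℤ.* b
    rearrange = solve-∀
    rearrange′ : ∀ R a b c → R ℤ.* a ℤ.+ R ℤ.* b ℤ.- R ℤ.* c ≡ R ℤ.* (a ℤ.+ b ℤ.- c)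
    rearrange′ = solve-∀
    b₂ : ℤ.- (+ φ es ℤ.* + B₂) ≡ ℤ.- + (Φ two [] ℕ.* φ es ℕ.* B₂)
    b₂ = cong ℤ.-_ (≡.trans (≡.sym (ℤ.pos-* (φ es) B₂)) (cong (λ z → + (z ℕ.* B₂)) (≡.sym (ℕ.+-identityʳ (φ es)))))
    b₄ : + (Φ four [] ℕ.* φ es ℕ.* B₄) ≡ + 2 ℤ.* + φ es ℤ.* + B₄
    b₄ = ≡.trans (ℤ.pos-* (2 ℕ.* φ es) B₄) (cong (λ z → z ℤ.* + B₄) (ℤ.pos-* 2 (φ es)))

  V-error : ∀ es {ℓ} → Extendable es (ℓ ∷ []) → R ℕ.* ℤ.∣ V es (ℓ ∷ []) ∣ ℕ.≤ φ es ℕ.* ((ℓ ∸ 1) ℕ.* primeError es ℓ)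
  V-error es {ℓ} ext = begin
    R ℕ.* ℤ.∣ V es (ℓ ∷ []) ∣
      ≤⟨ ℕ.*-monoʳ-≤ R (ℕ.≤-trans (∣-∣-≤ (S₁ ℤ.+ S₂) S₄) (ℕ.+-monoˡ-≤ ℤ.∣ S₄ ∣ (ℤ.∣i+j∣≤∣i∣+∣j∣ S₁ S₂))) ⟩
    R ℕ.* (ℤ.∣ S₁ ∣ ℕ.+ ℤ.∣ S₂ ∣ ℕ.+ ℤ.∣ S₄ ∣)
      ≡⟨ solve 4 (λ R a b c → R :* (a :+ b :+ c) := R :* a :+ R :* b :+ R :* c) ≡.refl R (ℤ.∣ S₁ ∣) (ℤ.∣ S₂ ∣) (ℤ.∣ S₄ ∣) ⟩
    R ℕ.* ℤ.∣ S₁ ∣ ℕ.+ R ℕ.* ℤ.∣ S₂ ∣ ℕ.+ R ℕ.* ℤ.∣ S₄ ∣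
      ≤⟨ ℕ.+-mono-≤ (ℕ.+-mono-≤ (S-bound es {none} ext tt b λ t → divides (suc q) (≡.sym (ℕ.*-identityʳ (suc q))) , divisor t ∷ [])
           (S-bound es {two} ext tt b λ t → 2∣1+q , divisor t ∷ [])) (S-bound es {four} ext tt b₄ λ t → ∣ᵇ⇒∣ 4 (suc q) (proj₁ (T-both {4 ∣ᵇ suc q} t)) , divisor (proj₂ (T-both {4 ∣ᵇ suc q} t)) ∷ []) ⟩
    Φ none (ℓ ∷ []) ℕ.* φ es ℕ.* bound b es ℕ.+ Φ two (ℓ ∷ []) ℕ.* φ es ℕ.* bound b es ℕ.+ Φ four (ℓ ∷ []) ℕ.* φ es ℕ.* bound b₄ es
      ≡⟨ solve 4 (λ L f x y → con 1 :* (L :* con 1) :* f :* x :+ con 1 :* (L :* con 1) :* f :* x :+ con 2 :* (L :* con 1) :* f :* y := f :* (L :* (x :+ x :+ con 2 :* y))) ≡.refl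
           (ℓ ∸ 1) (φ es) (bound b es) (bound b₄ es) ⟩
    φ es ℕ.* ((ℓ ∸ 1) ℕ.* primeError es ℓ) ∎
    where
    open ℕ.≤-Reasoning
    open +-*-Solver
    b = ℓ ∣ᵇ suc q
    b₄ = (4 ∣ᵇ suc q) ∧ b
    S₁ = S es none (ℓ ∷ [])
    S₂ = S es two (ℓ ∷ [])
    S₄ = S es four (ℓ ∷ [])
    divisor : T b → ℓ ∣ suc q
    divisor = ∣ᵇ⇒∣ ℓ (suc q)

  sieve : ℕ → List ℕ → Carrier → ℤ
  sieve P []       x = 0ℤ
  sieve P (ℓ ∷ ss) x = + quotient P ℓ ℤ.* kernₚ ℓ x 1# ℤ.+ sieve P ss x

  -- As [x^(n/ℓ) = 1] = (1 + θ_ℓ)/ℓ, the last factor is P (1 - Σ [x^(n/ℓ) = 1]) over `ss` when the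
  -- margin is not truncated. It is positive only if no ℓ in `ss` contributes, and unlike the
  -- product of indicators it is linear in the θ_ℓ.
  detector : List ℕ → List ℕ → Carrier → ℤ
  detector es ss x = (twoPart x ℤ.* möbius es x) ℤ.* (+ margin ss ℤ.- sieve (product ss) ss x)

  module _ (es ss : List ℕ) (adm : Admissible n es) (ext : All (λ ℓ → Extendable es (ℓ ∷ [])) ss) (holds : Holds es ss) where

    private
      P = product ss
      Δ = margin ss

      weighted : List ℕ → ℤ
      weighted []       = 0ℤ
      weighted (ℓ ∷ rs) = + quotient P ℓ ℤ.* V es (ℓ ∷ []) ℤ.+ weighted rs

      V-as-sum : ∀ d → V es d ≡ ∑ (λ x → 𝟙T x ℤ.* ((twoPart x ℤ.* möbius es x) ℤ.* kernₒ d x 1#))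
      V-as-sum d = ≡.sym (≡.trans (∑-cong λ x → expand (𝟙T x) (kern₂ two x 1#) (kern₂ four x 1#) (möbius es x) (kernₒ d x 1#))
        (≡.trans (∑-minus (λ x → t none x ℤ.+ t two x) (t four)) (cong (λ z → z ℤ.- S es four d) (∑-distrib-∙ (t none) (t two)))))
        where
        t : TwoPart → Carrier → ℤ
        t a x = 𝟙T x ℤ.* (kern a d x 1# ℤ.* möbius es x)
        expand : ∀ t a b m o → t ℤ.* (((1ℤ ℤ.+ a ℤ.- b) ℤ.* m) ℤ.* o) ≡ t ℤ.* ((1ℤ ℤ.* o) ℤ.* m) ℤ.+ t ℤ.* ((a ℤ.* o) ℤ.* m) ℤ.- t ℤ.* ((b ℤ.* o) ℤ.* m)
        expand = solve-∀

      weighted-as-sum : ∀ rs → weighted rs ≡ ∑ (λ x → 𝟙T x ℤ.* ((twoPart x ℤ.* möbius es x) ℤ.* sieve P rs x))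
      weighted-as-sum [] = ≡.sym (≡.trans (∑-cong λ x → vanish (𝟙T x) (twoPart x ℤ.* möbius es x)) ∑-ε)
        where
        vanish : ∀ t a → t ℤ.* (a ℤ.* 0ℤ) ≡ 0ℤ
        vanish = solve-∀
      weighted-as-sum (ℓ ∷ rs) = ≡.sym (≡.trans (∑-cong λ x → expand (𝟙T x) (twoPart x ℤ.* möbius es x) (+ quotient P ℓ) (kernₚ ℓ x 1#) (sieve P rs x))
        (≡.trans (∑-distrib-∙ (λ x → + quotient P ℓ ℤ.* (𝟙T x ℤ.* ((twoPart x ℤ.* möbius es x) ℤ.* kernₒ (ℓ ∷ []) x 1#))) (λ x → 𝟙T x ℤ.* ((twoPart x ℤ.* möbius es x) ℤ.* sieve P rs x)))
          (cong₂ ℤ._+_ (≡.trans (∑-*ˡ (+ quotient P ℓ) (λ x → 𝟙T x ℤ.* ((twoPart x ℤ.* möbius es x) ℤ.* kernₒ (ℓ ∷ []) x 1#))) (cong (λ z → + quotient P ℓ ℤ.* z) (≡.sym (V-as-sum (ℓ ∷ []))))) (≡.sym (weighted-as-sum rs)))))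
        where
        expand : ∀ t a c θ r → t ℤ.* (a ℤ.* (c ℤ.* θ ℤ.+ r)) ≡ c ℤ.* (t ℤ.* (a ℤ.* (θ ℤ.* 1ℤ))) ℤ.+ t ℤ.* (a ℤ.* r)
        expand = solve-∀

      detector-sum : ∑ (λ x → 𝟙T x ℤ.* detector es ss x) ≡ + Δ ℤ.* V es [] ℤ.- weighted ss
      detector-sum = ≡.trans (∑-cong λ x → expand (𝟙T x) (twoPart x ℤ.* möbius es x) (+ Δ) (sieve P ss x))
        (≡.trans (∑-minus (λ x → + Δ ℤ.* (𝟙T x ℤ.* ((twoPart x ℤ.* möbius es x) ℤ.* 1ℤ))) (λ x → 𝟙T x ℤ.* ((twoPart x ℤ.* möbius es x) ℤ.* sieve P ss x)))
          (cong₂ ℤ._-_ (≡.trans (∑-*ˡ (+ Δ) (λ x → 𝟙T x ℤ.* ((twoPart x ℤ.* möbius es x) ℤ.* 1ℤ))) (cong (λ z → + Δ ℤ.* z) (≡.sym (V-as-sum [])))) (≡.sym (weighted-as-sum ss))))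
        where
        expand : ∀ t a D s → t ℤ.* (a ℤ.* (D ℤ.- s)) ≡ D ℤ.* (t ℤ.* (a ℤ.* 1ℤ)) ℤ.- t ℤ.* (a ℤ.* s)
        expand = solve-∀

      weighted-bound : ∀ {rs} → All (λ ℓ → Extendable es (ℓ ∷ [])) rs → + R ℤ.* weighted rs ℤ.≤ + φ es ℤ.* + sieveError P es rs
      weighted-bound [] = ℤ.≤-reflexive (≡.trans (ℤ.*-zeroʳ (+ R)) (≡.sym (ℤ.*-zeroʳ (+ φ es))))
      weighted-bound {ℓ ∷ rs} (e ∷ ext) = begin
        + R ℤ.* (+ w ℤ.* V es (ℓ ∷ []) ℤ.+ weighted rs)  ≡⟨ rearrange (+ R) (+ w) (V es (ℓ ∷ [])) (weighted rs) ⟩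
        + w ℤ.* (+ R ℤ.* V es (ℓ ∷ [])) ℤ.+ + R ℤ.* weighted rs  ≤⟨ ℤ.+-mono-≤ (ℤ.*-monoˡ-≤-nonNeg (+ w) (upper {V es (ℓ ∷ [])} (V-error es e))) (weighted-bound ext) ⟩
        + w ℤ.* + (φ es ℕ.* E) ℤ.+ + φ es ℤ.* + sieveError P es rs ≡⟨ cong (λ z → + w ℤ.* z ℤ.+ + φ es ℤ.* + sieveError P es rs) (ℤ.pos-* (φ es) E) ⟩
        + w ℤ.* (+ φ es ℤ.* + E) ℤ.+ + φ es ℤ.* + sieveError P es rs ≡⟨ rearrange′ (+ w) (+ φ es) (+ E) (+ sieveError P es rs) ⟩
        + φ es ℤ.* (+ w ℤ.* + E ℤ.+ + sieveError P es rs)  ≡⟨ cong (λ z → + φ es ℤ.* z) (≡.trans (cong (λ z → z ℤ.+ + sieveError P es rs) (≡.sym (ℤ.pos-* w E))) (≡.sym (ℤ.pos-+ (w ℕ.* E) (sieveError P es rs)))) ⟩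
        + φ es ℤ.* + (w ℕ.* E ℕ.+ sieveError P es rs)              ∎
        where
        open ℤ.≤-Reasoning
        w = quotient P ℓ
        E = (ℓ ∸ 1) ℕ.* primeError es ℓ
        rearrange : ∀ R c v w → R ℤ.* (c ℤ.* v ℤ.+ w) ≡ c ℤ.* (R ℤ.* v) ℤ.+ R ℤ.* w
        rearrange = solve-∀
        rearrange′ : ∀ c f e s → c ℤ.* (f ℤ.* e) ℤ.+ f ℤ.* s ≡ f ℤ.* (c ℤ.* e ℤ.+ s)
        rearrange′ = solve-∀

    detector-sum-positive : 0ℤ ℤ.< ∑ (λ x → 𝟙T x ℤ.* detector es ss x)
    detector-sum-positive = ℤ.*-cancelˡ-<-nonNeg (+ R) (begin-strict
      + R ℤ.* 0ℤ             ≡⟨ ℤ.*-zeroʳ (+ R) ⟩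
      0ℤ                     ≡⟨ ℤ.*-zeroʳ (+ φ es) ⟨
      + φ es ℤ.* 0ℤ  <⟨ ℤ.*-monoˡ-<-pos (+ φ es) {{ℤ.positive (ℤ.+<+ (ℕ.>-nonZero⁻¹ (φ es) {{φ-nonZero (Admissible.primes adm)}}))}} (ℤ.<-≤-trans (i<j⇒0<j-i (ℤ.+<+ holds)) (ℤ.≤-reflexive holds≡)) ⟩
      + φ es ℤ.* (+ Δ ℤ.* + (R ℕ.* q) ℤ.- (+ Δ ℤ.* + mainError es ℤ.+ + sieveError P es ss))
                             ≡⟨ rearrange (+ φ es) (+ Δ) (+ (R ℕ.* q)) (+ mainError es) (+ sieveError P es ss) ⟩
      + Δ ℤ.* (+ φ es ℤ.* (+ (R ℕ.* q) ℤ.- + mainError es)) ℤ.- + φ es ℤ.* + sieveError P es ss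
                             ≤⟨ ℤ.+-mono-≤ (ℤ.*-monoˡ-≤-nonNeg (+ Δ) (V-main es adm)) (ℤ.neg-mono-≤ (weighted-bound ext)) ⟩
      + Δ ℤ.* (+ R ℤ.* V es []) ℤ.- + R ℤ.* weighted ss  ≡⟨ rearrange′ (+ Δ) (+ R) (V es []) (weighted ss) ⟩
      + R ℤ.* (+ Δ ℤ.* V es [] ℤ.- weighted ss)          ≡⟨ cong (λ z → + R ℤ.* z) detector-sum ⟨
      + R ℤ.* ∑ (λ x → 𝟙T x ℤ.* detector es ss x) ∎)
      where
      open ℤ.≤-Reasoning
      rearrange : ∀ f D X e s → f ℤ.* (D ℤ.* X ℤ.- (D ℤ.* e ℤ.+ s)) ≡ D ℤ.* (f ℤ.* (X ℤ.- e)) ℤ.- f ℤ.* s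
      rearrange = solve-∀
      rearrange′ : ∀ D R a b → D ℤ.* (R ℤ.* a) ℤ.- R ℤ.* b ≡ R ℤ.* (D ℤ.* a ℤ.- b)
      rearrange′ = solve-∀
      holds≡ : + (Δ ℕ.* (R ℕ.* q)) ℤ.- + (Δ ℕ.* mainError es ℕ.+ sieveError P es ss) ≡ + Δ ℤ.* + (R ℕ.* q) ℤ.- (+ Δ ℤ.* + mainError es ℤ.+ + sieveError P es ss)
      holds≡ = cong₂ ℤ._-_ (ℤ.pos-* Δ (R ℕ.* q)) (≡.trans (ℤ.pos-+ (Δ ℕ.* mainError es) (sieveError P es ss)) (cong (λ z → z ℤ.+ + sieveError P es ss) (ℤ.pos-* Δ (mainError es))))

-- From a positive sum to a 2-primitive element

prime-divisor : ∀ m → 1 ℕ.< m → ∃ λ r → Prime r × r ∣ m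
prime-divisor m@(suc _) 1<m with factorise m
... | record { factors = [] ; isFactorisation = eq } = contradiction eq (ℕ.>⇒≢ 1<m)
... | record { factors = r ∷ rs ; isFactorisation = eq ; factorsPrime = pr ∷ _ } = r , pr , subst (r ∣_) (≡.sym eq) (m∣m*n (product rs))

module Detection {c ℓ : Level} (q : ℕ) (q-odd : q ℕ.% 2 ≡ 1)
  {p k : ℕ} (p-prime : Prime p) (1≤k : 1 ℕ.≤ k) (q≡p^k : q ≡ p ℕ.^ k) (K : FiniteField (q ℕ.* q) c ℓ)
  (β : FiniteField.Carrier K) (β≉0 : ¬ FiniteField._≈_ K β (FiniteField.0# K)) (β-base : InBaseField K q β)
  (R s : ℕ) .{{R-nonZero : ℕ.NonZero R}} (R²q≤s² : (R ℕ.* R) ℕ.* q ℕ.≤ s ℕ.* s) where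

  open Existence q q-odd p-prime 1≤k q≡p^k K β β≉0 β-base R s R²q≤s²
  open Criterion q R s
  open LineSums q q-odd p-prime 1≤k q≡p^k K β β≉0 β-base

  square-one : ∀ y → y * y ≈ 1# → y ≈ 1# ⊎ y ≈ - 1#
  square-one y e with zero-product {y - 1#} {y + 1#} (begin
      (y - 1#) * (y + 1#)              ≈⟨ [y-z]x≈yx-zx (y + 1#) y 1# ⟩
      y * (y + 1#) - 1# * (y + 1#)  ≈⟨ +-cong (trans (distribˡ y y 1#) (trans (+-cong e (*-identityʳ y)) (+-comm 1# y))) (-‿cong (*-identityˡ _)) ⟩
      (y + 1#) - (y + 1#)              ≈⟨ -‿inverseʳ _ ⟩
      0#                               ∎)
    where open import Relation.Binary.Reasoning.Setoid setoid
  ... | inj₁ h = inj₁ (x-y≈0⇒x≈y y 1# h)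
  ... | inj₂ h = inj₂ (x-y≈0⇒x≈y y (- 1#) (trans (+-congˡ (-‿involutive 1#)) h))

  h₂ h₄ : ℕ
  h₂ = quotient n 2
  h₄ = quotient n 4

  h₄*2≡h₂ : h₄ ℕ.* 2 ≡ h₂
  h₄*2≡h₂ = ℕ.*-cancelʳ-≡ (h₄ ℕ.* 2) h₂ 2 (≡.trans (ℕ.*-assoc h₄ 2 2) (≡.trans (quotient-* 4∣n) (≡.sym (quotient-* 2∣n))))

  square : ∀ x m → (x ^ m) * (x ^ m) ≈ x ^ (m ℕ.* 2)
  square x m = trans (*-congˡ (sym (*-identityʳ _))) (sym (^-* x m 2))

  1≉-1 : ¬ 1# ≈ - 1#
  1≉-1 = x≉-x 1≉0

  sign-minus : ∀ m {x} → x ^ m ≈ - 1# → sign m x 1# ≡ ℤ.-1ℤ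
  sign-minus m {x} e = cong₂ ℤ._-_
    (⟦⟧-false (x ^ m ≟ 1# ^ m) λ h → 1≉-1 (trans (sym (1^n≈1 m)) (trans (sym h) e)))
    (⟦⟧-true (x ^ m ≟ - (1# ^ m)) (trans e (-‿cong (sym (1^n≈1 m)))))

  sign-zero : ∀ m {x} → ¬ x ^ m ≈ 1# → ¬ x ^ m ≈ - 1# → sign m x 1# ≡ 0ℤ
  sign-zero m {x} ¬1 ¬-1 = cong₂ ℤ._-_
    (⟦⟧-false (x ^ m ≟ 1# ^ m) λ h → ¬1 (trans h (1^n≈1 m)))
    (⟦⟧-false (x ^ m ≟ - (1# ^ m)) λ h → ¬-1 (trans h (-‿cong (1^n≈1 m))))

  -- For a nonsquare x^(n/4) squares to -1, so it is neither 1 nor -1 and the value is 1 - 1 - 0.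
  -- For a fourth power it is 1 + 1 - 2, and for the remaining squares 1 + 1 + 2.
  twoPart-value : ∀ {x} → ¬ x ≈ 0# → twoPart x ≡ 0ℤ ⊎ (twoPart x ≡ + 4 × x ^ h₂ ≈ 1# × ¬ x ^ h₄ ≈ 1#)
  twoPart-value {x} x≉0 with square-one (x ^ h₂) (trans (square x h₂) (trans (^-congʳ x (quotient-* 2∣n)) (^n≈1 x≉0)))
  ... | inj₂ w = inj₁ (cong₂ (λ a b → 1ℤ ℤ.+ a ℤ.- + 2 ℤ.* b) (sign-minus h₂ w) (sign-zero h₄
          (λ u → 1≉-1 (trans (sym (*-identityˡ 1#)) (trans (*-cong (sym u) (sym u)) (trans u² w))))
          (λ u → 1≉-1 (trans (sym (trans (-1*x≈-x _) (-‿involutive 1#))) (trans (*-cong (sym u) (sym u)) (trans u² w))))))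
    where
    u² : (x ^ h₄) * (x ^ h₄) ≈ x ^ h₂
    u² = trans (square x h₄) (^-congʳ x h₄*2≡h₂)
  ... | inj₁ w with square-one (x ^ h₄) (trans (square x h₄) (trans (^-congʳ x h₄*2≡h₂) w))
  ...   | inj₁ u = inj₁ (cong₂ (λ a b → 1ℤ ℤ.+ a ℤ.- + 2 ℤ.* b) (sign-trivial h₂ w) (sign-trivial h₄ u))
  ...   | inj₂ u = inj₂ (cong₂ (λ a b → 1ℤ ℤ.+ a ℤ.- + 2 ℤ.* b) (sign-trivial h₂ w) (sign-minus h₄ u) , w , λ e → 1≉-1 (trans (sym e) u))

  NonResidue : Carrier → ℕ → Set ℓ
  NonResidue x r = ¬ x ^ quotient n r ≈ 1#

  kernₚ-residue : ∀ r {x} → x ^ quotient n r ≈ 1# → kernₚ r x 1# ≡ + r ℤ.- 1ℤ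
  kernₚ-residue r {x} e = cong (λ z → z ℤ.- 1ℤ) (≡.trans (cong (λ z → + r ℤ.* z) (⟦⟧-true (x ^ quotient n r ≟ 1# ^ quotient n r) (trans e (sym (1^n≈1 (quotient n r)))))) (ℤ.*-identityʳ (+ r)))

  kernₚ-nonresidue : ∀ r {x} → NonResidue x r → kernₚ r x 1# ≡ ℤ.-1ℤ
  kernₚ-nonresidue r {x} ¬e = cong (λ z → z ℤ.- 1ℤ) (≡.trans (cong (λ z → + r ℤ.* z) (⟦⟧-false (x ^ quotient n r ≟ 1# ^ quotient n r) λ h → ¬e (trans h (1^n≈1 (quotient n r))))) (ℤ.*-zeroʳ (+ r)))

  private
    pred-as-minus : ∀ r .{{_ : ℕ.NonZero r}} → + (r ∸ 1) ≡ + r ℤ.- 1ℤ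
    pred-as-minus (suc r) = ≡.refl

  möbius-value : ∀ {es} x → All OddPrime es → möbius es x ≡ 0ℤ ⊎ (0ℤ ℤ.< möbius es x × All (NonResidue x) es)
  möbius-value x [] = inj₂ (ℤ.+<+ ℕ.z<s , [])
  möbius-value {r ∷ es} x ((pr , _) ∷ ps) with x ^ quotient n r ≟ 1#
  ... | yes e = inj₁ (cong (λ z → z ℤ.* möbius es x) (≡.trans (cong₂ ℤ._-_ (pred-as-minus r {{prime⇒nonZero pr}}) (kernₚ-residue r e)) (ℤ.+-inverseʳ (+ r ℤ.- 1ℤ))))
  ... | no ¬e with möbius-value x ps
  ...   | inj₁ z = inj₁ (≡.trans (cong (λ m → (+ (r ∸ 1) ℤ.- kernₚ r x 1#) ℤ.* m) z) (ℤ.*-zeroʳ (+ (r ∸ 1) ℤ.- kernₚ r x 1#)))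
  ...   | inj₂ (pos , all) = inj₂ (subst (0ℤ ℤ.<_) (cong (λ z → z ℤ.* möbius es x) (≡.sym factor)) (subst (ℤ._< + r ℤ.* möbius es x) (ℤ.*-zeroʳ (+ r)) (ℤ.*-monoˡ-<-pos (+ r) {{ℤ.positive (ℤ.+<+ (ℕ.>-nonZero⁻¹ r {{prime⇒nonZero pr}}))}} pos)) , ¬e ∷ all)
    where
    cancel : ∀ r → (r ℤ.- 1ℤ) ℤ.- ℤ.-1ℤ ≡ r
    cancel = solve-∀
    factor : + (r ∸ 1) ℤ.- kernₚ r x 1# ≡ + r
    factor = ≡.trans (cong₂ ℤ._-_ (pred-as-minus r {{prime⇒nonZero pr}}) (kernₚ-nonresidue r ¬e)) (cancel (+ r))

  module _ (P : ℕ) where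

    sieve-lower : ∀ {rs} x → All OddPrime rs → ℤ.- + cofactors P rs ℤ.≤ sieve P rs x
    sieve-lower x [] = ℤ.≤-refl
    sieve-lower {r ∷ rs} x ((pr , _) ∷ ps) = ℤ.≤-trans (ℤ.≤-reflexive (≡.trans (cong ℤ.-_ (ℤ.pos-+ w (cofactors P rs))) (split (+ w) (+ cofactors P rs))))
      (ℤ.+-mono-≤ (ℤ.*-monoˡ-≤-nonNeg (+ w) (kernₚ-lower (x ^ quotient n r ≟ 1#))) (sieve-lower x ps))
      where
      w = quotient P r
      split : ∀ a b → ℤ.- (a ℤ.+ b) ≡ a ℤ.* ℤ.-1ℤ ℤ.+ ℤ.- b
      split = solve-∀
      kernₚ-lower : Dec (x ^ quotient n r ≈ 1#) → ℤ.-1ℤ ℤ.≤ kernₚ r x 1#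
      kernₚ-lower (no ¬e) = ℤ.≤-reflexive (≡.sym (kernₚ-nonresidue r ¬e))
      kernₚ-lower (yes e) = ℤ.≤-trans (ℤ.-≤+ {0} {r ∸ 1}) (ℤ.≤-reflexive (≡.trans (pred-as-minus r {{prime⇒nonZero pr}}) (≡.sym (kernₚ-residue r e))))

    -- One prime r with x^(n/r) = 1 contributes (P/r)(r - 1) = P - P/r, and each other prime ℓ at
    -- least -P/ℓ.
    sieve-value : ∀ {rs} x → All OddPrime rs → All (_∣ P) rs → All (NonResidue x) rs ⊎ + P ℤ.- + cofactors P rs ℤ.≤ sieve P rs x
    sieve-value x [] [] = inj₁ []
    sieve-value {r ∷ rs} x ((pr , _) ∷ ps) (r∣P ∷ ds) with x ^ quotient n r ≟ 1#
    ... | yes e = inj₂ (ℤ.≤-trans (ℤ.≤-reflexive (≡.trans (cong₂ (λ a b → a ℤ.- b) P≡ (ℤ.pos-+ w (cofactors P rs))) (split (+ w) (+ r) (+ cofactors P rs))))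
        (ℤ.+-mono-≤ (ℤ.≤-reflexive (cong (λ z → + w ℤ.* z) (≡.sym (kernₚ-residue r e)))) (sieve-lower x ps)))
      where
      w = quotient P r
      P≡ : + P ≡ + w ℤ.* + r
      P≡ = ≡.trans (cong +_ (≡.sym (quotient-* {{prime⇒nonZero pr}} r∣P))) (ℤ.pos-* w r)
      split : ∀ w r b → w ℤ.* r ℤ.- (w ℤ.+ b) ≡ w ℤ.* (r ℤ.- 1ℤ) ℤ.+ ℤ.- b
      split = solve-∀
    ... | no ¬e with sieve-value x ps ds
    ...   | inj₁ all = inj₁ (¬e ∷ all)
    ...   | inj₂ h = inj₂ (ℤ.≤-trans (ℤ.≤-reflexive (≡.trans (cong (λ z → + P ℤ.- z) (ℤ.pos-+ w (cofactors P rs))) (split (+ P) (+ w) (+ cofactors P rs))))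
        (ℤ.+-mono-≤ (ℤ.≤-reflexive (cong (λ z → + w ℤ.* z) (≡.sym (kernₚ-nonresidue r ¬e)))) h))
      where
      w = quotient P r
      split : ∀ P w b → P ℤ.- (w ℤ.+ b) ≡ w ℤ.* ℤ.-1ℤ ℤ.+ (P ℤ.- b)
      split = solve-∀

  ^-lift : ∀ {x a b} → a ∣ b → x ^ a ≈ 1# → x ^ b ≈ 1#
  ^-lift {x} {a} (divides j eq) e = trans (^-congʳ x (≡.trans eq (ℕ.*-comm j a))) (trans (^-* x a j) (trans (^-congˡ j e) (1^n≈1 j)))

  ^-combine : ∀ {x} u a v b → x ^ a ≈ 1# → x ^ b ≈ 1# → ∀ {g} → g ℕ.+ v ℕ.* b ≡ u ℕ.* a → x ^ g ≈ 1#
  ^-combine {x} u a v b ea eb {g} eq = begin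
    x ^ g                       ≈⟨ *-identityʳ _ ⟨
    x ^ g * 1#                  ≈⟨ *-congˡ (^-lift (n∣m*n v) eb) ⟨
    x ^ g * x ^ (v ℕ.* b)       ≈⟨ ^-homo-* x g (v ℕ.* b) ⟨
    x ^ (g ℕ.+ v ℕ.* b)         ≈⟨ ^-congʳ x eq ⟩
    x ^ (u ℕ.* a)               ≈⟨ ^-lift (n∣m*n u) ea ⟩
    1#                          ∎
    where open import Relation.Binary.Reasoning.Setoid setoid

  ^-gcd : ∀ {x} a b → x ^ a ≈ 1# → x ^ b ≈ 1# → x ^ gcd a b ≈ 1#
  ^-gcd a b ea eb with Bézout.identity (gcd-GCD a b)
  ... | Bézout.+- u v eq = ^-combine u a v b ea eb eq
  ... | Bézout.-+ u v eq = ^-combine v b u a eb ea eq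

  -- If ξ^j = 1 with 0 < j < n/2, then ξ^g = 1 for g = gcd(j, n/2), a proper divisor of n/2. A prime
  -- r dividing the cofactor makes g divide (n/2)/r, which is n/4 for r = 2 and divides n/r for odd
  -- r; each contradicts a hypothesis.
  order-h₂ : ∀ {ξ} → ξ ^ h₂ ≈ 1# → ¬ ξ ^ h₄ ≈ 1# → (∀ {r} → Prime r → r ≢ 2 → r ∣ n → NonResidue ξ r) → HasMultOrder K ξ h₂
  order-h₂ {ξ} w u nr = 0<h₂ , w , minimal
    where
    instance
      h₂-nonZero : ℕ.NonZero h₂
      h₂-nonZero = PowerResidue.m-nonZero {2} _ 2∣n
    0<h₂ : 0 ℕ.< h₂
    0<h₂ = ℕ.>-nonZero⁻¹ h₂
    minimal : ∀ j → 0 ℕ.< j → j ℕ.< h₂ → ¬ ξ ^ j ≈ 1#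
    minimal j 0<j j<h₂ e with gcd[m,n]∣n j h₂
    ... | divides t h₂≡ with prime-divisor t 1<t
      where
      g = gcd j h₂
      g≤j : g ℕ.≤ j
      g≤j = ∣⇒≤ {{ℕ.>-nonZero 0<j}} (gcd[m,n]∣m j h₂)
      1<t : 1 ℕ.< t
      1<t = ℕ.≰⇒> λ t≤1 → ℕ.<⇒≱ j<h₂ (ℕ.≤-trans (ℕ.≤-reflexive h₂≡) (ℕ.≤-trans (ℕ.*-monoˡ-≤ g t≤1) (ℕ.≤-trans (ℕ.≤-reflexive (ℕ.*-identityˡ g)) g≤j)))
    ... | r , pr , divides t′ t≡ = refute (r ℕ.≟ 2)
      where
      g = gcd j h₂
      eg : ξ ^ g ≈ 1#
      eg = ^-gcd j h₂ e w
      h₂≡′ : h₂ ≡ t′ ℕ.* g ℕ.* r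
      h₂≡′ = ≡.trans h₂≡ (≡.trans (cong (ℕ._* g) t≡) (solve 3 (λ a r g → a :* r :* g := a :* g :* r) ≡.refl t′ r g))
        where open +-*-Solver
      refute : ¬ Dec (r ≡ 2)
      refute (yes ≡.refl) = u (^-lift (divides t′ (ℕ.*-cancelʳ-≡ h₄ (t′ ℕ.* g) 2 (≡.trans h₄*2≡h₂ h₂≡′))) eg)
      refute (no r≢2) = nr pr r≢2 r∣n (^-lift (divides (2 ℕ.* t′) (ℕ.*-cancelʳ-≡ (quotient n r) (2 ℕ.* t′ ℕ.* g) r {{prime⇒nonZero pr}} (≡.trans (quotient-* {{prime⇒nonZero pr}} r∣n) n≡))) eg)
        where
        open +-*-Solver
        n≡ : n ≡ 2 ℕ.* t′ ℕ.* g ℕ.* r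
        n≡ = ≡.trans (≡.sym (quotient-* 2∣n)) (≡.trans (cong (ℕ._* 2) h₂≡′) (solve 3 (λ a g r → a :* g :* r :* con 2 := con 2 :* a :* g :* r) ≡.refl t′ g r))
        r∣n : r ∣ n
        r∣n = divides (2 ℕ.* t′ ℕ.* g) n≡

  module _ (es ss : List ℕ) (adm : Admissible n es) (ext : All (λ ℓ → Extendable es (ℓ ∷ [])) ss) (holds : Holds es ss)
           (covered : ∀ {r} → Prime r → r ≢ 2 → r ∣ n → r ∈ es ++ ss) where

    private
      ss-primes : All OddPrime ss
      ss-primes = All.map (λ e → All.head (Admissible.primes (Extendable.d-admissible e))) ext

      margin-positive : 0 ℕ.< margin ss
      margin-positive = ℕ.n≢0⇒n>0 λ m≡0 → ℕ.n≮0 (ℕ.<-≤-trans holds (ℕ.≤-reflexive (cong (ℕ._* (R ℕ.* q)) m≡0)))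

      margin≡ : + margin ss ≡ + product ss ℤ.- + cofactors (product ss) ss
      margin≡ = ≡.sym (≡.trans (ℤ.m-n≡m⊖n (product ss) (cofactors (product ss) ss)) (ℤ.⊖-≥ {product ss} {cofactors (product ss) ss} (ℕ.<⇒≤ (ℕ.m∸n≢0⇒n<m {product ss} {cofactors (product ss) ss} (ℕ.>⇒≢ margin-positive)))))

      positive-cases : ∀ {a} → a ≡ 0ℤ → ¬ 0ℤ ℤ.< a
      positive-cases ≡.refl = ℤ.<-irrefl ≡.refl

    detected : ∀ {x} → ¬ x ≈ 0# → 0ℤ ℤ.< detector es ss x → x ^ h₂ ≈ 1# × ¬ x ^ h₄ ≈ 1# × All (NonResidue x) es × All (NonResidue x) ss
    detected {x} x≉0 pos with twoPart-value x≉0 | möbius-value x (Admissible.primes adm) | sieve-value (product ss) x ss-primes (all∣product ss)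
    ... | inj₁ z | _ | _ = contradiction pos (positive-cases (cong (λ a → (a ℤ.* möbius es x) ℤ.* (+ margin ss ℤ.- sieve (product ss) ss x)) z))
    ... | inj₂ _ | inj₁ z | _ = contradiction pos (positive-cases (≡.trans (cong (λ a → (twoPart x ℤ.* a) ℤ.* (+ margin ss ℤ.- sieve (product ss) ss x)) z) (cong (λ a → a ℤ.* (+ margin ss ℤ.- sieve (product ss) ss x)) (ℤ.*-zeroʳ (twoPart x)))))
    ... | inj₂ (_ , w , u) | inj₂ (_ , all) | inj₁ all′ = w , u , all , all′
    -- The first two factors are positive, but a sieving prime ℓ with x^(n/ℓ) = 1 pushes the sieve
    -- sum up to at least the margin, so the last factor is at most 0.
    ... | inj₂ (t≡4 , _) | inj₂ (mpos , _) | inj₂ h = contradiction pos (ℤ.≤⇒≯ (begin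
        (twoPart x ℤ.* möbius es x) ℤ.* (+ margin ss ℤ.- sieve (product ss) ss x)  ≡⟨ cong (λ a → (a ℤ.* möbius es x) ℤ.* (+ margin ss ℤ.- sieve (product ss) ss x)) t≡4 ⟩
        (+ 4 ℤ.* möbius es x) ℤ.* (+ margin ss ℤ.- sieve (product ss) ss x)  ≤⟨ ℤ.*-monoˡ-≤-nonNeg (+ 4 ℤ.* möbius es x) {{nonneg}} (ℤ.i≤j⇒i-j≤0 (ℤ.≤-trans (ℤ.≤-reflexive margin≡) h)) ⟩
        (+ 4 ℤ.* möbius es x) ℤ.* 0ℤ  ≡⟨ ℤ.*-zeroʳ (+ 4 ℤ.* möbius es x) ⟩
        0ℤ                                                                        ∎))
      where
      open ℤ.≤-Reasoning
      nonneg : ℤ.NonNegative (+ 4 ℤ.* möbius es x)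
      nonneg = ℤ.nonNegative (subst (ℤ._≤ + 4 ℤ.* möbius es x) (ℤ.*-zeroʳ (+ 4)) (ℤ.*-monoˡ-≤-nonNeg (+ 4) (ℤ.<⇒≤ mpos)))

    detector-cong : Respects (detector es ss)
    detector-cong {x} {y} e = cong₂ (λ a b → a ℤ.* (+ margin ss ℤ.- b))
      (cong₂ ℤ._*_ (cong₂ (λ a b → 1ℤ ℤ.+ a ℤ.- + 2 ℤ.* b) (sign-cong h₂ e refl) (sign-cong h₄ e refl)) (möbius-cong es)) (sieve-cong ss)
      where
      möbius-cong : ∀ es → möbius es x ≡ möbius es y
      möbius-cong [] = ≡.refl
      möbius-cong (r ∷ es) = cong₂ (λ a b → (+ (r ∸ 1) ℤ.- a) ℤ.* b) (kernₚ-cong r e refl) (möbius-cong es)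
      sieve-cong : ∀ rs → sieve (product ss) rs x ≡ sieve (product ss) rs y
      sieve-cong [] = ≡.refl
      sieve-cong (r ∷ rs) = cong₂ (λ a b → + quotient (product ss) r ℤ.* a ℤ.+ b) (kernₚ-cong r e refl) (sieve-cong rs)

    candidate : ∃ λ ξ → Trace ξ ≈ β × ξ ^ h₂ ≈ 1# × ¬ ξ ^ h₄ ≈ 1# × (∀ {r} → Prime r → r ≢ 2 → r ∣ n → NonResidue ξ r)
    candidate with any? {P = λ x → 0ℤ ℤ.< 𝟙T x ℤ.* detector es ss x} (λ e → subst (0ℤ ℤ.<_) (cong₂ ℤ._*_ (𝟙T-cong e) (detector-cong e))) (λ x → 0ℤ ℤ.<? 𝟙T x ℤ.* detector es ss x)
    ... | no ¬any = contradiction (detector-sum-positive es ss adm ext holds) (ℤ.≤⇒≯ (ℤ.≤-trans (∑-mono λ x → ℤ.≮⇒≥ λ h → ¬any (x , h)) (ℤ.≤-reflexive ∑-ε)))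
    ... | yes (ξ , pos) with Trace ξ ≟ β
    ...   | no _ = contradiction pos (ℤ.<-irrefl ≡.refl)
    ...   | yes tr with detected ξ≉0 (subst (0ℤ ℤ.<_) (ℤ.*-identityˡ (detector es ss ξ)) pos)
      where
      ξ≉0 : ¬ ξ ≈ 0#
      ξ≉0 e = Trace-0 e tr
    ...     | w , u , all , all′ = ξ , tr , w , u , λ {r} pr r≢2 r∣n → nonresidue (∈-++⁻ es (covered pr r≢2 r∣n))
      where
      nonresidue : ∀ {r} → r ∈ es ⊎ r ∈ ss → NonResidue ξ r
      nonresidue (inj₁ r∈) = All.lookup all r∈
      nonresidue (inj₂ r∈) = All.lookup all′ r∈

    two-primitive : ∃ λ ξ → TwoPrimitive K q ξ × Tr K q ξ ≈ β
    two-primitive with candidate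
    ... | ξ , tr , w , u , nr = ξ , order-h₂ w u nr , tr

-- Certificates and their verification by computation

open import Data.Nat
open import Data.Nat.Properties
open ≡ using (refl; sym; trans)

-- All that the existence argument needs to know about the number q, independently of the field and
-- of β.
record Certificate (q : ℕ) : Set where
  field
    R s          : ℕ
    R-nonZero    : NonZero R
    s/R≥√q       : R * R * q ≤ s * s
    es ss        : List ℕ
    primes       : All OddPrime (es ++ ss)
    divisors     : All (_∣ pred (q * q)) (es ++ ss)
    distinct     : AllPairs _≢_ (es ++ ss)
    covered      : ∀ {r} → Prime r → r ≢ 2 → r ∣ pred (q * q) → r ∈ es ++ ss
    holds        : Criterion.Holds q R s es ss

¬T-not : ∀ {b} → T (not b) → ¬ T b
¬T-not {false} _ ()

∣⇒∣ᵇ : ∀ d m .{{_ : NonZero d}} → d ∣ m → T (d ∣ᵇ m)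
∣⇒∣ᵇ (suc d) m h = ≡⇒≡ᵇ (m % suc d) 0 (n∣m⇒m%n≡0 m (suc d) h)

-- Trial division

-- The first argument is fuel. Running out of it answers `false`, so soundness requires no estimate
-- of how much is needed.
noDivisorFrom : ℕ → ℕ → ℕ → Bool
noDivisorFrom zero    d m = false
noDivisorFrom (suc f) d m = if m <ᵇ d * d then true else not (d ∣ᵇ m) ∧ noDivisorFrom f (suc d) m

isPrime : ℕ → Bool
isPrime m = (1 <ᵇ m) ∧ noDivisorFrom m 2 m

noDivisorFrom-sound : ∀ f d m → .{{NonTrivial m}} → .{{NonZero d}} → d Rough m → T (noDivisorFrom f d m) → Prime m
noDivisorFrom-sound (suc f) d m rough t with m <ᵇ d * d in eq
... | true  = rough∧square>⇒prime rough (<ᵇ⇒< m (d * d) (Equivalence.from T-≡ eq))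
... | false with T-both {not (d ∣ᵇ m)} t
...   | d∤m , t′ = noDivisorFrom-sound f (suc d) m (∤⇒rough-suc (λ h → ¬T-not d∤m (∣⇒∣ᵇ d m h)) rough) t′

isPrime-sound : ∀ m → T (isPrime m) → Prime m
isPrime-sound m t with T-both {1 <ᵇ m} t
... | 1<m , t′ = noDivisorFrom-sound m 2 m {{n>1⇒nonTrivial (<ᵇ⇒< 1 m 1<m)}} 2-rough t′

increasing : ℕ → List ℕ → Bool
increasing a []       = true
increasing a (b ∷ bs) = (a <ᵇ b) ∧ increasing b bs

allᵇ : (ℕ → Bool) → List ℕ → Bool
allᵇ f []       = true
allᵇ f (x ∷ xs) = f x ∧ allᵇ f xs

allᵇ-sound : ∀ f xs → T (allᵇ f xs) → All (T ∘ f) xs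
allᵇ-sound f []       _ = []
allᵇ-sound f (x ∷ xs) t with T-both {f x} t
... | tx , ts = tx ∷ allᵇ-sound f xs ts

increasing-sound : ∀ a xs → T (increasing a xs) → All (a <_) xs × AllPairs _<_ xs
increasing-sound a []       _ = [] , []
increasing-sound a (b ∷ bs) t with T-both {a <ᵇ b} t
... | a<ᵇb , t′ with increasing-sound b bs t′
...   | b< , pairs = <ᵇ⇒< a b a<ᵇb ∷ All.map (<-trans (<ᵇ⇒< a b a<ᵇb)) b< , b< ∷ pairs

-- Increasing from 2 makes the entries odd once they are prime, and distinct. The last test
-- certifies completeness without factoring n: a prime dividing a power of 2 ∏ ps is 2 or an entry.
isDivisorList : ℕ → ℕ → List ℕ → Bool
isDivisorList k n ps = increasing 2 ps ∧ (allᵇ isPrime ps ∧ (allᵇ (_∣ᵇ n) ps ∧ (n ∣ᵇ (2 * product ps) ^ k)))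

∣^⇒∣ : ∀ {r m} k → Prime r → r ∣ m ^ k → r ∣ m
∣^⇒∣ zero    pr r∣1 = contradiction (∣1⇒≡1 r∣1) (>⇒≢ (prime>1 pr))
∣^⇒∣ {r} {m} (suc k) pr r∣ with euclidsLemma m (m ^ k) pr r∣
... | inj₁ h = h
... | inj₂ h = ∣^⇒∣ k pr h

prime∣prime⇒≡ : ∀ {r p} → Prime r → Prime p → r ∣ p → r ≡ p
prime∣prime⇒≡ pr pp r∣p with prime⇒irreducible pp r∣p
... | inj₁ r≡1 = contradiction r≡1 (>⇒≢ (prime>1 pr))
... | inj₂ r≡p = r≡p

∣product⇒∈ : ∀ {r ps} → Prime r → All Prime ps → r ∣ product ps → r ∈ ps
∣product⇒∈ pr [] r∣1 = contradiction (∣1⇒≡1 r∣1) (>⇒≢ (prime>1 pr))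
∣product⇒∈ {r} {p ∷ ps} pr (pp ∷ pps) r∣ with euclidsLemma p (product ps) pr r∣
... | inj₁ h = here (prime∣prime⇒≡ pr pp h)
... | inj₂ h = there (∣product⇒∈ pr pps h)

record OddPrimeDivisors (n : ℕ) (ps : List ℕ) : Set where
  field
    primes   : All OddPrime ps
    divisors : All (_∣ n) ps
    sorted   : AllPairs _<_ ps
    covered  : ∀ {r} → Prime r → r ≢ 2 → r ∣ n → r ∈ ps

isDivisorList-sound : ∀ k n ps → T (isDivisorList k n ps) → OddPrimeDivisors n ps
isDivisorList-sound k n ps t with T-both {increasing 2 ps} t
... | t₁ , t′ with T-both {allᵇ isPrime ps} t′
... | t₂ , t″ with T-both {allᵇ (_∣ᵇ n) ps} t″
... | t₃ , t₄ = record
  { primes = All.zipWith (λ (pp , 2<p) → pp , >⇒≢ 2<p) (pps , proj₁ inc)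
  ; divisors = All.map (∣ᵇ⇒∣ _ n) (allᵇ-sound (_∣ᵇ n) ps t₃)
  ; sorted = proj₂ inc
  ; covered = covered
  }
  where
  inc = increasing-sound 2 ps t₁
  pps : All Prime ps
  pps = All.map (λ {m} → isPrime-sound m) (allᵇ-sound isPrime ps t₂)
  covered : ∀ {r} → Prime r → r ≢ 2 → r ∣ n → r ∈ ps
  covered pr r≢2 r∣n with euclidsLemma 2 (product ps) pr (∣^⇒∣ k pr (∣-trans r∣n (∣ᵇ⇒∣ n ((2 * product ps) ^ k) t₄)))
  ... | inj₁ r∣2 = contradiction (prime∣prime⇒≡ pr prime[2] r∣2) r≢2
  ... | inj₂ r∣P = ∣product⇒∈ pr pps r∣P

certificate : ∀ {q} es {ss} → OddPrimeDivisors (pred (q * q)) (es ++ ss) → ∀ R s → .{{NonZero R}} → R * R * q ≤ s * s →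
  Criterion.Holds q R s es ss → Certificate q
certificate es {ss} opd R s {{nz}} √ holds = record
  { R = R ; s = s ; R-nonZero = recompute-nonZero R ; s/R≥√q = √ ; es = es ; ss = ss ; primes = primes ; divisors = divisors
  ; distinct = AllPairs.map <⇒≢ sorted ; covered = covered ; holds = holds }
  where
  open OddPrimeDivisors opd
  recompute-nonZero : ∀ R → .{{NonZero R}} → NonZero R
  recompute-nonZero (suc R) = _

holdsᵇ : ℕ → ℕ → ℕ → List ℕ → List ℕ → Bool
holdsᵇ q R s es ss = (margin ss * mainError es + sieveError (product ss) es ss) <ᵇ (margin ss * (R * q))
  where open Criterion q R s

-- The soundness proofs hold for any hint, so the functions that compute hints need no proof.
record Hint : Set where
  field
    scale root exponent leastDivisor coprimePart : ℕ
    factors : List ℕ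

-- Two divisions of the primes are tried: sieve over all of them, or treat the smallest one by
-- Möbius inversion, since it has the largest reciprocal and costs the sieve most.
splitHolds : ℕ → ℕ → ℕ → List ℕ → Bool
splitHolds q R s []       = holdsᵇ q R s [] []
splitHolds q R s (p ∷ ps) = holdsᵇ q R s [] (p ∷ ps) ∨ holdsᵇ q R s (p ∷ []) ps

certifiedWith : ℕ → ℕ → ℕ → ℕ → List ℕ → Bool
certifiedWith q R s k ps = (0 <ᵇ R) ∧ ((R * R * q ≤ᵇ s * s) ∧ (isDivisorList k (pred (q * q)) ps ∧ splitHolds q R s ps))

certifiedWith-sound : ∀ q R s k ps → T (certifiedWith q R s k ps) → Certificate q
certifiedWith-sound q R s k ps t with T-both {0 <ᵇ R} t
... | t₀ , t with T-both {R * R * q ≤ᵇ s * s} t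
... | t₁ , t with T-both {isDivisorList k (pred (q * q)) ps} t
... | t₂ , t₃ = go ps (isDivisorList-sound k _ ps t₂) t₃
  where
  instance _ = >-nonZero (<ᵇ⇒< 0 R t₀)
  √ = ≤ᵇ⇒≤ (R * R * q) (s * s) t₁
  go : ∀ ps → OddPrimeDivisors (pred (q * q)) ps → T (splitHolds q R s ps) → Certificate q
  go [] opd t = certificate [] opd R s √ (<ᵇ⇒< _ _ t)
  go (p ∷ ps) opd t with T-either {holdsᵇ q R s [] (p ∷ ps)} t
  ... | inj₁ h = certificate [] opd R s √ (<ᵇ⇒< _ _ h)
  ... | inj₂ h = certificate (p ∷ []) opd R s √ (<ᵇ⇒< _ _ h)

-- q = d^i c with d prime, d ∤ c and c > 1 is not a prime power.
twoPrimes : ℕ → ℕ → ℕ → Bool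
twoPrimes q d c = isPrime d ∧ ((1 <ᵇ c) ∧ ((d ∣ᵇ q) ∧ ((c ∣ᵇ q) ∧ not (d ∣ᵇ c))))

twoPrimes-sound : ∀ q d c → T (twoPrimes q d c) → ¬ IsOddPrimePower q
twoPrimes-sound q d c t (_ , P , k , pP , _ , refl) with T-both {isPrime d} t
... | t₁ , t with T-both {1 <ᵇ c} t
... | t₂ , t with T-both {d ∣ᵇ P ^ k} t
... | t₃ , t with T-both {c ∣ᵇ P ^ k} t
... | t₄ , t₅ = ¬T-not t₅ (∣⇒∣ᵇ d c {{prime⇒nonZero pd}} (subst (_∣ c) (sym (prime∣prime⇒≡ pd pP (∣^⇒∣ k pd (∣ᵇ⇒∣ d _ t₃)))) P∣c))
  where
  pd = isPrime-sound d t₁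
  P∣c : P ∣ c
  P∣c with prime-divisor c (<ᵇ⇒< 1 c t₂)
  ... | r , pr , r∣c = subst (_∣ c) (prime∣prime⇒≡ pr pP (∣^⇒∣ k pr (∣-trans r∣c (∣ᵇ⇒∣ c _ t₄)))) r∣c

elemᵇ : ℕ → List ℕ → Bool
elemᵇ q []       = false
elemᵇ q (x ∷ xs) = (q ≡ᵇ x) ∨ elemᵇ q xs

elemᵇ-sound : ∀ q xs → T (elemᵇ q xs) → q ∈ xs
elemᵇ-sound q (x ∷ xs) t with T-either {q ≡ᵇ x} t
... | inj₁ h = here (≡ᵇ⇒≡ q x h)
... | inj₂ h = there (elemᵇ-sound q xs h)

settled : List ℕ → ℕ → Hint → Bool
settled xs q h = twoPrimes q leastDivisor coprimePart ∨ (certifiedWith q scale root exponent factors ∨ elemᵇ q xs)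
  where open Hint h

settled-sound : ∀ xs q h → T (settled xs q h) → IsOddPrimePower q → q ∉ xs → Certificate q
settled-sound xs q h t pp q∉ with T-either {twoPrimes q (Hint.leastDivisor h) (Hint.coprimePart h)} t
... | inj₁ t′ = contradiction pp (twoPrimes-sound q (Hint.leastDivisor h) (Hint.coprimePart h) t′)
... | inj₂ t′ with T-either {certifiedWith q (Hint.scale h) (Hint.root h) (Hint.exponent h) (Hint.factors h)} t′
...   | inj₁ t″ = certifiedWith-sound q (Hint.scale h) (Hint.root h) (Hint.exponent h) (Hint.factors h) t″
...   | inj₂ t″ = contradiction (elemᵇ-sound q xs t″) q∉

allSettled : (ℕ → Hint) → List ℕ → ℕ → ℕ → Bool
allSettled h xs zero    q = true
allSettled h xs (suc k) q = settled xs q (h q) ∧ allSettled h xs k (2 + q)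

allSettled-sound : ∀ h xs k q → T (allSettled h xs k q) → ∀ i → i < k → T (settled xs (i * 2 + q) (h (i * 2 + q)))
allSettled-sound h xs (suc k) q t i i<k with T-both {settled xs q (h q)} t
allSettled-sound h xs (suc k) q t zero    i<k       | t₁ , t₂ = t₁
allSettled-sound h xs (suc k) q t (suc i) (s≤s i<k) | t₁ , t₂ =
  subst (λ j → T (settled xs j (h j))) (trans (+-suc (i * 2) (suc q)) (cong suc (+-suc (i * 2) q))) (allSettled-sound h xs k (2 + q) t₂ i i<k)

strip : ℕ → ℕ → ℕ → ℕ
strip zero    d       m = m
strip (suc f) zero    m = m
strip (suc f) (suc d) m = if suc d ∣ᵇ m then strip f (suc d) (m / suc d) else m

leftovers : ℕ → ℕ → List ℕ
leftovers a b = if a <ᵇ b then keep a (keep b []) else keep b (keep a [])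
  where
  keep : ℕ → List ℕ → List ℕ
  keep a rs = if a ≤ᵇ 1 then rs else a ∷ rs

commonFactors : ℕ → ℕ → ℕ → ℕ → List ℕ
commonFactors zero    d a b = leftovers a b
commonFactors (suc f) d a b =
  if (d ∣ᵇ a) ∨ (d ∣ᵇ b) then d ∷ commonFactors f (2 + d) (strip 20 d a) (strip 20 d b)
  else commonFactors f (2 + d) a b

oddFactors : ℕ → List ℕ
oddFactors q = commonFactors 61 3 (strip 20 2 (pred q)) (strip 20 2 (suc q))

leastOddDivisor : ℕ → ℕ → ℕ → ℕ
leastOddDivisor zero    d q = d
leastOddDivisor (suc f) d q = if d ∣ᵇ q then d else leastOddDivisor f (2 + d) q

-- The least s with x ≤ s², provided r² < x ≤ (r + 2^k)².
rootFrom : ℕ → ℕ → ℕ → ℕ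
rootFrom x zero    r = suc r
rootFrom x (suc k) r = if (r + 2 ^ k) * (r + 2 ^ k) <ᵇ x then rootFrom x k (r + 2 ^ k) else rootFrom x k r

-- For q < 15401 the prime factors of q ± 1 left after division by 3, 5, …, 123 are single primes,
-- and (2 ∏ p)^28 is a multiple of q² − 1.
hint : ℕ → Hint
hint q = record
  { scale = 32 ; root = rootFrom (1024 * q) 13 0 ; exponent = 28
  ; leastDivisor = leastOddDivisor 61 3 q ; coprimePart = strip 20 (leastOddDivisor 61 3 q) q
  ; factors = oddFactors q }

-- Odd prime divisors of an arbitrary number

oddPrimeDivisor? : ∀ n r → Dec (OddPrime r × r ∣ n)
oddPrimeDivisor? n r = (prime? r ×-dec ¬? (r ≟ 2)) ×-dec (r ∣? n)

oddPrimeDivisors : ∀ n .{{_ : NonZero n}} → ∃ (OddPrimeDivisors n)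
oddPrimeDivisors n = filter (oddPrimeDivisor? n) (upTo (suc n)) , record
  { primes   = All.map proj₁ good
  ; divisors = All.map proj₂ good
  ; sorted   = AllPairs.filter⁺ (oddPrimeDivisor? n) (AllPairs.applyUpTo⁺₁ id (suc n) (λ i<j _ → i<j))
  ; covered  = λ pr r≢2 r∣n → ∈-filter⁺ (oddPrimeDivisor? n) (∈-upTo⁺ (s≤s (∣⇒≤ r∣n))) ((pr , r≢2) , r∣n)
  }
  where good = All.all-filter (oddPrimeDivisor? n) (upTo (suc n))

product∣ : ∀ {n d} → All Prime d → AllPairs _≢_ d → All (_∣ n) d → product d ∣ n
product∣ {n} [] [] [] = 1∣ n
product∣ {n} {ℓ ∷ d} (pℓ ∷ ps) (ℓ≢ ∷ ne) (ℓ∣n ∷ ds) with product∣ ps ne ds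
... | divides t n≡ with coprime-divisor (prime-coprime pℓ (prime∤product pℓ ps ℓ≢)) (subst (ℓ ∣_) (trans n≡ (*-comm t (product d))) ℓ∣n)
...   | divides t′ t≡ = divides t′ (trans n≡ (trans (cong (_* product d) t≡) (*-assoc t′ ℓ (product d))))

-- The product of the distinct primes divides n = 8 t and is odd, so the three factors 2 can be
-- cancelled one by one and it divides t.
8*product≤ : ∀ {n ps} .{{_ : NonZero n}} → 8 ∣ n → OddPrimeDivisors n ps → 8 * product ps ≤ n
8*product≤ {n} {ps} (divides t n≡) opd = ≤-trans (*-monoʳ-≤ 8 (∣⇒≤ {{t-nonZero}} P∣t)) (≤-reflexive (trans (*-comm 8 t) (sym n≡)))
  where
  open OddPrimeDivisors opd
  t-nonZero : NonZero t
  t-nonZero = ≢-nonZero λ t≡0 → ≢-nonZero⁻¹ n (trans n≡ (cong (_* 8) t≡0))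
  odd : Coprime (product ps) 2
  odd = Coprime.sym (prime-coprime prime[2] (2∤product primes))
  P∣8t : product ps ∣ 2 * (2 * (2 * t))
  P∣8t = subst (product ps ∣_) (trans n≡ (solve 1 (λ t → t :* con 8 := con 2 :* (con 2 :* (con 2 :* t))) refl t))
    (product∣ (All.map proj₁ primes) (AllPairs.map <⇒≢ sorted) divisors)
    where open +-*-Solver
  P∣t : product ps ∣ t
  P∣t = coprime-divisor odd (coprime-divisor odd (coprime-divisor odd P∣8t))

-- The i-th smallest odd prime divisor is at least the i-th odd prime.

primeFree : ℕ → ℕ → Bool
primeFree a zero    = true
primeFree a (suc k) = not (does (prime? (suc a))) ∧ primeFree (suc a) k

primeFree-sound : ∀ a k {p} → T (primeFree a k) → Prime p → a < p → a + k < p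
primeFree-sound a zero    t pp a<p = subst (_< _) (sym (+-identityʳ a)) a<p
primeFree-sound a (suc k) {p} t pp a<p with prime? (suc a) | T-both {not (does (prime? (suc a)))} t
... | no ¬p | _ , t′ = subst (_< p) (sym (+-suc a k)) (primeFree-sound (suc a) k t′ pp (≤∧≢⇒< a<p λ { refl → ¬p pp }))

-- Only the absence of primes strictly between neighbours is tested. That is all a lower bound for
-- the next prime requires; primality of the entries is not.
consecutivePrimes : ℕ → List ℕ → Bool
consecutivePrimes a []       = true
consecutivePrimes a (b ∷ bs) = primeFree a (b ∸ suc a) ∧ consecutivePrimes b bs

infix 4 _≼_
data _≼_ : List ℕ → List ℕ → Set where
  []  : ∀ {bs} → bs ≼ []
  _∷_ : ∀ {b p bs ps} → b ≤ p → bs ≼ ps → b ∷ bs ≼ p ∷ ps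

next-prime : ∀ {a b bs p} → T (consecutivePrimes a (b ∷ bs)) → Prime p → a < p → b ≤ p
next-prime {a} {b} t pp a<p = ≤-trans (m≤n+m∸n b (suc a)) (primeFree-sound a (b ∸ suc a) (proj₁ (T-both {primeFree a (b ∸ suc a)} t)) pp a<p)

primes-≼ : ∀ {a bs ps} → T (consecutivePrimes a bs) → All (a <_) ps → AllPairs _<_ ps → All Prime ps → length ps ≤ length bs → bs ≼ ps
primes-≼ {ps = []} t [] [] [] _ = []
primes-≼ {a} {b ∷ bs} {p ∷ ps} t (a<p ∷ _) (p< ∷ sorted) (pp ∷ pps) (s≤s len) =
  b≤p ∷ primes-≼ (proj₂ (T-both {primeFree a (b ∸ suc a)} t)) (All.map (≤-<-trans b≤p) p<) sorted pps len
  where b≤p = next-prime {bs = bs} t pp a<p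

≼-product : ∀ {bs ps} → bs ≼ ps → product (take (length ps) bs) ≤ product ps
≼-product {[]}    []          = ≤-refl
≼-product {_ ∷ _} []          = ≤-refl
≼-product         (b≤p ∷ b≼p) = *-mono-≤ b≤p (≼-product b≼p)

last : ℕ → List ℕ → ℕ
last a []       = a
last a (b ∷ bs) = last b bs

-- Primes beyond the length of the table exceed its last entry, so each of them contributes at least
-- c.
product-growth : ∀ {a bs ps} c → c ≤ suc (last a bs) → T (consecutivePrimes a bs) → All (a <_) ps → AllPairs _<_ ps → All Prime ps →
  ∀ v → length ps ≡ length bs + v → product bs * c ^ v ≤ product ps
product-growth {bs = []} {[]} c c≤ t [] [] [] zero _ = ≤-refl
product-growth {a} {[]} {p ∷ ps} c c≤ t (a<p ∷ a<) (p< ∷ sorted) (pp ∷ pps) (suc v) eq = begin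
  1 * (c * c ^ v)    ≡⟨ solve 2 (λ c x → con 1 :* (c :* x) := c :* (con 1 :* x)) refl c (c ^ v) ⟩
  c * (1 * c ^ v)  ≤⟨ *-mono-≤ (≤-trans c≤ a<p) (product-growth {a} {[]} c c≤ t a< sorted pps v (suc-injective eq)) ⟩
  p * product ps     ∎
  where
  open ≤-Reasoning
  open +-*-Solver
product-growth {a} {b ∷ bs} {p ∷ ps} c c≤ t (a<p ∷ _) (p< ∷ sorted) (pp ∷ pps) v eq = begin
  b * product bs * c ^ v    ≡⟨ *-assoc b (product bs) (c ^ v) ⟩
  b * (product bs * c ^ v)  ≤⟨ *-mono-≤ b≤p (product-growth {b} {bs} c c≤ (proj₂ (T-both {primeFree a (b ∸ suc a)} t)) (All.map (≤-<-trans b≤p) p<) sorted pps v (suc-injective eq)) ⟩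
  p * product ps            ∎
  where
  open ≤-Reasoning
  b≤p = next-prime {bs = bs} t pp a<p

-- Estimates for large q

-- An upper bound for 10000 · Σ 1/b over the first k entries, when the list has that many:
-- fixed-point arithmetic in which every term is rounded up.
reciprocals : ℕ → List ℕ → ℕ
reciprocals zero    bs       = 0
reciprocals (suc k) []       = 0
reciprocals (suc k) (b ∷ bs) = suc (quotient 10000 b) + reciprocals k bs

module _ (q s : ℕ) (1≤s : 1 ≤ s) where
  open Criterion q 1 s

  -- Here R = 1 ≤ s, so each of the 2^|es| weights is at most s. The gain from divisors of q + 1 is
  -- given up.
  bound≤ : ∀ b es → bound b es ≤ 2 ^ length es * s
  bound≤ true  [] = ≤-trans 1≤s (≤-reflexive (sym (*-identityˡ s)))
  bound≤ false [] = ≤-reflexive (sym (*-identityˡ s))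
  bound≤ b (ℓ ∷ es) = ≤-trans (+-mono-≤ (bound≤ b es) (bound≤ (b ∧ (ℓ ∣ᵇ suc q)) es))
    (≤-reflexive (solve 2 (λ x s → x :* s :+ x :* s := con 2 :* x :* s) refl (2 ^ length es) s))
    where open +-*-Solver

  deficit≤ : ∀ es → deficit es ≤ 2 ^ length es * s
  deficit≤ [] = z≤n
  deficit≤ (ℓ ∷ es) = ≤-trans (+-mono-≤ (deficit≤ es) (bound≤ (ℓ ∣ᵇ suc q) es))
    (≤-reflexive (solve 2 (λ x s → x :* s :+ x :* s := con 2 :* x :* s) refl (2 ^ length es) s))
    where open +-*-Solver

  mainError≤ : ∀ es → mainError es ≤ 4 * (2 ^ length es * s)
  mainError≤ es = ≤-trans (+-mono-≤ (+-mono-≤ (deficit≤ es) (bound≤ true es)) (*-monoʳ-≤ 2 (bound≤ (4 ∣ᵇ suc q) es)))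
    (≤-reflexive (solve 1 (λ x → x :+ x :+ con 2 :* x := con 4 :* x) refl (2 ^ length es * s)))
    where open +-*-Solver

  primeError≤ : ∀ es ℓ → primeError es ℓ ≤ 4 * (2 ^ length es * s)
  primeError≤ es ℓ = ≤-trans (+-mono-≤ (+-mono-≤ (bound≤ (ℓ ∣ᵇ suc q) es) (bound≤ (ℓ ∣ᵇ suc q) es)) (*-monoʳ-≤ 2 (bound≤ ((4 ∣ᵇ suc q) ∧ (ℓ ∣ᵇ suc q)) es)))
    (≤-reflexive (solve 1 (λ x → x :+ x :+ con 2 :* x := con 4 :* x) refl (2 ^ length es * s)))
    where open +-*-Solver

  möbius-holds : ∀ es → 4 * (2 ^ length es * s) < q → Holds es []
  möbius-holds es X<q = begin-strict
    1 * mainError es + 0    ≡⟨ solve 1 (λ x → con 1 :* x :+ con 0 := x) refl (mainError es) ⟩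
    mainError es            ≤⟨ mainError≤ es ⟩
    4 * (2 ^ length es * s) <⟨ X<q ⟩
    q                       ≡⟨ solve 1 (λ x → x := con 1 :* (con 1 :* x)) refl q ⟩
    1 * (1 * q)             ∎
    where
    open ≤-Reasoning
    open +-*-Solver

  cofactors≤ : ∀ {P bs rs} → All Prime rs → All (_∣ P) rs → All (0 <_) bs → bs ≼ rs → 10000 * cofactors P rs ≤ P * reciprocals (length rs) bs
  cofactors≤ {P} [] [] _ [] = ≤-reflexive (trans (*-zeroʳ 10000) (sym (*-zeroʳ P)))
  cofactors≤ {P} {b ∷ bs} {r ∷ rs} (pr ∷ ps) (r∣P ∷ ds) (0<b ∷ 0<) (b≤r ∷ b≼) = begin
    10000 * (w + cofactors P rs)               ≡⟨ *-distribˡ-+ 10000 w (cofactors P rs) ⟩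
    10000 * w + 10000 * cofactors P rs  ≤⟨ +-mono-≤ (≤-trans (*-monoˡ-≤ w (10000≤ b 0<b)) (≤-trans (*-monoˡ-≤ w (*-monoʳ-≤ c b≤r)) (≤-reflexive cw))) (cofactors≤ ps ds 0< b≼) ⟩
    P * c + P * reciprocals (length rs) bs     ≡⟨ *-distribˡ-+ P c (reciprocals (length rs) bs) ⟨
    P * (c + reciprocals (length rs) bs)       ∎
    where
    open ≤-Reasoning
    w = quotient P r
    c = suc (quotient 10000 b)
    cw : c * r * w ≡ P * c
    cw = trans (*-assoc c r w) (trans (*-comm c (r * w)) (cong (_* c) (trans (*-comm r w) (quotient-* {{prime⇒nonZero pr}} r∣P))))
    10000≤ : ∀ b → 0 < b → 10000 ≤ suc (quotient 10000 b) * b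
    10000≤ (suc b) _ = ≤-trans (≤-reflexive (m≡m%n+[m/n]*n 10000 (suc b))) (+-monoˡ-≤ (10000 / suc b * suc b) (<⇒≤ (m%n<n 10000 (suc b))))

  weights : ℕ → List ℕ → ℕ
  weights P []       = 0
  weights P (r ∷ rs) = quotient P r * (r ∸ 1) + weights P rs

  -- For each r the two terms are (P/r)(r - 1) and P/r, with sum P.
  weights+cofactors : ∀ {P rs} → All Prime rs → All (_∣ P) rs → weights P rs + cofactors P rs ≡ length rs * P
  weights+cofactors [] [] = refl
  weights+cofactors {P} {r ∷ rs} (pr ∷ ps) (r∣P ∷ ds) = trans
    (solve 4 (λ w r x y → (w :* r :+ x) :+ (w :+ y) := w :* (con 1 :+ r) :+ (x :+ y)) refl (quotient P r) (r ∸ 1) (weights P rs) (cofactors P rs))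
    (cong₂ _+_ (trans (cong (quotient P r *_) (suc-pred r {{prime⇒nonZero pr}})) (quotient-* {{prime⇒nonZero pr}} r∣P)) (weights+cofactors ps ds))
    where open +-*-Solver

  sieveError≤ : ∀ P es {Y} → 2 ^ length es ≤ Y → ∀ rs → sieveError P es rs ≤ 4 * (Y * s) * weights P rs
  sieveError≤ P es {Y} ≤Y [] = z≤n
  sieveError≤ P es {Y} ≤Y (r ∷ rs) = begin
    w * ((r ∸ 1) * primeError es r) + sieveError P es rs  ≤⟨ +-mono-≤ (*-monoʳ-≤ w (*-monoʳ-≤ (r ∸ 1) (≤-trans (primeError≤ es r) (*-monoʳ-≤ 4 (*-monoˡ-≤ s ≤Y))))) (sieveError≤ P es ≤Y rs) ⟩
    w * ((r ∸ 1) * (4 * (Y * s))) + 4 * (Y * s) * weights P rs ≡⟨ solve 4 (λ w r X y → w :* (r :* X) :+ X :* y := X :* (w :* r :+ y)) refl w (r ∸ 1) (4 * (Y * s)) (weights P rs) ⟩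
    4 * (Y * s) * (w * (r ∸ 1) + weights P rs)                 ∎
    where
    open ≤-Reasoning
    open +-*-Solver
    w = quotient P r

  -- With X = 4 Y s and k = |ss| ≥ 1, the total error is at most Δ X + X ((k - 1) P + Δ), where Δ is
  -- the margin. As Δ ≥ P δ / 10000, division by Δ leaves X (2 + (k - 1) · 10000 / δ) < q, which no
  -- longer involves the primes themselves.
  sieve-holds : ∀ es {Y ss ρ δ} → 2 ^ length es ≤ Y → All Prime ss → 10000 * cofactors (product ss) ss ≤ product ss * ρ → ρ + δ ≡ 10000 →
    4 * Y * (2 * δ + (length ss ∸ 1) * 10000) * s < δ * q → Holds es ss
  sieve-holds es {Y} {ss} {ρ} {δ} ≤Y ps cof≤ ρ+δ X<q = *-cancelˡ-< δ _ _ (begin-strict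
    δ * (Δ * mainError es + sieveError P es ss)  ≤⟨ *-monoʳ-≤ δ (+-mono-≤ (*-monoʳ-≤ Δ (≤-trans (mainError≤ es) (*-monoʳ-≤ 4 (*-monoˡ-≤ s ≤Y)))) (sieveError≤ P es ≤Y ss)) ⟩
    δ * (Δ * X + X * W)  ≡⟨ solve 4 (λ d D X W → d :* (D :* X :+ X :* W) := X :* (d :* D :+ d :* W)) refl δ Δ X W ⟩
    X * (δ * Δ + δ * W)  ≤⟨ *-monoʳ-≤ X (+-monoʳ-≤ (δ * Δ) (*-monoʳ-≤ δ (W≤ (length ss) (weights+cofactors ps (all∣product ss))))) ⟩
    X * (δ * Δ + δ * (j * P + Δ))  ≡⟨ solve 5 (λ d D X j P → X :* (d :* D :+ d :* (j :* P :+ D)) := X :* (con 2 :* d :* D :+ j :* (P :* d))) refl δ Δ X j P ⟩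
    X * (2 * δ * Δ + j * (P * δ))                ≤⟨ *-monoʳ-≤ X (+-monoʳ-≤ (2 * δ * Δ) (*-monoʳ-≤ j Pδ≤)) ⟩
    X * (2 * δ * Δ + j * (10000 * Δ))  ≡⟨ solve 6 (λ Y s d D j M → (con 4 :* (Y :* s)) :* (con 2 :* d :* D :+ j :* (M :* D)) := D :* (con 4 :* Y :* (con 2 :* d :+ j :* M) :* s)) refl Y s δ Δ j 10000 ⟩
    Δ * (4 * Y * (2 * δ + j * 10000) * s)        <⟨ *-monoʳ-< Δ {{Δ-nonZero}} X<q ⟩
    Δ * (δ * q)  ≡⟨ solve 3 (λ D d q → D :* (d :* q) := d :* (D :* (con 1 :* q))) refl Δ δ q ⟩
    δ * (Δ * (1 * q))                            ∎)
    where
    open ≤-Reasoning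
    open +-*-Solver
    P = product ss
    cof = cofactors P ss
    Δ = margin ss
    W = weights P ss
    X = 4 * (Y * s)
    j = length ss ∸ 1
    P-nonZero : NonZero P
    P-nonZero = go ps
      where
      go : ∀ {ss} → All Prime ss → NonZero (product ss)
      go [] = _
      go {r ∷ rs} (pr ∷ ps) = m*n≢0 r (product rs) {{prime⇒nonZero pr}} {{go ps}}
    cof≤P : cof ≤ P
    cof≤P = *-cancelˡ-≤ 10000 (≤-trans cof≤ (≤-trans (*-monoʳ-≤ P (≤-trans (m≤m+n ρ δ) (≤-reflexive ρ+δ))) (≤-reflexive (*-comm P 10000))))
    Δ+cof : Δ + cof ≡ P
    Δ+cof = m∸n+n≡m cof≤P
    Pδ≤ : P * δ ≤ 10000 * Δ
    Pδ≤ = +-cancelʳ-≤ (10000 * cof) (P * δ) (10000 * Δ) (begin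
      P * δ + 10000 * cof         ≤⟨ +-monoʳ-≤ (P * δ) cof≤ ⟩
      P * δ + P * ρ               ≡⟨ trans (sym (*-distribˡ-+ P δ ρ)) (cong (P *_) (trans (+-comm δ ρ) ρ+δ)) ⟩
      P * 10000                   ≡⟨ trans (*-comm P 10000) (cong (10000 *_) (sym Δ+cof)) ⟩
      10000 * (Δ + cof)           ≡⟨ *-distribˡ-+ 10000 Δ cof ⟩
      10000 * Δ + 10000 * cof     ∎)
    W≤ : ∀ k → W + cof ≡ k * P → W ≤ (k ∸ 1) * P + Δ
    W≤ zero    e = ≤-trans (≤-reflexive (m+n≡0⇒m≡0 W e)) z≤n
    W≤ (suc k) e = +-cancelʳ-≤ cof W (k * P + Δ) (≤-reflexive (trans e (trans (+-comm P (k * P)) (trans (cong (λ z → k * P + z) (sym Δ+cof)) (sym (+-assoc (k * P) Δ cof))))))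
    δ-nonZero : NonZero δ
    δ-nonZero = ≢-nonZero λ { refl → n≮0 X<q }
    Δ-nonZero : NonZero Δ
    Δ-nonZero = ≢-nonZero λ Δ≡0 → <⇒≱ (>-nonZero⁻¹ (P * δ) {{m*n≢0 P δ {{P-nonZero}} {{δ-nonZero}}}}) (≤-trans Pδ≤ (≤-reflexive (cong (10000 *_) Δ≡0)))

-- t + 1 is the square root of q rounded up, also when q is a square.
√-bounds : ∀ q → 0 < q → ∃ λ t → t * t < q × q ≤ suc t * suc t
√-bounds (suc zero) _ = 0 , s≤s z≤n , s≤s z≤n
√-bounds (suc (suc q)) _ with √-bounds (suc q) z<s
... | t , t²<q , q≤ with suc (suc q) ≤? suc t * suc t
...   | yes h = t , m<n⇒m<1+n t²<q , h
...   | no ¬h = suc t , ≰⇒> ¬h , ≤-trans (s≤s q≤) (*-mono-< (n<1+n (suc t)) (n<1+n (suc t)))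

square-cancel-< : ∀ {a b} → a * a < b * b → a < b
square-cancel-< a²<b² = ≰⇒> λ b≤a → <⇒≱ a²<b² (*-mono-≤ b≤a b≤a)

-- From m² < q follows m ≤ t, hence Z ≤ δ (t - 1) and Z (t + 1) ≤ δ (t² - 1) < δ q. The additional δ
-- in the hypothesis on Z pays for rounding √q up to t + 1.
threshold : ∀ {q t Z δ m} → t * t < q → q ≤ suc t * suc t → m * m < q → 0 < δ → Z + δ ≤ δ * m → Z * suc t < δ * q
threshold {q} {t} {Z} {δ} {m} t²<q q≤ m²<q 0<δ Z≤ = begin-strict
  Z * suc t                ≡⟨ solve 2 (λ Z t → Z :* (con 1 :+ t) := t :* Z :+ Z) refl Z t ⟩
  t * Z + Z                <⟨ +-monoʳ-< (t * Z) (<-≤-trans (m<m+n Z 0<δ) Z+δ≤) ⟩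
  t * Z + δ * t            ≤⟨ m≤m+n (t * Z + δ * t) δ ⟩
  t * Z + δ * t + δ        ≡⟨ solve 3 (λ t Z d → t :* Z :+ d :* t :+ d := t :* (Z :+ d) :+ d) refl t Z δ ⟩
  t * (Z + δ) + δ          ≤⟨ +-monoˡ-≤ δ (*-monoʳ-≤ t Z+δ≤) ⟩
  t * (δ * t) + δ          ≡⟨ solve 2 (λ t d → t :* (d :* t) :+ d := d :* (con 1 :+ t :* t)) refl t δ ⟩
  δ * suc (t * t)          ≤⟨ *-monoʳ-≤ δ t²<q ⟩
  δ * q                    ∎
  where
  open ≤-Reasoning
  open +-*-Solver
  m≤t : m ≤ t
  m≤t = ≤-pred (square-cancel-< (<-≤-trans m²<q q≤))
  Z+δ≤ : Z + δ ≤ δ * t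
  Z+δ≤ = ≤-trans Z≤ (*-monoʳ-≤ δ m≤t)

sieveMargin : ℕ → List ℕ → ℕ
sieveMargin k bs = 10000 ∸ reciprocals k bs

-- The coefficient of s in the hypothesis of `sieve-holds` for Y = 2: one prime is kept for Möbius
-- inversion and k primes are sieved.
sieveCost : ℕ → List ℕ → ℕ
sieveCost k bs = 4 * 2 * (2 * sieveMargin k bs + (k ∸ 1) * 10000)

-- One unit compensates for the rounding in the quotient, the other is the extra margin that
-- `threshold` asks for.
sieveThreshold : ℕ → List ℕ → ℕ
sieveThreshold k bs = 2 + quotient (sieveCost k bs) (sieveMargin k bs)

-- Two ways to ensure m² < q: from q ≥ Q, or from many prime divisors, since m⁴ ≤ 8 P ≤ q² - 1 < q².
exceeds : ℕ → ℕ → ℕ → Bool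
exceeds Q P m = (m * m <ᵇ Q) ∨ (m * m * (m * m) ≤ᵇ 8 * P)

sieveSuffices : ℕ → ℕ → List ℕ → ℕ → Bool
sieveSuffices Q b bs k = (reciprocals k bs ≤ᵇ 10000) ∧ ((0 <ᵇ sieveMargin k bs) ∧
  ((sieveCost k bs + sieveMargin k bs ≤ᵇ sieveMargin k bs * sieveThreshold k bs) ∧ exceeds Q (product (take (suc k) (b ∷ bs))) (sieveThreshold k bs)))

exceeds-sound : ∀ {q} Q P m → T (exceeds Q P m) → Q ≤ q → 8 * P ≤ pred (q * q) → 0 < q → m * m < q
exceeds-sound {q} Q P m t Q≤q P≤ 0<q with T-either {m * m <ᵇ Q} t
... | inj₁ h = <-≤-trans (<ᵇ⇒< (m * m) Q h) Q≤q
... | inj₂ h = square-cancel-< (≤-<-trans (≤-trans (≤ᵇ⇒≤ (m * m * (m * m)) (8 * P) h) P≤) (pred[n]<n {q * q} {{>-nonZero (*-mono-< 0<q 0<q)}}))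
  where
  pred[n]<n : ∀ {n} .{{_ : NonZero n}} → pred n < n
  pred[n]<n {suc n} = n<1+n n

2<-odd-primes : ∀ {n ps} → OddPrimeDivisors n ps → All (2 <_) ps
2<-odd-primes opd = All.map (λ (pp , p≢2) → ≤∧≢⇒< (prime>1 pp) (λ e → p≢2 (sym e))) (OddPrimeDivisors.primes opd)

module Large (Q b : ℕ) (bs : List ℕ)
  (table   : T (consecutivePrimes 2 (b ∷ bs)))
  (table>0 : All (0 <_) bs)
  (small   : T (exceeds Q 1 5))
  (sieves  : T (allᵇ (sieveSuffices Q b bs) (upTo (suc (length bs)))))
  (16≤     : 16 ≤ suc (last 2 (b ∷ bs)))
  (plain   : T (exceeds 0 (product (b ∷ bs)) (suc (4 * 2 ^ length (b ∷ bs)))))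
  {q : ℕ} (odd : q % 2 ≡ 1) (Q≤q : Q ≤ q) (1<q : 1 < q) where

  private
    n = pred (q * q)
    instance
      n-nonZero : NonZero n
      n-nonZero = >-nonZero (<⇒<pred (*-mono-< 1<q 1<q))
        where
        <⇒<pred : ∀ {m} → 1 < m → 0 < pred m
        <⇒<pred (s≤s h) = h
    ps = proj₁ (oddPrimeDivisors n)
    opd = proj₂ (oddPrimeDivisors n)
    0<q = <-trans z<s 1<q
    t = proj₁ (√-bounds q 0<q)
    t²<q = proj₁ (proj₂ (√-bounds q 0<q))
    q≤ = proj₂ (proj₂ (√-bounds q 0<q))
    q≤s² : 1 * 1 * q ≤ suc t * suc t
    q≤s² = ≤-trans (≤-reflexive (trans (*-assoc 1 1 q) (trans (*-identityˡ (1 * q)) (*-identityˡ q)))) q≤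

  short : ∀ ps → OddPrimeDivisors n ps → length ps ≤ length (b ∷ bs) → Certificate q
  -- Without odd prime divisors the condition is 4 (t + 1) < q, for which 5² < q suffices.
  short [] opd _ = certificate [] opd 1 (suc t) q≤s² (möbius-holds q (suc t) (s≤s z≤n) []
    (subst (_< q) (cong (4 *_) (sym (*-identityˡ (suc t)))) (subst (4 * suc t <_) (*-identityˡ q) (threshold {q} {t} {4} {1} {5} t²<q q≤
      (exceeds-sound {q} Q 1 5 small Q≤q (8*product≤ (8∣odd²-1 q odd) opd) 0<q) z<s ≤-refl))))
  short (p ∷ ps) opd len with primes-≼ {2} {b ∷ bs} {p ∷ ps} table (2<-odd-primes opd) (OddPrimeDivisors.sorted opd) (All.map proj₁ (OddPrimeDivisors.primes opd)) len
  ... | table≼@(_ ∷ bs≼) with All.lookup (allᵇ-sound (sieveSuffices Q b bs) (upTo (suc (length bs))) sieves) (∈-upTo⁺ len)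
  ... | u with T-both {reciprocals (length ps) bs ≤ᵇ 10000} u
  ... | u₁ , u with T-both {0 <ᵇ sieveMargin (length ps) bs} u
  ... | u₂ , u with T-both {sieveCost (length ps) bs + sieveMargin (length ps) bs ≤ᵇ sieveMargin (length ps) bs * sieveThreshold (length ps) bs} u
  ... | u₃ , u₄ = certificate (p ∷ []) opd 1 (suc t) q≤s² (sieve-holds q (suc t) (s≤s z≤n) (p ∷ []) {2} {ps} {reciprocals k bs} {sieveMargin k bs} ≤-refl pps
      (cofactors≤ q (suc t) (s≤s z≤n) pps (all∣product ps) table>0 bs≼) (m+[n∸m]≡n (≤ᵇ⇒≤ (reciprocals k bs) 10000 u₁))
      (threshold {q} {t} {sieveCost k bs} {sieveMargin k bs} {sieveThreshold k bs} t²<q q≤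
        (exceeds-sound {q} Q (product (take (suc k) (b ∷ bs))) (sieveThreshold k bs) u₄ Q≤q (≤-trans (*-monoʳ-≤ 8 (≼-product table≼)) (8*product≤ (8∣odd²-1 q odd) opd)) 0<q)
        (<ᵇ⇒< 0 (sieveMargin k bs) u₂) (≤ᵇ⇒≤ (sieveCost k bs + sieveMargin k bs) (sieveMargin k bs * sieveThreshold k bs) u₃)))
    where
    k = length ps
    pps = All.tail (All.map proj₁ (OddPrimeDivisors.primes opd))

  long : ∀ ps → OddPrimeDivisors n ps → ∀ v → length ps ≡ length (b ∷ bs) + v → Certificate q
  long ps opd v len = certificate ps (subst (OddPrimeDivisors n) (sym (++-identityʳ ps)) opd) 1 (suc t) q≤s² (möbius-holds q (suc t) (s≤s z≤n) ps
    (subst (_< q) (*-assoc 4 (2 ^ length ps) (suc t)) (subst (4 * 2 ^ length ps * suc t <_) (*-identityˡ q) (threshold {q} {t} {4 * 2 ^ length ps} {1} {m} t²<q q≤ m²<q z<s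
      (≤-reflexive (trans (+-comm (4 * 2 ^ length ps) 1) (sym (*-identityˡ m))))))))
    where
    m = suc (4 * 2 ^ length ps)
    L = length (b ∷ bs)
    w = 2 ^ v
    16^ : ∀ v → 2 ^ v * 2 ^ v * (2 ^ v * 2 ^ v) ≡ 16 ^ v
    16^ zero = refl
    16^ (suc v) = trans (solve 1 (λ x → (con 2 :* x) :* (con 2 :* x) :* ((con 2 :* x) :* (con 2 :* x)) := con 16 :* (x :* x :* (x :* x))) refl (2 ^ v)) (cong (16 *_) (16^ v))
      where open +-*-Solver
    m₀ = suc (4 * 2 ^ L)
    m≤ : m ≤ m₀ * w
    m≤ = begin
      suc (4 * 2 ^ length ps)      ≡⟨ cong (λ z → suc (4 * z)) (trans (cong (2 ^_) len) (^-distribˡ-+-* 2 L v)) ⟩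
      suc (4 * (2 ^ L * w))        ≡⟨ cong suc (sym (*-assoc 4 (2 ^ L) w)) ⟩
      1 + 4 * 2 ^ L * w            ≤⟨ +-monoˡ-≤ (4 * 2 ^ L * w) (m^n>0 2 v) ⟩
      m₀ * w                       ∎
      where open ≤-Reasoning
    m₀⁴≤ : m₀ * m₀ * (m₀ * m₀) ≤ 8 * product (b ∷ bs)
    m₀⁴≤ with T-either {m₀ * m₀ <ᵇ 0} plain
    ... | inj₁ ()
    ... | inj₂ h = ≤ᵇ⇒≤ (m₀ * m₀ * (m₀ * m₀)) (8 * product (b ∷ bs)) h
    m²<q : m * m < q
    m²<q = exceeds-sound {q} 0 (product ps) m (Equivalence.from T-∨ (inj₂ (≤⇒≤ᵇ m⁴≤))) z≤n (8*product≤ (8∣odd²-1 q odd) opd) 0<q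
      where
      open ≤-Reasoning
      open +-*-Solver
      m⁴≤ : m * m * (m * m) ≤ 8 * product ps
      m⁴≤ = begin
        m * m * (m * m)                           ≤⟨ *-mono-≤ (*-mono-≤ m≤ m≤) (*-mono-≤ m≤ m≤) ⟩
        m₀ * w * (m₀ * w) * (m₀ * w * (m₀ * w))  ≡⟨ solve 2 (λ x w → x :* w :* (x :* w) :* (x :* w :* (x :* w)) := x :* x :* (x :* x) :* (w :* w :* (w :* w))) refl m₀ w ⟩
        m₀ * m₀ * (m₀ * m₀) * (w * w * (w * w))   ≤⟨ *-mono-≤ m₀⁴≤ (≤-reflexive (16^ v)) ⟩
        8 * product (b ∷ bs) * 16 ^ v             ≡⟨ *-assoc 8 (product (b ∷ bs)) (16 ^ v) ⟩
        8 * (product (b ∷ bs) * 16 ^ v)  ≤⟨ *-monoʳ-≤ 8 (product-growth {2} {b ∷ bs} {ps} 16 16≤ table (2<-odd-primes opd) (OddPrimeDivisors.sorted opd) (All.map proj₁ (OddPrimeDivisors.primes opd)) v len) ⟩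
        8 * product ps                            ∎

  largeCertificate : Certificate q
  largeCertificate with ≤-total (length ps) (length (b ∷ bs))
  ... | inj₁ len = short ps opd len
  ... | inj₂ len = long ps opd (length ps ∸ length (b ∷ bs)) (sym (m+[n∸m]≡n len))

-- The two ranges of q

AllPairs-++⁻ : ∀ (es : List ℕ) {ss} → AllPairs _≢_ (es ++ ss) → AllPairs _≢_ es × All (λ r → All (_≢ r) es) ss
AllPairs-++⁻ []       ne        = [] , All.tabulate (λ _ → [])
AllPairs-++⁻ (e ∷ es) (e≢ ∷ ne) with AllPairs-++⁻ es ne
... | ne′ , cross = All.++⁻ˡ es e≢ ∷ ne′ , All.zipWith (λ (e≢r , ≢r) → e≢r ∷ ≢r) (All.++⁻ʳ es e≢ , cross)

certificate⇒two-primitive : ∀ {c ℓ} {q} → IsOddPrimePower q → Certificate q → (K : FiniteField (q * q) c ℓ) →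
  ∀ β → ¬ FiniteField._≈_ K β (FiniteField.0# K) → InBaseField K q β →
  ∃ λ ξ → TwoPrimitive K q ξ × FiniteField._≈_ K (Tr K q ξ) β
certificate⇒two-primitive {q = q} (odd , p , k , p-prime , 1≤k , q≡) cert K β β≉0 β-base =
  Detection.two-primitive q odd p-prime 1≤k q≡ K β β≉0 β-base R s {{R-nonZero}} s/R≥√q es ss adm
    (All.zipWith (λ ((pr , r∣n) , ≢r) → Existence.[ℓ]-extendable q odd p-prime 1≤k q≡ K β β≉0 β-base R s {{R-nonZero}} s/R≥√q adm pr r∣n ≢r)
      (All.zip (All.++⁻ʳ es primes , All.++⁻ʳ es divisors) , proj₂ (AllPairs-++⁻ es distinct)))
    holds covered
  where
  open Certificate cert
  adm = admissible (All.++⁻ˡ es primes) (All.++⁻ˡ es divisors) (proj₁ (AllPairs-++⁻ es distinct))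

-- Settled by evaluation for the 7699 odd numbers 3, 5, ..., 15399: each is shown not to be a prime
-- power, or satisfies the criterion, or is listed.
settledBelow15401 : T (allSettled hint exceptions 7699 3)
settledBelow15401 = tt

smallCertificate : ∀ {q} → q < 15401 → IsOddPrimePower q → q ∉ exceptions → Certificate q
smallCertificate {q} q<15401 (odd , pp) q∉ = go (q / 2) (trans (m≡m%n+[m/n]*n q 2) (cong (_+ q / 2 * 2) odd))
  where
  go : ∀ j → q ≡ 1 + j * 2 → Certificate q
  -- q = 1 is odd but lies below the checked range; it is p^0, which the condition 1 ≤ k excludes.
  go zero    refl = contradiction (sym (proj₂ (proj₂ (proj₂ (proj₂ pp))))) (>⇒≢ (1<prime-power (proj₁ (proj₂ (proj₂ pp))) (proj₁ (proj₂ (proj₂ (proj₂ pp))))))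
  go (suc i) refl = settled-sound exceptions q (hint q) t (odd , pp) q∉
    where
    i<7699 : i < 7699
    i<7699 = *-cancelʳ-< 2 i 7699 (≤-pred (≤-pred (≤-pred q<15401)))
    t : T (settled exceptions q (hint q))
    t = subst (λ j → T (settled exceptions j (hint j))) (+-comm (i * 2) 3) (allSettled-sound hint exceptions 7699 3 settledBelow15401 i i<7699)

-- With 3 in front there are 16 primes, the first number of odd primes for which (1 + 4 · 2^L)⁴ ≤ 8
-- ∏, so that Möbius inversion over all the primes succeeds without a sieve.
primesFrom5To59 : List ℕ
primesFrom5To59 = 5 ∷ 7 ∷ 11 ∷ 13 ∷ 17 ∷ 19 ∷ 23 ∷ 29 ∷ 31 ∷ 37 ∷ 41 ∷ 43 ∷ 47 ∷ 53 ∷ 59 ∷ []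

theorem6p8 : ∀ {c ℓ : Level} (q : ℕ) → IsOddPrimePower q → q ∉ exceptions →
    (K : FiniteField (q * q) c ℓ) →
    ∀ (β : FiniteField.Carrier K) → ¬ (FiniteField._≈_ K β (FiniteField.0# K)) → InBaseField K q β →
    ∃ λ (ξ : FiniteField.Carrier K) → TwoPrimitive K q ξ × FiniteField._≈_ K (Tr K q ξ) β
theorem6p8 q pp q∉ = certificate⇒two-primitive pp (cert (q <? 15401))
  where
  cert : Dec (q < 15401) → Certificate q
  cert (yes q<15401) = smallCertificate q<15401 pp q∉
  cert (no  q≮15401) = Large.largeCertificate 15401 3 primesFrom5To59 tt (All.tabulate {xs = primesFrom5To59} positive) tt tt (≤ᵇ⇒≤ 16 60 tt) tt
    (proj₁ pp) (≮⇒≥ q≮15401) (≤-trans (≤ᵇ⇒≤ 2 15401 tt) (≮⇒≥ q≮15401))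
    where
    positive : ∀ {b} → b ∈ primesFrom5To59 → 0 < b
    positive b∈ = All.lookup (All.map (λ {m} → <ᵇ⇒< 0 m) (allᵇ-sound (0 <ᵇ_) primesFrom5To59 tt)) b∈
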